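{- For every undirected capacitated graph $G=(V,E)$ with $n=|V|$ vertices and every terminal set $K\subset V$ with $|K|=k$, there exists a mimicking network (that is, a cut sparsifier of quality $1$) for $G$ and $K$ that has at most $M(k-1)$ vertices, where $M(k-1)$ is the $(k-1)$'th Dedekind number. Further, this mimicking network can be constructed in time polynomial in $n$ and $2^k$.
   Context: Graphs are finite, undirected, with edge capacities $c:E\to\mathbb{R}^+$. The cut function is $h_G(A)=\sum_{e\in\delta(A)}c(e)$ for $A\subseteq V$, where $\delta(A)$ is the set of edges with exactly one endpoint in $A$. For a terminal set $K\subset V$ and $U\subseteq K$, the terminal cut function is $h_K^G(U)=\min\{h_G(A): A\subseteq V,\ A\cap K=U\}$. A mimicking network for $(G,K)$ is an undirected capacitated graph $H=(V_H,E_H)$ with $K\subseteq V_H$ such that $h_K^H(U)=h_K^G(U)$ for every $U\subset K$. The vertices in $V_H\setminus K$ are called Steiner vertices. The $n$'th Dedekind number $M(n)$ is the number of antichains in the poset of all subsets of an $n$-element set ordered by inclusion (equivalently, the number of monotone Boolean functions of $n$ variables); roughly, $M(n)\approx 2^{\binom{n}{\lfloor n/2\rfloor}}$. -}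

module Defs where

open import Algebra.Bundles using (CommutativeRing)
open import Algebra.Structures using (IsCommutativeRing)
import Algebra.Definitions.RawMonoid as RawMonoidSum
open import Data.Bool.Base using (Bool; true; false; not; _xor_; if_then_else_)
open import Data.Fin.Base as Fin using (Fin; toℕ; fromℕ<)
open import Data.Fin.Subset using (Subset; inside; outside; _⊆_)
open import Data.Fin.Subset.Properties using (_⊆?_)
open import Data.List.Base using (List; []; _∷_; [_]; _++_; map; filter; length)
open import Data.List.Relation.Unary.AllPairs using (AllPairs; allPairs?)
open import Data.Nat.Base as ℕ using (ℕ; zero; suc)
import Data.Nat.Properties as ℕ
open import Data.Product.Base using (_×_; _,_; ∃; ∃-syntax; Σ-syntax)
open import Data.Vec.Base as Vec using (lookup; tabulate)
open import Function.Bundles using (_↣_; Injection)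
open import Function.Definitions using (Injective)
open import Level using (0ℓ)
open import Relation.Binary.Core using (Rel)
open import Relation.Binary.Definitions using (Decidable)
open import Relation.Binary.PropositionalEquality using (_≡_; refl)
open import Relation.Binary.Structures using (IsDecTotalOrder)
import Relation.Binary.Construct.NonStrictToStrict as Strict
open import Relation.Nullary.Decidable using (Dec; yes; no; does; ¬?; _×-dec_)
open import Relation.Nullary.Negation using (¬_)
open import Relation.Unary using (Pred)

------------------------------------------------------------------------
-- The real numbers

-- The real numbers, characterised (classically: uniquely, up to isomorphism)
-- as a complete ordered field.  The order is decidable, as in classical
-- mathematics and in the real RAM model.

record RealNumbers : Set₁ where
  infix  8 -_
  infixl 7 _*_
  infixl 6 _+_ _-_
  infix  4 _≈_ _≤_
  field
    Carrier : Set
    _≈_ _≤_ : Rel Carrier 0ℓ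
    _+_ _*_ : Carrier → Carrier → Carrier
    -_      : Carrier → Carrier
    0# 1#   : Carrier
    isCommutativeRing : IsCommutativeRing _≈_ _+_ _*_ -_ 0# 1#
    isDecTotalOrder   : IsDecTotalOrder _≈_ _≤_
    0≉1       : ¬ (0# ≈ 1#)
    inverse   : ∀ x → ¬ (x ≈ 0#) → ∃[ y ] x * y ≈ 1#
    +-monoˡ-≤ : ∀ z {x y} → x ≤ y → x + z ≤ y + z
    *-nonNeg  : ∀ {x y} → 0# ≤ x → 0# ≤ y → 0# ≤ x * y

  UpperBound : Pred Carrier 0ℓ → Pred Carrier 0ℓ
  UpperBound P b = ∀ x → P x → x ≤ b

  field
    supremum : (P : Pred Carrier 0ℓ) → ∃ P → ∃ (UpperBound P) →
               ∃[ s ] UpperBound P s × (∀ b → UpperBound P b → s ≤ b)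

  open IsDecTotalOrder isDecTotalOrder public using (_≤?_)
  open Strict _≈_ _≤_ public using (_<_)

  _-_ : Carrier → Carrier → Carrier
  x - y = x + - y

  commutativeRing : CommutativeRing 0ℓ 0ℓ
  commutativeRing = record { isCommutativeRing = isCommutativeRing }

  open RawMonoidSum (CommutativeRing.+-rawMonoid commutativeRing) public
    using (sum)

------------------------------------------------------------------------
-- Dedekind numbers

allSubsets : ∀ n → List (Subset n)
allSubsets zero    = [ Vec.[] ]
allSubsets (suc n) = map (outside Vec.∷_) (allSubsets n)
                  ++ map (inside  Vec.∷_) (allSubsets n)

-- If the entries of xs are distinct, sublists xs lists every subset of xs
-- exactly once.

sublists : ∀ {A : Set} → List A → List (List A)
sublists []       = [ [] ]
sublists (x ∷ xs) = sublists xs ++ map (x ∷_) (sublists xs)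

Incomparable : ∀ {n} → Rel (Subset n) 0ℓ
Incomparable A B = ¬ (A ⊆ B) × ¬ (B ⊆ A)

incomparable? : ∀ {n} → Decidable (Incomparable {n})
incomparable? A B = ¬? (A ⊆? B) ×-dec ¬? (B ⊆? A)

Antichain : ∀ {n} → Pred (List (Subset n)) 0ℓ
Antichain = AllPairs Incomparable

dedekind : ℕ → ℕ
dedekind n = length (filter (allPairs? incomparable?) (sublists (allSubsets n)))

_ : map dedekind (0 ∷ 1 ∷ 2 ∷ 3 ∷ []) ≡ 2 ∷ 3 ∷ 6 ∷ 20 ∷ []
_ = refl

------------------------------------------------------------------------
-- Graphs, terminal cuts and mimicking networks

module Networks (ℝ : RealNumbers) where
  open RealNumbers ℝ

  -- A simple undirected graph on Fin n.  An edge {u , v} is stored with its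
  -- smaller endpoint as source; injectivity of the endpoint map excludes
  -- parallel edges.

  record Graph (n : ℕ) : Set where
    field
      edges    : ℕ
      source   : Fin edges → Fin n
      target   : Fin edges → Fin n
      ordered  : ∀ e → source e Fin.< target e
      simple   : Injective _≡_ _≡_ (λ e → source e , target e)
      capacity : Fin edges → Carrier
      positive : ∀ e → 0# < capacity e

  open Graph public

  δ : ∀ {n} (G : Graph n) → Subset n → Subset (edges G)
  δ G A = tabulate λ e → lookup A (source G e) xor lookup A (target G e)

  cut : ∀ {n} → Graph n → Subset n → Carrier
  cut G A = sum λ e → if lookup (δ G A) e then capacity G e else 0#

  -- A set K of k terminals in Fin n is given by an enumeration of it, i.e. an
  -- injection whose image is K.  Subsets of K are then subsets of Fin k.
  -- Two graphs share the terminal set K when both carry such an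
  -- injection: the i-th terminal of one is identified with that of the other.

  Terminals : ℕ → ℕ → Set
  Terminals k n = Fin k ↣ Fin n

  _∩_ : ∀ {k n} → Subset n → Terminals k n → Subset k
  A ∩ K = tabulate λ i → lookup A (Injection.to K i)

  -- x = min { cut G A | A ∩ K = U }

  record IsTerminalCut {k n} (G : Graph n) (K : Terminals k n)
                       (U : Subset k) (x : Carrier) : Set where
    field
      attained : ∃[ A ] A ∩ K ≡ U × cut G A ≈ x
      minimal  : ∀ A → A ∩ K ≡ U → x ≤ cut G A

  -- H, with terminals K′, has the same terminal cut function as G.

  MimickingNetwork : ∀ {k n n′} → Graph n → Terminals k n →
                     Graph n′ → Terminals k n′ → Set
  MimickingNetwork {k} G K H K′ =
    ∀ (U : Subset k) → ∃[ x ] IsTerminalCut H K′ U x × IsTerminalCut G K U x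

------------------------------------------------------------------------
-- Programs for a real RAM

-- Memory consists of finitely many named arrays of naturals and of reals;
-- the names are fixed by the program, the indices are computed.  A scalar
-- variable is cell 0 of an array.

ArrayName : Set
ArrayName = ℕ

infixl 6 _⊕_ _⊖_
infixl 8 _[_]

data NatExp : Set where
  lit     : ℕ → NatExp
  _[_]    : ArrayName → NatExp → NatExp
  _⊕_ _⊖_ : NatExp → NatExp → NatExp

data RealExp : Set where
  0ʳ      : RealExp
  _[_]    : ArrayName → NatExp → RealExp
  _⊕_ _⊖_ : RealExp → RealExp → RealExp

data Test : Set where
  natLE  : NatExp → NatExp → Test
  realLE : RealExp → RealExp → Test
  neg    : Test → Test

infixr 4 _⨾_

data Program : Set where
  skip     : Program
  setNat   : ArrayName → NatExp → NatExp → Program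
  setReal  : ArrayName → NatExp → RealExp → Program
  _⨾_      : Program → Program → Program
  ifThenElse : Test → Program → Program → Program
  while    : Test → Program → Program

module Machine (ℝ : RealNumbers) where
  open RealNumbers ℝ
  open Networks ℝ

  Array : Set → Set
  Array A = ArrayName → ℕ → A

  write : ∀ {A} → Array A → ArrayName → ℕ → A → Array A
  write m a i v b j =
    if does (a ℕ.≟ b) then (if does (i ℕ.≟ j) then v else m b j) else m b j

  record Store : Set where
    field
      nats  : Array ℕ
      reals : Array Carrier

  open Store public

  ⟦_⟧ⁿ : NatExp → Store → ℕ
  ⟦ lit c ⟧ⁿ   σ = c
  ⟦ a [ i ] ⟧ⁿ σ = nats σ a (⟦ i ⟧ⁿ σ)
  ⟦ d ⊕ e ⟧ⁿ   σ = ⟦ d ⟧ⁿ σ ℕ.+ ⟦ e ⟧ⁿ σ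
  ⟦ d ⊖ e ⟧ⁿ   σ = ⟦ d ⟧ⁿ σ ℕ.∸ ⟦ e ⟧ⁿ σ

  ⟦_⟧ʳ : RealExp → Store → Carrier
  ⟦ 0ʳ ⟧ʳ      σ = 0#
  ⟦ a [ i ] ⟧ʳ σ = reals σ a (⟦ i ⟧ⁿ σ)
  ⟦ d ⊕ e ⟧ʳ   σ = ⟦ d ⟧ʳ σ + ⟦ e ⟧ʳ σ
  ⟦ d ⊖ e ⟧ʳ   σ = ⟦ d ⟧ʳ σ - ⟦ e ⟧ʳ σ

  ⟦_⟧ᵗ : Test → Store → Bool
  ⟦ natLE d e ⟧ᵗ  σ = does (⟦ d ⟧ⁿ σ ℕ.≤? ⟦ e ⟧ⁿ σ)
  ⟦ realLE d e ⟧ᵗ σ = does (⟦ d ⟧ʳ σ ≤? ⟦ e ⟧ʳ σ)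
  ⟦ neg b ⟧ᵗ      σ = not (⟦ b ⟧ᵗ σ)

  -- ⟨ P , σ ⟩⇓[ t ] τ: started in store σ, P halts after t steps in store τ.
  -- Each assignment and each test is one step: the expressions in it have a
  -- size fixed by the program.  There is no multiplication, so t steps create
  -- only naturals (and, from rational data, rationals) of bit length linear
  -- in t plus that of the input; unit cost thus hides no superpolynomial work.

  infix 3 ⟨_,_⟩⇓[_]_

  data ⟨_,_⟩⇓[_]_ : Program → Store → ℕ → Store → Set where
    ⇓skip : ∀ {σ} → ⟨ skip , σ ⟩⇓[ 1 ] σ
    ⇓nat  : ∀ {a i e σ} →
      ⟨ setNat a i e , σ ⟩⇓[ 1 ]
        record σ { nats = write (nats σ) a (⟦ i ⟧ⁿ σ) (⟦ e ⟧ⁿ σ) }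
    ⇓real : ∀ {a i e σ} →
      ⟨ setReal a i e , σ ⟩⇓[ 1 ]
        record σ { reals = write (reals σ) a (⟦ i ⟧ⁿ σ) (⟦ e ⟧ʳ σ) }
    ⇓seq  : ∀ {P Q σ τ υ s t} →
      ⟨ P , σ ⟩⇓[ s ] τ → ⟨ Q , τ ⟩⇓[ t ] υ → ⟨ P ⨾ Q , σ ⟩⇓[ s ℕ.+ t ] υ
    ⇓then : ∀ {b P Q σ τ t} → ⟦ b ⟧ᵗ σ ≡ true →
      ⟨ P , σ ⟩⇓[ t ] τ → ⟨ ifThenElse b P Q , σ ⟩⇓[ suc t ] τ
    ⇓else : ∀ {b P Q σ τ t} → ⟦ b ⟧ᵗ σ ≡ false →
      ⟨ Q , σ ⟩⇓[ t ] τ → ⟨ ifThenElse b P Q , σ ⟩⇓[ suc t ] τ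
    ⇓stop : ∀ {b P σ} → ⟦ b ⟧ᵗ σ ≡ false → ⟨ while b P , σ ⟩⇓[ 1 ] σ
    ⇓loop : ∀ {b P σ τ υ s t} → ⟦ b ⟧ᵗ σ ≡ true →
      ⟨ P , σ ⟩⇓[ s ] τ → ⟨ while b P , τ ⟩⇓[ t ] υ →
      ⟨ while b P , σ ⟩⇓[ suc (s ℕ.+ t) ] υ

  -- A graph with terminals occupies arrays 0 (numbers of vertices, terminals
  -- and edges), 1 (sources), 2 (targets) and 3 (terminals) of naturals and
  -- array 0 (capacities) of reals.

  record _Holds_,_ (σ : Store) {k n} (G : Graph n) (K : Terminals k n) : Set where
    field
      vertexCount   : nats σ 0 0 ≡ n
      terminalCount : nats σ 0 1 ≡ k
      edgeCount     : nats σ 0 2 ≡ edges G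
      sources       : ∀ e → nats σ 1 (toℕ e) ≡ toℕ (source G e)
      targets       : ∀ e → nats σ 2 (toℕ e) ≡ toℕ (target G e)
      terminals     : ∀ i → nats σ 3 (toℕ i) ≡ toℕ (Injection.to K i)
      capacities    : ∀ e → reals σ 0 (toℕ e) ≈ capacity G e

  padded : ∀ {A : Set} → A → ∀ {l} → (Fin l → A) → ℕ → A
  padded z {l} f i with i ℕ.<? l
  ... | yes i<l = f (fromℕ< i<l)
  ... | no  _   = z

  -- The store holding (G , K) in which all unused cells are zero.

  input : ∀ {k n} → Graph n → Terminals k n → Store
  input {k} {n} G K = record
    { nats  = λ { 0 0 → n
                ; 0 1 → k
                ; 0 2 → edges G
                ; 1 j → padded 0 (λ e → toℕ (source G e)) j
                ; 2 j → padded 0 (λ e → toℕ (target G e)) j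
                ; 3 j → padded 0 (λ i → toℕ (Injection.to K i)) j
                ; _ _ → 0 }
    ; reals = λ { 0 j → padded 0# (capacity G) j
                ; _ _ → 0# }
    }

  -- On input (G , K), P outputs (H , K′) within t steps.

  _On_,_Outputs_,_Within_ : ∀ {k n n′} → Program → Graph n → Terminals k n →
                            Graph n′ → Terminals k n′ → ℕ → Set
  P On G , K Outputs H , K′ Within t =
    ∃[ s ] Σ[ σ ∈ Store ]
      (⟨ P , input G K ⟩⇓[ s ] σ) × s ℕ.≤ t × (σ Holds H , K′)

{-# OPTIONS --safe #-}

-- Fix one terminal t.  For every set U of other terminals let T(U) be the least
-- minimum cut separating U from the remaining terminals; submodularity makes
-- U ↦ T(U) monotone.  Identify two vertices when they lie in the same T(U), and
-- merge parallel edges.  Every T(U) is a union of classes, so no terminal cut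
-- gets larger, and cuts of the quotient are cuts of the graph, so none gets
-- smaller (sides containing t are covered by complementation).  The class of v
-- is determined by the upward closed family {U | v ∈ T(U)}, hence by the
-- antichain of its minimal members, and there are M(k - 1) of those.
--
-- The sets T(U) are found by 2^(k-1) runs of a push–relabel algorithm.  Labels
-- stop at n; once all excess outside the sinks has label n, the vertices with
-- smaller label are those that reach a sink in the residual graph, and they
-- form T(U).

module Submission where

open import Defs
open import Algebra.Bundles using (CommutativeMonoid; CommutativeRing)
import Algebra.Properties.CommutativeSemigroup as CSG
import Algebra.Properties.Monoid.Sum as MonoidSum
open import Data.Bool.Base using (Bool; true; false; not; _∨_; _∧_; _xor_; if_then_else_)
open import Data.Bool.ListAction using (any)
open import Data.Bool.Properties using (∧-zeroʳ; xor-same; xor-comm; not-involutive)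
open import Data.Empty using (⊥; ⊥-elim)
open import Data.Fin.Base as Fin using (Fin; toℕ; fromℕ<; combine)
open import Data.Fin.Properties
  using (toℕ-inject₁; toℕ-fromℕ; toℕ<n; toℕ-fromℕ<; toℕ-injective; combine-injective; injective⇒≤; pigeonhole)
open import Data.Fin.Subset using (Subset; _⊆_)
open import Data.List.Base using (List; []; _∷_)
open import Data.List.Relation.Unary.All using (All; []; _∷_)
open import Data.Nat.Base
open import Data.Nat.Properties
open import Data.Nat.Tactic.RingSolver using (solve-∀)
open import Data.Product.Base using (_×_; _,_; Σ-syntax; ∃-syntax; proj₁; proj₂)
open import Data.Sum.Base using (_⊎_; inj₁; inj₂)
open import Data.Vec.Base using (lookup; tabulate)
open import Data.Vec.Properties using (lookup∘tabulate; tabulate∘lookup; tabulate-cong; lookup⇒[]=; []=⇒lookup)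
open import Function.Base using (case_of_; _∘_)
open import Function.Bundles using (Injection)
open import Level using (0ℓ)
open import Relation.Binary.Definitions using (tri<; tri≈; tri>)
open import Relation.Binary.PropositionalEquality as ≡
  using (_≡_; _≢_; ≢-sym; cong; cong₂; cong-app; subst; subst₂)
open import Relation.Binary.Structures using (IsDecTotalOrder)
open import Relation.Nullary.Decidable using (Dec; yes; no; does; dec-true; dec-false)
open import Relation.Nullary.Negation using (¬_; contradiction)

-- Correctness and running time come from one calculus: weakest preconditions in which no loop may
-- make more than a common number `B` of iterations. The cost is then a constant times `B` to the
-- loop depth, so only iteration bounds remain to be proved, and all of them follow from one
-- polynomial in n + 2^k.
--
-- Capacities are arbitrary reals, so progress of the flow algorithm cannot be measured by the
-- amount of flow moved. It is measured by a natural number built from labels and from the signs of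
-- excesses and residual capacities; this bounds the number of rounds by a polynomial in n alone.
--
-- Minimum cuts chosen arbitrarily among ties need not grow with U. The least ones do, and being
-- unique they do not depend on how they were computed.
--
-- The machine can neither multiply nor divide. Powers of two and binary digits are obtained by
-- doubling, and the sides of a vertex in all 2^(k-1) cuts are packed into one natural number, so
-- that two comparisons decide whether two vertices share a class.

-- A program logic with step counts for the real RAM

module WeakestPreconditions where
  open ≡ using (refl; sym; trans)

  for : ArrayName → NatExp → Program → Program
  for i e P = setNat i (lit 0) (lit 0)
            ⨾ while (natLE (i [ lit 0 ] ⊕ lit 1) e) (P ⨾ setNat i (lit 0) (i [ lit 0 ] ⊕ lit 1))

  when : List Test → Program → Program
  when []       P = P
  when (b ∷ bs) P = ifThenElse b (when bs P) skip

  -- There is no early exit: `f` ends at the last index that passes the tests. Its initial value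
  -- `e`, one past the range, signals failure.
  search : ArrayName → ArrayName → NatExp → List Test → Program
  search i f e bs = setNat f (lit 0) e ⨾ for i e (when bs (setNat f (lit 0) (i [ lit 0 ])))

  writesNat writesReal : Program → ArrayName → Bool
  writesNat skip               a = false
  writesNat (setNat b _ _)     a = does (b ≟ a)
  writesNat (setReal _ _ _)    a = false
  writesNat (P ⨾ Q)            a = writesNat P a ∨ writesNat Q a
  writesNat (ifThenElse _ P Q) a = writesNat P a ∨ writesNat Q a
  writesNat (while _ P)        a = writesNat P a
  writesReal skip               a = false
  writesReal (setNat _ _ _)     a = false
  writesReal (setReal b _ _)    a = does (b ≟ a)
  writesReal (P ⨾ Q)            a = writesReal P a ∨ writesReal Q a
  writesReal (ifThenElse _ P Q) a = writesReal P a ∨ writesReal Q a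
  writesReal (while _ P)        a = writesReal P a

  -- Running P takes at most coefficient P * B ^ degree P steps if none of its
  -- loops makes more than B iterations.

  coefficient degree : Program → ℕ
  coefficient skip               = 1
  coefficient (setNat _ _ _)     = 1
  coefficient (setReal _ _ _)    = 1
  coefficient (P ⨾ Q)            = coefficient P + coefficient Q
  coefficient (ifThenElse _ P Q) = 1 + (coefficient P + coefficient Q)
  coefficient (while _ P)        = 2 + coefficient P
  degree skip               = 0
  degree (setNat _ _ _)     = 0
  degree (setReal _ _ _)    = 0
  degree (P ⨾ Q)            = degree P ⊔ degree Q
  degree (ifThenElse _ P Q) = degree P ⊔ degree Q
  degree (while _ P)        = suc (degree P)

  ≡ᵇ-refl : ∀ n → (n ≡ᵇ n) ≡ true
  ≡ᵇ-refl zero    = refl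
  ≡ᵇ-refl (suc n) = ≡ᵇ-refl n

  false≢true : ¬ (false ≡ true)
  false≢true ()

  from-does : ∀ {A : Set} (d : Dec A) → does d ≡ true → A
  from-does (yes a) _ = a

  from-does-false : ∀ {A : Set} (d : Dec A) → does d ≡ false → ¬ A
  from-does-false (no ¬a) _ = ¬a

  ∧-true : ∀ {x y} → x ∧ y ≡ true → x ≡ true × y ≡ true
  ∧-true {true} e = refl , e

  not-true : ∀ {x} → not x ≡ true → x ≡ false
  not-true {false} _ = refl

  not-false : ∀ {x} → not x ≡ false → x ≡ true
  not-false {true} _ = refl

  ∨-false : ∀ {x y} → x ∨ y ≡ false → x ≡ false × y ≡ false
  ∨-false {false} {false} _ = refl , refl

  module Logic (ℝ : RealNumbers) (B : ℕ) .{{_ : NonZero B}} where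
    open RealNumbers ℝ using (Carrier)
    open Machine ℝ

    Assertion : Set₁
    Assertion = Store → Set

    -- Recursion is on an iteration budget and the body enters as a predicate transformer, which
    -- keeps `WP` structurally recursive in the program. With budget 0 the guard has to be false.
    Loop : Test → (Store → Assertion → Set) → ℕ → Store → Assertion → Set
    Loop b W zero    σ Q = ⟦ b ⟧ᵗ σ ≡ false × Q σ
    Loop b W (suc t) σ Q = (⟦ b ⟧ᵗ σ ≡ false → Q σ)
                         × (⟦ b ⟧ᵗ σ ≡ true → W σ (λ τ → Loop b W t τ Q))

    -- Weakest precondition for: P halts in a store satisfying Q, and no loop
    -- makes more than B iterations.

    WP : Program → Store → Assertion → Set
    WP skip               σ Q = Q σ
    WP (setNat a i e)     σ Q = Q (record σ { nats = write (nats σ) a (⟦ i ⟧ⁿ σ) (⟦ e ⟧ⁿ σ) })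
    WP (setReal a i e)    σ Q = Q (record σ { reals = write (reals σ) a (⟦ i ⟧ⁿ σ) (⟦ e ⟧ʳ σ) })
    WP (P ⨾ P′)           σ Q = WP P σ (λ τ → WP P′ τ Q)
    WP (ifThenElse b P P′) σ Q = (⟦ b ⟧ᵗ σ ≡ true → WP P σ Q) × (⟦ b ⟧ᵗ σ ≡ false → WP P′ σ Q)
    WP (while b P)        σ Q = ∃[ t ] t ≤ B × Loop b (WP P) t σ Q

    WP-mono : ∀ P {σ} {Q Q′ : Assertion} → (∀ τ → Q τ → Q′ τ) → WP P σ Q → WP P σ Q′
    WP-mono skip            f w = f _ w
    WP-mono (setNat a i e)  f w = f _ w
    WP-mono (setReal a i e) f w = f _ w
    WP-mono (P ⨾ P′)        f w = WP-mono P (λ τ → WP-mono P′ f) w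
    WP-mono (ifThenElse b P P′) f (w , w′) = (λ e → WP-mono P f (w e)) , (λ e → WP-mono P′ f (w′ e))
    WP-mono (while b P) {σ} {Q} {Q′} f (t , t≤B , w) = t , t≤B , go t w
      where
      go : ∀ t {σ} → Loop b (WP P) t σ Q → Loop b (WP P) t σ Q′
      go zero    (e , q) = e , f _ q
      go (suc t) (q , w) = (λ e → f _ (q e)) , (λ e → WP-mono P (λ τ → go t) (w e))

    -- What may change is read off the syntax, so for concrete programs the side conditions hold by
    -- `refl`. Equating whole arrays, not cells, allows substitution in predicates on arrays without
    -- function extensionality.
    record Unchanged (P : Program) (σ τ : Store) : Set where
      constructor unchanged
      field
        nats-≡  : ∀ a → writesNat P a ≡ false → nats τ a ≡ nats σ a
        reals-≡ : ∀ a → writesReal P a ≡ false → reals τ a ≡ reals σ a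
    open Unchanged public

    write-other : ∀ {A : Set} (m : Array A) a i v b → does (a ≟ b) ≡ false → write m a i v b ≡ m b
    write-other m a i v b e with does (a ≟ b) | e
    ... | false | refl = refl

    setNat-unchanged : ∀ a i e {σ} → Unchanged (setNat a i e) σ (record σ { nats = write (nats σ) a (⟦ i ⟧ⁿ σ) (⟦ e ⟧ⁿ σ) })
    setNat-unchanged a i e {σ} = unchanged (write-other (nats σ) a (⟦ i ⟧ⁿ σ) (⟦ e ⟧ⁿ σ)) (λ _ _ → refl)

    -- Every specification acquires its frame condition here, so specifications mention only the
    -- arrays that they are about.
    WP-frame : ∀ P {σ} {Q : Assertion} → WP P σ Q → WP P σ (λ τ → Unchanged P σ τ × Q τ)
    WP-frame skip w = unchanged (λ _ _ → refl) (λ _ _ → refl) , w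
    WP-frame (setNat a i e) w = setNat-unchanged a i e , w
    WP-frame (setReal a i e) {σ} w =
      unchanged (λ _ _ → refl) (write-other (reals σ) a (⟦ i ⟧ⁿ σ) (⟦ e ⟧ʳ σ)) , w
    WP-frame (P ⨾ P′) w =
      WP-mono P (λ τ (u , w′) → WP-mono P′ (λ υ (u′ , q) → unchanged
        (λ a e → trans (nats-≡ u′ a (proj₂ (∨-false e))) (nats-≡ u a (proj₁ (∨-false e))))
        (λ a e → trans (reals-≡ u′ a (proj₂ (∨-false e))) (reals-≡ u a (proj₁ (∨-false e)))) , q)
        (WP-frame P′ w′)) (WP-frame P w)
    WP-frame (ifThenElse b P P′) (w , w′) =
      (λ e → WP-mono P (λ τ (u , q) → unchanged
        (λ a e → nats-≡ u a (proj₁ (∨-false e)))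
        (λ a e → reals-≡ u a (proj₁ (∨-false e))) , q) (WP-frame P (w e))) ,
      (λ e → WP-mono P′ (λ τ (u , q) → unchanged
        (λ a e → nats-≡ u a (proj₂ (∨-false e)))
        (λ a e → reals-≡ u a (proj₂ (∨-false e))) , q) (WP-frame P′ (w′ e)))
    WP-frame (while b P) {σ} {Q} (t , t≤B , w) =
      t , t≤B , go t (unchanged (λ _ _ → refl) (λ _ _ → refl)) w
      where
      go : ∀ t {υ} → Unchanged (while b P) σ υ → Loop b (WP P) t υ Q →
           Loop b (WP P) t υ (λ τ → Unchanged (while b P) σ τ × Q τ)
      go zero    u (e , q) = e , u , q
      go (suc t) u (q , w) = (λ e → u , q e) , (λ e →
        WP-mono P (λ τ (u′ , w′) → go t (unchanged
          (λ a e → trans (nats-≡ u′ a e) (nats-≡ u a e))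
          (λ a e → trans (reals-≡ u′ a e) (reals-≡ u a e))) w′) (WP-frame P (w e)))

    after : ∀ P {σ} {Q Q′ : Assertion} → WP P σ Q → (∀ τ → Unchanged P σ τ → Q τ → Q′ τ) → WP P σ Q′
    after P w f = WP-mono P (λ τ (u , q) → f τ u q) (WP-frame P w)

    steps : Program → ℕ
    steps P = coefficient P * B ^ degree P

    steps-mono : ∀ c {d e} → d ≤ e → c * B ^ d ≤ c * B ^ e
    steps-mono c d≤e = *-monoʳ-≤ c (^-monoʳ-≤ B d≤e)

    steps-+ : ∀ c c′ d d′ → c * B ^ d + c′ * B ^ d′ ≤ (c + c′) * B ^ (d ⊔ d′)
    steps-+ c c′ d d′ = ≤-trans (+-mono-≤ (steps-mono c (m≤m⊔n d d′)) (steps-mono c′ (m≤n⊔m d d′)))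
      (≤-reflexive (sym (*-distribʳ-+ (B ^ (d ⊔ d′)) c c′)))

    1≤B^ : ∀ d → 1 ≤ B ^ d
    1≤B^ d = m^n>0 B d

    WP-sound : ∀ P {σ} {Q : Assertion} → WP P σ Q →
               ∃[ s ] Σ[ τ ∈ Store ] (⟨ P , σ ⟩⇓[ s ] τ) × s ≤ steps P × Q τ
    WP-sound skip            w = 1 , _ , ⇓skip , ≤-refl , w
    WP-sound (setNat a i e)  w = 1 , _ , ⇓nat , ≤-refl , w
    WP-sound (setReal a i e) w = 1 , _ , ⇓real , ≤-refl , w
    WP-sound (P ⨾ P′) w =
      let s , τ , r , s≤ , w′ = WP-sound P w
          s′ , υ , r′ , s′≤ , q = WP-sound P′ w′
      in s + s′ , υ , ⇓seq r r′ ,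
         ≤-trans (+-mono-≤ s≤ s′≤) (steps-+ (coefficient P) (coefficient P′) (degree P) (degree P′)) , q
    WP-sound (ifThenElse b P P′) {σ} (w , w′) with ⟦ b ⟧ᵗ σ in eq
    ... | true  = let s , τ , r , s≤ , q = WP-sound P (w refl) in
      suc s , τ , ⇓then eq r ,
      +-mono-≤ (1≤B^ (degree P ⊔ degree P′)) (≤-trans s≤ (≤-trans (m≤m+n _ (steps P′)) (steps-+ (coefficient P) (coefficient P′) (degree P) (degree P′)))) , q
    ... | false = let s , τ , r , s≤ , q = WP-sound P′ (w′ refl) in
      suc s , τ , ⇓else eq r ,
      +-mono-≤ (1≤B^ (degree P ⊔ degree P′)) (≤-trans s≤ (≤-trans (m≤n+m _ (steps P)) (steps-+ (coefficient P) (coefficient P′) (degree P) (degree P′)))) , q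
    WP-sound (while b P) {σ} {Q} (t , t≤B , w) =
      let s , τ , r , s≤ , q = go t w in s , τ , r , ≤-trans s≤ bound , q
      where
      open ≤-Reasoning
      S = steps P
      go : ∀ t {σ} → Loop b (WP P) t σ Q →
           ∃[ s ] Σ[ τ ∈ Store ] (⟨ while b P , σ ⟩⇓[ s ] τ) × s ≤ suc (t * suc S) × Q τ
      go zero    (e , q) = 1 , _ , ⇓stop e , ≤-refl , q
      go (suc t) {σ} (q , w) with ⟦ b ⟧ᵗ σ in eq
      ... | false = 1 , σ , ⇓stop eq , s≤s z≤n , q refl
      ... | true  =
        let s , τ , r , s≤ , w′ = WP-sound P (w refl)
            s′ , υ , r′ , s′≤ , q = go t w′
        in suc (s + s′) , υ , ⇓loop eq r r′ ,
           s≤s (≤-trans (+-mono-≤ s≤ s′≤) (≤-reflexive (+-suc S (t * suc S)))) , q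
      -- One step for the last guard, and `suc S` for each guard with its body. Both extra units are
      -- absorbed into powers of `B`, whence the 2 in `coefficient`.
      bound : suc (t * suc S) ≤ (2 + coefficient P) * B ^ suc (degree P)
      bound = begin
        1 + t * (1 + S)         ≤⟨ +-mono-≤ (1≤B^ (suc (degree P))) (*-mono-≤ t≤B (+-monoˡ-≤ S (1≤B^ (degree P)))) ⟩
        Y + B * (B ^ degree P + coefficient P * B ^ degree P) ≡⟨ cong (Y +_) (*-distribˡ-+ B _ _) ⟩
        Y + (Y + B * (coefficient P * B ^ degree P)) ≡⟨ cong (λ z → Y + (Y + z)) lem ⟩
        Y + (Y + coefficient P * Y) ∎
        where
        Y = B ^ suc (degree P)
        lem : B * (coefficient P * B ^ degree P) ≡ coefficient P * Y
        lem = trans (sym (*-assoc B (coefficient P) _)) (trans (cong (_* B ^ degree P) (*-comm B (coefficient P))) (*-assoc (coefficient P) B _))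

    -- The invariant I t holds when t iterations are still allowed.

    while-rule : ∀ {b P σ} {Q : Assertion} (I : ℕ → Assertion) t →
                 (∀ s τ → I s τ → ⟦ b ⟧ᵗ τ ≡ false → Q τ) →
                 (∀ τ → I 0 τ → ⟦ b ⟧ᵗ τ ≡ false) →
                 (∀ s τ → I (suc s) τ → ⟦ b ⟧ᵗ τ ≡ true → WP P τ (I s)) →
                 t ≤ B → I t σ → WP (while b P) σ Q
    while-rule {b} {P} {σ} {Q} I t done stop step t≤B i = t , t≤B , go t i
      where
      go : ∀ t {σ} → I t σ → Loop b (WP P) t σ Q
      go zero    i = stop _ i , done 0 _ i (stop _ i)
      go (suc t) i = done (suc t) _ i , λ e → WP-mono P (λ τ → go t) (step t _ i e)

    setN : ArrayName → ℕ → ℕ → Store → Store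
    setN a i v σ = record σ { nats = write (nats σ) a i v }

    write-same : ∀ {A : Set} (m : Array A) a i v → write m a i v a i ≡ v
    write-same m a i v rewrite ≡ᵇ-refl a | ≡ᵇ-refl i = refl

    Unchanged-refl : ∀ P {σ} → Unchanged P σ σ
    Unchanged-refl P = unchanged (λ _ _ → refl) (λ _ _ → refl)

    -- The bound `e` is evaluated anew before each iteration, so it has to equal `b` in every store
    -- reachable up to the frame of the loop. `J` ties the budget to the counter by
    -- `nats τ i 0 + s ≡ b`; hence the budget runs out exactly when the guard fails.
    for-rule : ∀ i e P {σ} {Q : Assertion} (I : ℕ → Assertion) b → b ≤ B → writesNat P i ≡ false →
               (∀ τ → Unchanged (for i e P) σ τ → ⟦ e ⟧ⁿ τ ≡ b) →
               I 0 (setN i 0 0 σ) →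
               (∀ τ → Unchanged (for i e P) σ τ → nats τ i 0 < b → I (nats τ i 0) τ →
                 WP P τ (λ υ → I (suc (nats τ i 0)) (setN i 0 (nats υ i 0 + 1) υ))) →
               (∀ τ → Unchanged (for i e P) σ τ → I b τ → Q τ) →
               WP (for i e P) σ Q
    for-rule i e P {σ} {Q} I b b≤B fresh bound start step finish =
      while-rule {b = natLE (i [ lit 0 ] ⊕ lit 1) e} {P ⨾ setNat i (lit 0) (i [ lit 0 ] ⊕ lit 1)} J b
        (λ { s τ (u , c≤b , eq , j) stop → finish τ u (subst (λ z → I z τ) (≤-antisym c≤b (≮⇒≥ (λ lt → false≢true
              (trans (sym stop) (dec-true (_ ≤? _) (subst₂ _≤_ (+-comm 1 _) (sym (bound τ u)) lt))))) ) j) })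
        (λ { τ (u , c≤b , eq , j) → dec-false (_ ≤? _) (λ le → <-irrefl (trans (sym (+-identityʳ _)) eq)
              (subst₂ _≤_ (+-comm (nats τ i 0) 1) (bound τ u) le)) })
        (λ { s τ (u , c≤b , eq , j) go →
          let c<b = subst₂ _≤_ (+-comm (nats τ i 0) 1) (bound τ u) (from-does (_ ≤? _) go) in
          WP-mono P (λ υ (u′ , j′) →
            let new = trans (write-same (nats υ) i 0 _) (trans (+-comm (nats υ i 0) 1) (cong suc (cong-app (nats-≡ u′ i fresh) 0))) in
            advance u u′ ,
            subst (_≤ b) (sym new) c<b ,
            trans (cong (_+ s) new) (trans (sym (+-suc _ s)) eq) ,
            subst (λ z → I z (setN i 0 (nats υ i 0 + 1) υ)) (sym new) j′)
            (WP-frame P (step τ u c<b j)) })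
        b≤B (before , subst (_≤ b) (sym zero′) z≤n , cong (_+ b) zero′ , subst (λ z → I z (setN i 0 0 σ)) (sym zero′) start)
      where
      J : ℕ → Assertion
      J s τ = Unchanged (for i e P) σ τ × nats τ i 0 ≤ b × nats τ i 0 + s ≡ b × I (nats τ i 0) τ
      zero′ : nats (setN i 0 0 σ) i 0 ≡ 0
      zero′ = write-same (nats σ) i 0 0
      before : Unchanged (for i e P) σ (setN i 0 0 σ)
      before = unchanged (λ a eq → write-other (nats σ) i 0 0 a (proj₁ (∨-false eq))) (λ _ _ → refl)
      advance : ∀ {τ υ} → Unchanged (for i e P) σ τ → Unchanged P τ υ →
              Unchanged (for i e P) σ (setN i 0 (nats υ i 0 + 1) υ)
      advance {τ} {υ} u u′ = unchanged
        (λ a eq → trans (write-other (nats υ) i 0 _ a (proj₁ (∨-false eq)))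
          (trans (nats-≡ u′ a (proj₁ (∨-false {writesNat P a} (proj₂ (∨-false {does (i ≟ a)} eq))))) (nats-≡ u a eq)))
        (λ a eq → trans (reals-≡ u′ a (proj₁ (∨-false eq))) (reals-≡ u a eq))

    all : List Test → Store → Bool
    all []       σ = true
    all (b ∷ bs) σ = ⟦ b ⟧ᵗ σ ∧ all bs σ

    when-rule : ∀ bs {P σ} {Q : Assertion} → (all bs σ ≡ true → WP P σ Q) →
                (all bs σ ≡ false → Q σ) → WP (when bs P) σ Q
    when-rule []                 t f = t refl
    when-rule (b ∷ bs) {P} {σ} t f =
      (λ e → when-rule bs (λ e′ → t (trans (cong (_∧ all bs σ) e) e′)) (λ e′ → f (trans (cong (_∧ all bs σ) e) e′))) ,
      (λ e → f (cong (_∧ all bs σ) e))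

    writes-when : ∀ bs {P a} → writesNat P a ≡ false → writesNat (when bs P) a ≡ false
    writes-when []       e = e
    writes-when (b ∷ bs) {P} {a} e rewrite writes-when bs {P} {a} e = refl

    Found : (ℕ → Bool) → ℕ → ℕ → Set
    Found p b k = (k ≡ b × (∀ j → j < b → p j ≡ false)) ⊎ (k < b × p k ≡ true)

    search-rule : ∀ i f e bs {σ} {Q : Assertion} (p : ℕ → Bool) b → b ≤ B → does (f ≟ i) ≡ false → does (i ≟ f) ≡ false →
                  (∀ τ → Unchanged (search i f e bs) σ τ → ⟦ e ⟧ⁿ τ ≡ b) →
                  (∀ τ → Unchanged (search i f e bs) σ τ → all bs τ ≡ p (nats τ i 0)) →
                  (∀ τ → Unchanged (search i f e bs) σ τ → Found p b (nats τ f 0) → Q τ) →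
                  WP (search i f e bs) σ Q
    search-rule i f e bs {σ} {Q} p b b≤B f≢i i≢f bound test finish =
      for-rule i e (when bs (setNat f (lit 0) (i [ lit 0 ]))) I b b≤B (writes-when bs f≢i)
        (λ τ u → bound τ (weaken u))
        (inj₁ (trans (cong-app (write-other (nats (setN f 0 (⟦ e ⟧ⁿ σ) σ)) i 0 0 f i≢f) 0) (trans (write-same (nats σ) f 0 _) (bound σ (Unchanged-refl (search i f e bs)))) , λ _ ()))
        (λ τ u lt inv → when-rule bs
          (λ t → inj₂ (subst (λ z → z < b × p z ≡ true)
            (sym (trans (cong-app (write-other (nats (setN f 0 (nats τ i 0) τ)) i 0 (nats (setN f 0 (nats τ i 0) τ) i 0 + 1) f i≢f) 0) (write-same (nats τ) f 0 _)))
            (lt , trans (sym (test τ (weaken u))) t)))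
          (λ t → subst (λ z → (z ≡ b × _) ⊎ (z < b × p z ≡ true))
            (sym (cong-app (write-other (nats τ) i 0 (nats τ i 0 + 1) f i≢f) 0)) (extend (trans (sym (test τ (weaken u))) t) inv)))
        (λ τ u inv → finish τ (weaken u) inv)
      where
      I : ℕ → Assertion
      I c τ = (nats τ f 0 ≡ b × (∀ j → j < c → p j ≡ false)) ⊎ (nats τ f 0 < b × p (nats τ f 0) ≡ true)
      extend : ∀ {c k} → p c ≡ false → (k ≡ b × (∀ j → j < c → p j ≡ false)) ⊎ (k < b × p k ≡ true) →
               (k ≡ b × (∀ j → j < suc c → p j ≡ false)) ⊎ (k < b × p k ≡ true)
      extend {c} e (inj₂ y) = inj₂ y
      extend {c} e (inj₁ (k≡b , none)) = inj₁ (k≡b , λ j j<sc → case m<1+n⇒m<n∨m≡n j<sc of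
        λ { (inj₁ j<c) → none j j<c ; (inj₂ refl) → e })
      weaken : ∀ {τ} → Unchanged (for i e (when bs (setNat f (lit 0) (i [ lit 0 ])))) (setN f 0 (⟦ e ⟧ⁿ σ) σ) τ →
               Unchanged (search i f e bs) σ τ
      weaken u = unchanged
        (λ a eq → trans (nats-≡ u a (proj₂ (∨-false {does (f ≟ a)} eq))) (write-other (nats σ) f 0 _ a (proj₁ (∨-false eq))))
        (λ a eq → reals-≡ u a eq)

open WeakestPreconditions

-- For a concrete name `a`, `write m a i v a` computes to `upd (m a) i v`, so invariants phrased
-- with `upd` match the preconditions of assignments definitionally.
upd : ∀ {A : Set} → (ℕ → A) → ℕ → A → ℕ → A
upd f i v j = if does (i ≟ j) then v else f j

upd-same : ∀ {A : Set} (f : ℕ → A) i v → upd f i v i ≡ v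
upd-same f i v rewrite ≡ᵇ-refl i = ≡.refl

upd-other : ∀ {A : Set} (f : ℕ → A) {i j} v → j ≢ i → upd f i v j ≡ f j
upd-other f {i} {j} v j≢i rewrite dec-false (i ≟ j) (≢-sym j≢i) = ≡.refl

below-suc : ∀ {j} {P : ℕ → Set} → (∀ a → a < j → P a) → P j → ∀ a → a < suc j → P a
below-suc f p a a<sj with m<1+n⇒m<n∨m≡n a<sj
... | inj₁ a<j    = f a a<j
... | inj₂ ≡.refl = p

-- Finite sums over initial segments of the naturals

module Sums (𝕄 : CommutativeMonoid 0ℓ 0ℓ) where
  open CommutativeMonoid 𝕄
  open CSG commutativeSemigroup using (interchange; xy∙z≈xz∙y)
  open MonoidSum monoid using (sum; sum-init-last)
  open import Relation.Binary.Reasoning.Setoid setoid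

  -- The last summand is split off because a loop that handles index `n` extends its sum at that
  -- end.
  S : ℕ → (ℕ → Carrier) → Carrier
  S zero    f = ε
  S (suc n) f = S n f ∙ f n

  S-cong : ∀ n {f g} → (∀ i → i < n → f i ≈ g i) → S n f ≈ S n g
  S-cong zero    e = refl
  S-cong (suc n) e = ∙-cong (S-cong n (λ i i<n → e i (m<n⇒m<1+n i<n))) (e n ≤-refl)

  S-ε : ∀ n {f} → (∀ i → i < n → f i ≈ ε) → S n f ≈ ε
  S-ε zero    e = refl
  S-ε (suc n) e = trans (∙-cong (S-ε n (λ i i<n → e i (m<n⇒m<1+n i<n))) (e n ≤-refl)) (identityˡ ε)

  S-∙ : ∀ n f g → S n (λ i → f i ∙ g i) ≈ S n f ∙ S n g
  S-∙ zero    f g = sym (identityˡ ε)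
  S-∙ (suc n) f g = trans (∙-congʳ (S-∙ n f g)) (interchange _ _ _ _)

  -- The effect of a change at one index, stated without subtraction so that it serves potentials in
  -- ℕ as well as sums of reals.
  S-point : ∀ n {f g j} → j < n → (∀ i → i < n → i ≢ j → f i ≈ g i) → S n f ∙ g j ≈ S n g ∙ f j
  S-point (suc n) {f} {g} {j} j<n e with m<1+n⇒m<n∨m≡n j<n
  ... | inj₂ ≡.refl = trans (xy∙z≈xz∙y _ _ _) (∙-congʳ (∙-congʳ (S-cong n (λ i i<n → e i (m<n⇒m<1+n i<n) (<⇒≢ i<n)))))
  ... | inj₁ j<n′ = begin
    (S n f ∙ f n) ∙ g j ≈⟨ xy∙z≈xz∙y _ _ _ ⟩
    (S n f ∙ g j) ∙ f n ≈⟨ ∙-cong (S-point n j<n′ (λ i i<n → e i (m<n⇒m<1+n i<n))) (e n ≤-refl (≢-sym (<⇒≢ j<n′))) ⟩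
    (S n g ∙ f j) ∙ g n ≈⟨ xy∙z≈xz∙y _ _ _ ⟩
    (S n g ∙ g n) ∙ f j ∎

  sum≈S : ∀ n (f : Fin n → Carrier) {g : ℕ → Carrier} → (∀ i → f i ≈ g (toℕ i)) → sum f ≈ S n g
  sum≈S zero    f e = refl
  sum≈S (suc n) f {g} e = trans (sum-init-last f)
    (∙-cong (sum≈S n (f ∘ Fin.inject₁) (λ i → trans (e (Fin.inject₁ i)) (reflexive (cong g (toℕ-inject₁ i)))))
            (trans (e (Fin.fromℕ n)) (reflexive (cong g (toℕ-fromℕ n)))))

open Sums +-0-commutativeMonoid public using ()
  renaming (S to Sℕ; S-point to Sℕ-point)

Sℕ-mono : ∀ n {f g} → (∀ i → i < n → f i ≤ g i) → Sℕ n f ≤ Sℕ n g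
Sℕ-mono zero    e = z≤n
Sℕ-mono (suc n) e = +-mono-≤ (Sℕ-mono n (λ i i<n → e i (m<n⇒m<1+n i<n))) (e n ≤-refl)

Sℕ-const : ∀ n c → Sℕ n (λ _ → c) ≡ n * c
Sℕ-const zero    c = ≡.refl
Sℕ-const (suc n) c = ≡.trans (cong (_+ c) (Sℕ-const n c)) (+-comm (n * c) c)

Sℕ-bound : ∀ n {f c} → (∀ i → i < n → f i ≤ c) → Sℕ n f ≤ n * c
Sℕ-bound n {f} {c} e = ≤-trans (Sℕ-mono n e) (≤-reflexive (Sℕ-const n c))

-- Arithmetic in the ordered field

module Reals (ℝ : RealNumbers) where
  open RealNumbers ℝ public
    renaming (_+_ to _+ʳ_; -_ to -ʳ_; _-_ to _-ʳ_; _≤_ to _≤ʳ_; _<_ to _<ʳ_; _≤?_ to _≤?ʳ_; +-monoˡ-≤ to +ʳ-monoˡ-≤)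
    hiding (sum; _*_)
  open CommutativeRing commutativeRing public using
    (+-commutativeMonoid; +-cong; +-congˡ; +-congʳ; -‿inverseʳ; -‿inverseˡ; setoid)
    renaming (refl to ≈-refl; sym to ≈-sym; trans to ≈-trans; reflexive to ≈-reflexive; +-identityˡ to +ʳ-identityˡ; +-identityʳ to +ʳ-identityʳ; +-comm to +ʳ-comm; +-assoc to +ʳ-assoc)
  open CSG (CommutativeMonoid.commutativeSemigroup +-commutativeMonoid) public using (interchange)
  open Sums +-commutativeMonoid public
  open IsDecTotalOrder isDecTotalOrder public using (antisym; total)
    renaming (refl to ≤ʳ-refl; trans to ≤ʳ-trans; reflexive to ≤ʳ-reflexive)

  ≤ʳ-resp : ∀ {x x′ y y′} → x ≈ x′ → y ≈ y′ → x ≤ʳ y → x′ ≤ʳ y′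
  ≤ʳ-resp x≈ y≈ x≤y = ≤ʳ-trans (≤ʳ-reflexive (≈-sym x≈)) (≤ʳ-trans x≤y (≤ʳ-reflexive y≈))

  +ʳ-mono-≤ : ∀ {a b c d} → a ≤ʳ b → c ≤ʳ d → (a +ʳ c) ≤ʳ (b +ʳ d)
  +ʳ-mono-≤ {a} {b} {c} {d} a≤b c≤d =
    ≤ʳ-trans (+ʳ-monoˡ-≤ c a≤b) (≤ʳ-resp (+ʳ-comm c b) (+ʳ-comm d b) (+ʳ-monoˡ-≤ b c≤d))

  cancelʳ : ∀ x z → ((x +ʳ z) +ʳ (-ʳ z)) ≈ x
  cancelʳ x z = ≈-trans (+ʳ-assoc x z (-ʳ z)) (≈-trans (+-congˡ (-‿inverseʳ z)) (+ʳ-identityʳ x))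

  +-cancelʳ-≈ : ∀ {x y} z → (x +ʳ z) ≈ (y +ʳ z) → x ≈ y
  +-cancelʳ-≈ {x} {y} z e = ≈-trans (≈-sym (cancelʳ x z)) (≈-trans (+-congʳ e) (cancelʳ y z))

  +-cancelʳ-≤ʳ : ∀ {x y} z → (x +ʳ z) ≤ʳ (y +ʳ z) → x ≤ʳ y
  +-cancelʳ-≤ʳ {x} {y} z e = ≤ʳ-resp (cancelʳ x z) (cancelʳ y z) (+ʳ-monoˡ-≤ (-ʳ z) e)

  0≤+ : ∀ {x y} → 0# ≤ʳ x → 0# ≤ʳ y → 0# ≤ʳ (x +ʳ y)
  0≤+ 0≤x 0≤y = ≤ʳ-resp (+ʳ-identityˡ 0#) ≈-refl (+ʳ-mono-≤ 0≤x 0≤y)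

  0≤- : ∀ {x y} → y ≤ʳ x → 0# ≤ʳ (x -ʳ y)
  0≤- {x} {y} y≤x = ≤ʳ-resp (-‿inverseʳ y) ≈-refl (+ʳ-monoˡ-≤ (-ʳ y) y≤x)

  x≤x+y : ∀ {x y} → 0# ≤ʳ y → x ≤ʳ (x +ʳ y)
  x≤x+y {x} 0≤y = ≤ʳ-resp (+ʳ-identityʳ x) ≈-refl (+ʳ-mono-≤ ≤ʳ-refl 0≤y)

  ≰⇒≥ʳ : ∀ {x y} → ¬ (x ≤ʳ y) → y ≤ʳ x
  ≰⇒≥ʳ {x} {y} x≰y with total x y
  ... | inj₁ x≤y = contradiction x≤y x≰y
  ... | inj₂ y≤x = y≤x

  S-mono : ∀ n {f g} → (∀ i → i < n → f i ≤ʳ g i) → S n f ≤ʳ S n g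
  S-mono zero    e = ≤ʳ-refl
  S-mono (suc n) e = +ʳ-mono-≤ (S-mono n (λ i i<n → e i (m<n⇒m<1+n i<n))) (e n ≤-refl)

  S-nonneg : ∀ n {f} → (∀ i → i < n → 0# ≤ʳ f i) → 0# ≤ʳ S n f
  S-nonneg zero    e = ≤ʳ-refl
  S-nonneg (suc n) e = 0≤+ (S-nonneg n (λ i i<n → e i (m<n⇒m<1+n i<n))) (e n ≤-refl)

  term≤S : ∀ n {f j} → (∀ i → i < n → 0# ≤ʳ f i) → j < n → f j ≤ʳ S n f
  term≤S (suc n) {f} {j} e j<n with m<1+n⇒m<n∨m≡n j<n
  ... | inj₂ ≡.refl = ≤ʳ-resp (+ʳ-identityˡ (f n)) ≈-refl (+ʳ-mono-≤ (S-nonneg n (λ i i<n → e i (m<n⇒m<1+n i<n))) ≤ʳ-refl)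
  ... | inj₁ j<n′   = ≤ʳ-trans (term≤S n (λ i i<n → e i (m<n⇒m<1+n i<n)) j<n′) (x≤x+y (e n ≤-refl))

  ind : Bool → Carrier → Carrier
  ind b x = if b then x else 0#

  ind-nonneg : ∀ b {x} → 0# ≤ʳ x → 0# ≤ʳ ind b x
  ind-nonneg true  0≤x = 0≤x
  ind-nonneg false 0≤x = ≤ʳ-refl

  ind-0 : ∀ b → ind b 0# ≈ 0#
  ind-0 true  = ≈-refl
  ind-0 false = ≈-refl

  ind-cong : ∀ b {x y} → x ≈ y → ind b x ≈ ind b y
  ind-cong true  e = e
  ind-cong false e = ≈-refl

  ind-+ : ∀ b x y → ind b (x +ʳ y) ≈ (ind b x +ʳ ind b y)
  ind-+ true  x y = ≈-refl
  ind-+ false x y = ≈-sym (+ʳ-identityˡ 0#)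

  add : (ℕ → Carrier) → ℕ → Carrier → ℕ → Carrier
  add f j y = upd f j (f j +ʳ y)

  S-add : ∀ n (c : ℕ → Bool) f {j} y → j < n →
          S n (λ i → ind (c i) (add f j y i)) ≈ (S n (λ i → ind (c i) (f i)) +ʳ ind (c j) y)
  S-add n c f {j} y j<n = +-cancelʳ-≈ (ind (c j) (f j)) (≈-trans
    (S-point n j<n (λ i _ i≢j → ind-cong (c i) (≈-reflexive (upd-other f _ i≢j))))
    (≈-trans (+-congˡ (≈-trans (ind-cong (c j) (≈-reflexive (upd-same f j _)))
                              (≈-trans (ind-+ (c j) (f j) y) (+ʳ-comm _ _))))
             (≈-sym (+ʳ-assoc _ _ _))))

-- Preflows, push and relabel

module Flow (ℝ : RealNumbers) (n M : ℕ) (tail head rev : ℕ → ℕ) (cap : ℕ → RealNumbers.Carrier ℝ) where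
  open Reals ℝ

  record Arcs : Set where
    field
      tail<n   : ∀ {a} → a < M → tail a < n
      head<n   : ∀ {a} → a < M → head a < n
      rev<M    : ∀ {a} → a < M → rev a < M
      tail-rev : ∀ {a} → a < M → tail (rev a) ≡ head a
      head-rev : ∀ {a} → a < M → head (rev a) ≡ tail a
      cap≥0    : ∀ {a} → a < M → 0# ≤ʳ cap a

  -- Arcs entering `A`: flow runs towards the sinks, and `A` is the sink side.
  crossing : (ℕ → Bool) → ℕ → Bool
  crossing A a = not (A (tail a)) ∧ A (head a)

  value : (ℕ → Bool) → Carrier
  value A = S M (λ a → ind (crossing A a) (cap a))

  module Phase (arcs : Arcs) (d₀ sink : ℕ → ℕ) where
    open Arcs arcs

    Avoids : (ℕ → Bool) → Set
    Avoids A = ∀ v → v < n → d₀ v ≡ n → A v ≡ false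

    Covers : (ℕ → Bool) → Set
    Covers A = ∀ v → v < n → 1 ≤ sink v → A v ≡ true

    -- d labels vertices, r a is the residual capacity of arc a and x v the
    -- excess at v.  A vertex counts as disconnected from the sinks once its
    -- label is n; sources have that label from the start.

    record Preflow (d : ℕ → ℕ) (r x : ℕ → Carrier) : Set where
      field
        d≤n      : ∀ v → v < n → d v ≤ n
        d-sink   : ∀ v → v < n → 1 ≤ sink v → d v ≡ 0
        d-source : ∀ v → v < n → d₀ v ≡ n → d v ≡ n
        valid    : ∀ a → a < M → d (tail a) ≤ suc (d (head a)) ⊎ r a ≤ʳ 0#
        r≥0      : ∀ a → a < M → 0# ≤ʳ r a
        x≥0      : ∀ v → v < n → 0# ≤ʳ x v
        -- Capacity entering `A` is either still residual or has arrived as excess inside `A`. These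
        -- equations, one for each set without sources, replace a flow function with its
        -- conservation and antisymmetry laws.
        balance  : ∀ A → Avoids A →
                   (S M (λ a → ind (crossing A a) (r a)) +ʳ S n (λ v → ind (A v) (x v))) ≈ value A

    Admissible : (ℕ → ℕ) → (ℕ → Carrier) → ℕ → ℕ → Set
    Admissible d r u a = tail a ≡ u × ¬ (r a ≤ʳ 0#) × d u ≡ suc (d (head a))

    Settled : (ℕ → ℕ) → (r x : ℕ → Carrier) → ℕ → Set
    Settled d r x u = (n ≤ d u ⊎ 1 ≤ sink u) ⊎ (x u ≤ʳ 0# × ∃[ a ] a < M × Admissible d r u a)

    -- Saturating the arcs out of the sources

    record Saturated (j : ℕ) (r x : ℕ → Carrier) : Set where
      field
        r≥0     : ∀ a → a < j → 0# ≤ʳ r a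
        closed  : ∀ a → a < j → ¬ (n ≤ d₀ (tail a)) ⊎ r a ≤ʳ 0#
        x≥0     : ∀ v → v < n → 0# ≤ʳ x v
        balance : ∀ A → Avoids A →
                  (S j (λ a → ind (crossing A a) (r a)) +ʳ S n (λ v → ind (A v) (x v))) ≈
                  S j (λ a → ind (crossing A a) (cap a))

    saturated-0 : ∀ {r x} → (∀ v → v < n → x v ≡ 0#) → Saturated 0 r x
    saturated-0 e = record
      { r≥0 = λ _ () ; closed = λ _ ()
      ; x≥0 = λ v v<n → ≤ʳ-reflexive (≈-reflexive (≡.sym (e v v<n)))
      ; balance = λ A _ → ≈-trans (+ʳ-identityˡ _) (S-ε n (λ v v<n → ≈-trans (ind-cong (A v) (≈-reflexive (e v v<n))) (ind-0 (A v)))) }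

    S-upd-last : ∀ j (c : ℕ → Bool) r y → S (suc j) (λ a → ind (c a) (upd r j y a)) ≈ (S j (λ a → ind (c a) (r a)) +ʳ ind (c j) y)
    S-upd-last j c r y = +-cong
      (S-cong j (λ a a<j → ind-cong (c a) (≈-reflexive (upd-other r y (<⇒≢ a<j)))))
      (ind-cong (c j) (≈-reflexive (upd-same r j y)))

    -- The reverse arc gets no residual capacity in return. It enters a source, so it crosses into
    -- no set that avoids the sources and `balance` cannot see it. Nor can flow return to a source
    -- later: a push into label n would have to start at label n + 1.
    saturated-closed : ∀ {j r x} → j < M → n ≤ d₀ (tail j) → d₀ (tail j) ≤ n → Saturated j r x →
                       Saturated (suc j) (upd r j 0#) (add x (head j) (cap j))
    saturated-closed {j} {r} {x} j<M n≤d d≤n s = record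
      { r≥0    = below-suc (λ a a<j → subst (0# ≤ʳ_) (≡.sym (upd-other r 0# (<⇒≢ a<j))) (s .r≥0 a a<j))
                           (subst (0# ≤ʳ_) (≡.sym (upd-same r j 0#)) ≤ʳ-refl)
      ; closed = below-suc (λ a a<j → subst (λ z → _ ⊎ z ≤ʳ 0#) (≡.sym (upd-other r 0# (<⇒≢ a<j))) (s .closed a a<j))
                           (inj₂ (subst (_≤ʳ 0#) (≡.sym (upd-same r j 0#)) ≤ʳ-refl))
      ; x≥0    = λ v v<n → add≥0 v v<n
      ; balance = λ A av →
          ≈-trans (+-cong (≈-trans (S-upd-last j (crossing A) r 0#) (≈-trans (+-congˡ (ind-0 (crossing A j))) (+ʳ-identityʳ _)))
                          (S-add n A x (cap j) (head<n j<M)))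
          (≈-trans (≈-sym (+ʳ-assoc _ _ _))
            (+-cong (s .balance A av) (≈-reflexive (cong (λ b → ind (not b ∧ A (head j)) (cap j)) (≡.sym (av (tail j) (tail<n j<M) (≤-antisym d≤n n≤d)))))))
      }
      where
      open Saturated
      add≥0 : ∀ v → v < n → 0# ≤ʳ add x (head j) (cap j) v
      add≥0 v v<n with v ≟ head j
      ... | yes ≡.refl = subst (0# ≤ʳ_) (≡.sym (upd-same x (head j) _)) (0≤+ (s .x≥0 _ v<n) (cap≥0 j<M))
      ... | no v≢      = subst (0# ≤ʳ_) (≡.sym (upd-other x _ v≢)) (s .x≥0 v v<n)

    saturated-open : ∀ {j r x} → j < M → ¬ (n ≤ d₀ (tail j)) → Saturated j r x →
                     Saturated (suc j) (upd r j (cap j)) x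
    saturated-open {j} {r} {x} j<M n≰d s = record
      { r≥0    = below-suc (λ a a<j → subst (0# ≤ʳ_) (≡.sym (upd-other r _ (<⇒≢ a<j))) (s .r≥0 a a<j))
                           (subst (0# ≤ʳ_) (≡.sym (upd-same r j _)) (cap≥0 j<M))
      ; closed = below-suc (λ a a<j → subst (λ z → _ ⊎ z ≤ʳ 0#) (≡.sym (upd-other r _ (<⇒≢ a<j))) (s .closed a a<j))
                           (inj₁ n≰d)
      ; x≥0    = s .x≥0
      ; balance = λ A av →
          ≈-trans (+-congʳ (S-upd-last j (crossing A) r (cap j)))
          (≈-trans (≈-trans (+ʳ-assoc _ _ _) (≈-trans (+-congˡ (+ʳ-comm _ _)) (≈-sym (+ʳ-assoc _ _ _))))
            (+-congʳ (s .balance A av)))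
      }
      where open Saturated

    saturated⇒preflow : ∀ {r x} → (∀ v → v < n → d₀ v ≡ 0 ⊎ d₀ v ≡ n) →
                        (∀ v → v < n → 1 ≤ sink v → d₀ v ≡ 0) → Saturated M r x → Preflow d₀ r x
    saturated⇒preflow two snk s = record
      { d≤n = λ v v<n → case two v v<n of λ { (inj₁ e) → subst (_≤ n) (≡.sym e) z≤n ; (inj₂ e) → ≤-reflexive e }
      ; d-sink = snk ; d-source = λ _ _ e → e
      ; valid = λ a a<M → case s .closed a a<M of λ
          { (inj₂ r≤0) → inj₂ r≤0
          ; (inj₁ n≰d) → case two (tail a) (tail<n a<M) of λ
              { (inj₁ e) → inj₁ (subst (_≤ suc (d₀ (head a))) (≡.sym e) z≤n)
              ; (inj₂ e) → contradiction (≤-reflexive (≡.sym e)) n≰d } }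
      ; r≥0 = s .r≥0 ; x≥0 = s .x≥0 ; balance = s .balance }
      where open Saturated

    -- Potential

    pos : Carrier → Bool
    pos y = not (does (y ≤?ʳ 0#))

    φ : (ℕ → ℕ) → (ℕ → Carrier) → ℕ → ℕ
    φ d x v = if pos (x v) then d v else 0

    θ : (ℕ → ℕ) → (ℕ → Carrier) → ℕ → ℕ
    θ d r a = if pos (r a) ∧ does (suc (d (head a)) ≤? d (tail a)) then 1 else 0

    Φ : (ℕ → ℕ) → (ℕ → Carrier) → ℕ
    Φ d x = Sℕ n (φ d x)

    Θ : (ℕ → ℕ) → (ℕ → Carrier) → ℕ
    Θ d r = Sℕ M (θ d r)

    Λ : (ℕ → ℕ) → ℕ
    Λ d = Sℕ n (λ v → n ∸ d v)

    -- Pushes never create downward residual arcs, so Θ falls at a saturating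
    -- push, which raises Φ by at most n; other pushes lower Φ; relabelling
    -- lowers Λ, which outweighs the rest.

    Ψ : (ℕ → ℕ) → (r x : ℕ → Carrier) → ℕ
    Ψ d r x = Φ d x + (suc n * Θ d r + (2 + suc n * M) * Λ d)

    if≤ : ∀ b c → (if b then c else 0) ≤ c
    if≤ true  c = ≤-refl
    if≤ false c = z≤n

    Θ≤M : ∀ d r → Θ d r ≤ M
    Θ≤M d r = ≤-trans (Sℕ-bound M (λ a _ → if≤ (pos (r a) ∧ does (suc (d (head a)) ≤? d (tail a))) 1)) (≤-reflexive (*-identityʳ M))

    Ψ-bound : ∀ d r x → (∀ v → v < n → d v ≤ n) → Ψ d r x ≤ n * n + (suc n * M + (2 + suc n * M) * (n * n))
    Ψ-bound d r x d≤n = +-mono-≤ (Sℕ-bound n (λ v v<n → ≤-trans (if≤ (pos (x v)) (d v)) (d≤n v v<n)))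
      (+-mono-≤ (*-monoʳ-≤ (suc n) (Θ≤M d r)) (*-monoʳ-≤ (2 + suc n * M) (Sℕ-bound n (λ v _ → m∸n≤m n (d v)))))

    pos-true : ∀ {y} → ¬ (y ≤ʳ 0#) → pos y ≡ true
    pos-true {y} y≰0 = cong not (dec-false (y ≤?ʳ 0#) y≰0)

    pos-false : ∀ {y} → y ≈ 0# → pos y ≡ false
    pos-false {y} y≈0 = cong not (dec-true (y ≤?ʳ 0#) (≤ʳ-reflexive y≈0))

    module Relabel {d r x} (p : Preflow d r x) {u} (u<n : u < n) (du<n : d u < n) (nonsink : ¬ (1 ≤ sink u))
                   (none : ∀ a → a < M → ¬ Admissible d r u a) where
      open Preflow p

      d′ : ℕ → ℕ
      d′ = upd d u (d u + 1)

      d′u : d′ u ≡ suc (d u)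
      d′u = ≡.trans (upd-same d u _) (+-comm (d u) 1)

      d≤d′ : ∀ v → d v ≤ d′ v
      d≤d′ v with v ≟ u
      ... | yes ≡.refl = ≤-trans (n≤1+n _) (≤-reflexive (≡.sym d′u))
      ... | no v≢u     = ≤-reflexive (≡.sym (upd-other d _ v≢u))

      preflow : Preflow d′ r x
      preflow = record
        { d≤n = bounded ; d-sink = sinks ; d-source = sources ; valid = valid′
        ; r≥0 = r≥0 ; x≥0 = x≥0 ; balance = balance }
        where
        bounded : ∀ v → v < n → d′ v ≤ n
        bounded v v<n with v ≟ u
        ... | yes ≡.refl = subst (_≤ n) (≡.sym d′u) du<n
        ... | no v≢u     = subst (_≤ n) (≡.sym (upd-other d _ v≢u)) (d≤n v v<n)
        sinks : ∀ v → v < n → 1 ≤ sink v → d′ v ≡ 0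
        sinks v v<n s with v ≟ u
        ... | yes ≡.refl = contradiction s nonsink
        ... | no v≢u     = ≡.trans (upd-other d _ v≢u) (d-sink v v<n s)
        sources : ∀ v → v < n → d₀ v ≡ n → d′ v ≡ n
        sources v v<n s with v ≟ u
        ... | yes ≡.refl = contradiction (d-source v v<n s) (<⇒≢ du<n)
        ... | no v≢u     = ≡.trans (upd-other d _ v≢u) (d-source v v<n s)
        valid′ : ∀ a → a < M → d′ (tail a) ≤ suc (d′ (head a)) ⊎ r a ≤ʳ 0#
        valid′ a a<M with valid a a<M | r a ≤?ʳ 0# | tail a ≟ u
        ... | inj₂ r≤0 | _       | _ = inj₂ r≤0
        ... | _        | yes r≤0 | _ = inj₂ r≤0
        ... | inj₁ le  | no r≰0  | no t≢u = inj₁ (≤-trans (≤-reflexive (upd-other d _ t≢u)) (≤-trans le (s≤s (d≤d′ _))))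
        -- On a residual arc out of `u`, equality in `d u ≤ suc (d (head a))` would make the arc
        -- admissible. The inequality is therefore strict and leaves room for one more unit.
        ... | inj₁ le  | no r≰0  | yes ≡.refl = inj₁ (≤-trans (≤-reflexive d′u)
                (≤-trans (≤∧≢⇒< le (λ e → none a a<M (≡.refl , r≰0 , e))) (s≤s (d≤d′ _))))

      -- Origin of the weight 2 + (n + 1)M: Φ rises by at most 1 and (n + 1)Θ by at most (n + 1)M,
      -- while Λ drops by exactly 1. One unit remains and makes the inequality strict.
      decrease : Ψ d′ r x < Ψ d r x
      decrease = begin-strict
        Φ d′ x + (suc n * Θ d′ r + K * Λ d′) ≤⟨ +-mono-≤ Φ′ (+-monoˡ-≤ (K * Λ d′) (*-monoʳ-≤ (suc n) (Θ≤M d′ r))) ⟩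
        suc (Φ d x) + (suc n * M + K * Λ d′) <⟨ ≤-reflexive (arith (Φ d x) (suc n * M) (Λ d′)) ⟩
        Φ d x + K * suc (Λ d′)               ≡⟨ cong (λ z → Φ d x + K * z) Λ′ ⟩
        Φ d x + K * Λ d                      ≤⟨ +-monoʳ-≤ (Φ d x) (m≤n+m (K * Λ d) (suc n * Θ d r)) ⟩
        Ψ d r x ∎
        where
        open ≤-Reasoning
        K = 2 + suc n * M
        arith : ∀ f m l → suc (suc f + (m + (2 + m) * l)) ≡ f + (2 + m) * suc l
        arith = solve-∀
        Φ′ : Φ d′ x ≤ suc (Φ d x)
        Φ′ = +-cancelʳ-≤ (φ d x u) _ _ (≤-trans (≤-reflexive
          (Sℕ-point n u<n (λ v _ v≢u → cong (λ z → if pos (x v) then z else 0) (upd-other d _ v≢u))))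
          (≤-trans (+-monoʳ-≤ (Φ d x) (lem (pos (x u)))) (≤-reflexive (+-suc (Φ d x) (φ d x u)))))
          where
          lem : ∀ b → (if b then d′ u else 0) ≤ suc (if b then d u else 0)
          lem true  = ≤-reflexive d′u
          lem false = z≤n
        Λ′ : suc (Λ d′) ≡ Λ d
        Λ′ = +-cancelʳ-≡ (n ∸ suc (d u)) _ _ (≡.trans (≡.sym (+-suc (Λ d′) _))
          (≡.trans (cong (Λ d′ +_) (≡.trans (≡.sym (+-∸-assoc 1 du<n)) (≡.refl)))
          (≡.trans (Sℕ-point n u<n (λ v _ v≢u → cong (n ∸_) (upd-other d _ v≢u)))
                   (cong (λ z → Λ d + (n ∸ z)) d′u))))

    module Push {d r x} (p : Preflow d r x) {a} (a<M : a < M) (r≰0 : ¬ (r a ≤ʳ 0#))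
                (down : d (tail a) ≡ suc (d (head a))) (x≰0 : ¬ (x (tail a) ≤ʳ 0#))
                {δ} (0≤δ : 0# ≤ʳ δ) (δ≤r : δ ≤ʳ r a) (δ≤x : δ ≤ʳ x (tail a)) where
      open Preflow p
      private
        u = tail a
        v = head a
        u<n = tail<n a<M
        v<n = head<n a<M

      r₁ r′ x₁ x′ : ℕ → Carrier
      r₁ = add r a (-ʳ δ)
      r′ = add r₁ (rev a) δ
      x₁ = add x u (-ʳ δ)
      x′ = add x₁ v δ

      add-nonneg : ∀ {N} (f : ℕ → Carrier) j y → (∀ i → i < N → 0# ≤ʳ f i) → 0# ≤ʳ (f j +ʳ y) → ∀ i → i < N → 0# ≤ʳ add f j y i
      add-nonneg f j y f≥0 le i i<N with i ≟ j
      ... | yes ≡.refl = subst (0# ≤ʳ_) (≡.sym (upd-same f j _)) le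
      ... | no i≢j     = subst (0# ≤ʳ_) (≡.sym (upd-other f _ i≢j)) (f≥0 i i<N)

      -- A push moves δ from an arc to its reverse and from one excess to another. On whichever
      -- sides of a set the two endpoints lie, told by `b` and `c`, the four changes add up to zero.
      cancel : ∀ b c R X → (((R +ʳ ind (not b ∧ c) (-ʳ δ)) +ʳ ind (not c ∧ b) δ) +ʳ ((X +ʳ ind b (-ʳ δ)) +ʳ ind c δ)) ≈ (R +ʳ X)
      cancel b c R X = ≈-trans (+-cong (+ʳ-assoc _ _ _) (+ʳ-assoc _ _ _)) (≈-trans (interchange _ _ _ _)
        (≈-trans (+-congˡ (zeros b c)) (+ʳ-identityʳ _)))
        where
        zeros : ∀ b c → ((ind (not b ∧ c) (-ʳ δ) +ʳ ind (not c ∧ b) δ) +ʳ (ind b (-ʳ δ) +ʳ ind c δ)) ≈ 0#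
        zeros true  true  = ≈-trans (+-cong (+ʳ-identityˡ _) (-‿inverseˡ δ)) (+ʳ-identityˡ _)
        zeros true  false = ≈-trans (+-cong (+ʳ-identityˡ _) (+ʳ-identityʳ _)) (-‿inverseʳ δ)
        zeros false true  = ≈-trans (+-cong (+ʳ-identityʳ _) (+ʳ-identityˡ _)) (-‿inverseˡ δ)
        zeros false false = ≈-trans (+-cong (+ʳ-identityˡ _) (+ʳ-identityˡ _)) (+ʳ-identityˡ _)

      preflow : Preflow d r′ x′
      preflow = record
        { d≤n = d≤n ; d-sink = d-sink ; d-source = d-source ; valid = valid′
        ; r≥0 = r′≥0
        ; x≥0 = x′≥0
        ; balance = balance′ }
        where
        r₁≥0 = add-nonneg r a (-ʳ δ) r≥0 (0≤- δ≤r)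
        r′≥0 = add-nonneg r₁ (rev a) δ r₁≥0 (0≤+ (r₁≥0 _ (rev<M a<M)) 0≤δ)
        x₁≥0 = add-nonneg x u (-ʳ δ) x≥0 (0≤- δ≤x)
        x′≥0 = add-nonneg x₁ v δ x₁≥0 (0≤+ (x₁≥0 _ v<n) 0≤δ)
        valid′ : ∀ b → b < M → d (tail b) ≤ suc (d (head b)) ⊎ r′ b ≤ʳ 0#
        valid′ b b<M with valid b b<M | b ≟ rev a | b ≟ a
        ... | inj₁ le  | _ | _ = inj₁ le
        -- The reverse arc leads upwards in the labelling, so it is valid whatever its residual
        -- capacity.
        ... | inj₂ r≤0 | yes ≡.refl | _ = inj₁ (≤-trans (≤-reflexive (cong d (tail-rev a<M)))
                (≤-trans (n≤1+n _) (≤-trans (n≤1+n _) (≤-reflexive (cong suc (≡.trans (≡.sym down) (cong d (≡.sym (head-rev a<M)))))))))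
        ... | inj₂ r≤0 | no _ | yes ≡.refl = contradiction r≤0 r≰0
        ... | inj₂ r≤0 | no b≢ | no b≢a = inj₂ (subst (_≤ʳ 0#) (≡.sym (≡.trans (upd-other r₁ _ b≢) (upd-other r _ b≢a))) r≤0)
        balance′ : ∀ A → Avoids A →
                   (S M (λ a → ind (crossing A a) (r′ a)) +ʳ S n (λ v → ind (A v) (x′ v))) ≈ value A
        balance′ A av = ≈-trans (+-cong
          (≈-trans (S-add M (crossing A) r₁ δ (rev<M a<M)) (+-cong (S-add M (crossing A) r (-ʳ δ) a<M)
            (≈-reflexive (cong₂ (λ s t → ind (not (A s) ∧ A t) δ) (tail-rev a<M) (head-rev a<M)))))
          (≈-trans (S-add n A x₁ δ v<n) (+-congʳ (S-add n A x (-ʳ δ) u<n))))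
          (≈-trans (cancel (A u) (A v) _ _) (balance A av))

      Φ₁ : Φ d x₁ + d u ≡ Φ d x + φ d x₁ u
      Φ₁ = ≡.trans (cong (Φ d x₁ +_) (≡.sym (cong (λ b → if b then d u else 0) (pos-true x≰0))))
        (Sℕ-point n u<n (λ w _ w≢u → cong (λ z → if pos z then d w else 0) (upd-other x _ w≢u)))

      Φ′ : Φ d x′ ≤ Φ d x₁ + d v
      Φ′ = ≤-trans (m≤m+n (Φ d x′) (φ d x₁ v)) (≤-trans (≤-reflexive
        (Sℕ-point n v<n (λ w _ w≢v → cong (λ z → if pos z then d w else 0) (upd-other x₁ _ w≢v))))
        (+-monoʳ-≤ (Φ d x₁) (if≤ (pos (x′ v)) (d v))))

      Θ₁ : Θ d r₁ + 1 ≡ Θ d r + θ d r₁ a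
      Θ₁ = ≡.trans (cong (Θ d r₁ +_) (≡.sym (cong₂ (λ b c → if b ∧ c then 1 else 0) (pos-true r≰0) (dec-true (suc (d v) ≤? d u) (≤-reflexive (≡.sym down))))))
        (Sℕ-point M a<M (λ b _ b≢a → cong (λ z → if pos z ∧ does (suc (d (head b)) ≤? d (tail b)) then 1 else 0) (upd-other r _ b≢a)))

      Θ′ : Θ d r′ ≤ Θ d r₁
      Θ′ = ≤-trans (m≤m+n (Θ d r′) (θ d r₁ (rev a))) (≤-reflexive (≡.trans
        (Sℕ-point M (rev<M a<M) (λ b _ b≢ → cong (λ z → if pos z ∧ does (suc (d (head b)) ≤? d (tail b)) then 1 else 0) (upd-other r₁ _ b≢)))
        (≡.trans (cong (Θ d r₁ +_) (upward (pos (r′ (rev a))))) (+-identityʳ _))))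
        where
        upward : ∀ b → (if b ∧ does (suc (d (head (rev a))) ≤? d (tail (rev a))) then 1 else 0) ≡ 0
        upward false = ≡.refl
        upward true rewrite head-rev a<M | tail-rev a<M
          = cong (λ b → if b then 1 else 0) (dec-false (suc (d u) ≤? d v) (<⇒≱ (s≤s (≤-trans (n≤1+n _) (≤-reflexive (≡.sym down))))))

      -- If `u` is drained, Φ loses `d u` and gains at most `d v`, which is one less. If the arc is
      -- saturated, it leaves Θ, while Φ gains at most `d v ≤ n`: this is where the factor n + 1 on
      -- Θ comes from.
      decrease : (δ ≡ x u ⊎ δ ≡ r a) → Ψ d r′ x′ < Ψ d r x
      decrease (inj₁ δ≡x) = +-mono-<-≤ Φ″ (+-monoˡ-≤ ((2 + suc n * M) * Λ d) (*-monoʳ-≤ (suc n)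
          (≤-trans Θ′ (+-cancelʳ-≤ 1 _ _ (≤-trans (≤-reflexive Θ₁) (+-monoʳ-≤ (Θ d r) (if≤ (pos (r₁ a) ∧ does (suc (d v) ≤? d u)) 1)))))))
        where
        drained : φ d x₁ u ≡ 0
        drained = cong (λ b → if b then d u else 0) (pos-false (≈-trans (≈-reflexive (upd-same x u _)) (≈-trans (≈-reflexive (cong (λ z → x u +ʳ (-ʳ z)) δ≡x)) (-‿inverseʳ (x u)))))
        Φ″ : Φ d x′ < Φ d x
        Φ″ = ≤-trans (s≤s Φ′) (≤-reflexive (≡.trans (≡.sym (+-suc (Φ d x₁) (d v))) (≡.trans (cong (Φ d x₁ +_) (≡.sym down))
               (≡.trans Φ₁ (≡.trans (cong (Φ d x +_) drained) (+-identityʳ _))))))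
      decrease (inj₂ δ≡r) = begin-strict
        Φ d x′ + (suc n * Θ d r′ + K * Λ d) ≤⟨ +-mono-≤ Φ″ (+-monoˡ-≤ (K * Λ d) (*-monoʳ-≤ (suc n) Θ′)) ⟩
        (Φ d x + n) + (suc n * Θ d r₁ + K * Λ d) <⟨ ≤-reflexive (arith (Φ d x) n (Θ d r₁) (K * Λ d)) ⟩
        Φ d x + (suc n * suc (Θ d r₁) + K * Λ d) ≡⟨ cong (λ z → Φ d x + (suc n * z + K * Λ d)) Θ″ ⟩
        Ψ d r x ∎
        where
        open ≤-Reasoning
        K = 2 + suc n * M
        arith : ∀ f n t l → suc ((f + n) + (suc n * t + l)) ≡ f + (suc n * suc t + l)
        arith = solve-∀
        Φ″ : Φ d x′ ≤ Φ d x + n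
        Φ″ = ≤-trans Φ′ (+-mono-≤ (+-cancelʳ-≤ (d u) _ _ (≤-trans (≤-reflexive Φ₁) (+-monoʳ-≤ (Φ d x) (if≤ (pos (x₁ u)) (d u))))) (d≤n v v<n))
        emptied : θ d r₁ a ≡ 0
        emptied = cong (λ b → if b ∧ does (suc (d v) ≤? d u) then 1 else 0) (pos-false (≈-trans (≈-reflexive (upd-same r a _)) (≈-trans (≈-reflexive (cong (λ z → r a +ʳ (-ʳ z)) δ≡r)) (-‿inverseʳ (r a)))))
        Θ″ : suc (Θ d r₁) ≡ Θ d r
        Θ″ = ≡.trans (+-comm 1 _) (≡.trans Θ₁ (≡.trans (cong (Θ d r +_) emptied) (+-identityʳ _)))

    module Final {d r x} (p : Preflow d r x) (settled : ∀ u → u < n → Settled d r x u) where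
      open Preflow p

      T : ℕ → Bool
      T v = does (d v + 1 ≤? n)

      T-true : ∀ {v} → T v ≡ true → d v < n
      T-true {v} e = subst (_≤ n) (+-comm (d v) 1) (from-does (d v + 1 ≤? n) e)

      T-false : ∀ {v} → T v ≡ false → n ≤ d v
      T-false {v} e = ≮⇒≥ (λ lt → from-does-false (d v + 1 ≤? n) e (subst (_≤ n) (+-comm 1 (d v)) lt))

      descend : ∀ v → v < n → d v < n → (1 ≤ sink v) ⊎ (x v ≤ʳ 0# × ∃[ a ] a < M × Admissible d r v a)
      descend v v<n lt with settled v v<n
      ... | inj₁ (inj₁ n≤d) = contradiction n≤d (<⇒≱ lt)
      ... | inj₁ (inj₂ s)   = inj₁ s
      ... | inj₂ q          = inj₂ q

      -- Below label n only sinks, labelled 0, may lack an admissible arc, and each such arc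
      -- descends by exactly one. The descent from `v` thus meets every smaller label.
      levels : ∀ c v → v < n → d v ≡ c → c < n → ∀ c′ → c′ ≤ c → ∃[ w ] w < n × d w ≡ c′
      levels c v v<n e c<n c′ c′≤c with m≤n⇒m<n∨m≡n c′≤c
      ... | inj₂ ≡.refl = v , v<n , e
      levels (suc c) v v<n e c<n c′ c′≤c | inj₁ (s≤s c′≤c₁) with descend v v<n (subst (_< n) (≡.sym e) c<n)
      ... | inj₁ s = contradiction (≡.trans (≡.sym e) (d-sink v v<n s)) λ ()
      ... | inj₂ (_ , a , a<M , _ , _ , e′) =
        levels c (head a) (head<n a<M) (suc-injective (≡.trans (≡.sym e′) e)) (<-trans (n<1+n c) c<n) c′ c′≤c₁

      -- Otherwise all n + 1 labels would occur on n vertices.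

      gap : ∀ u v → u < n → v < n → n ≤ d u → d v < n → ¬ (n ≤ suc (d v))
      gap u v u<n v<n n≤du dv<n n≤ = clash (pigeonhole (n<1+n n) f)
        where
        all-levels : ∀ c → c ≤ n → ∃[ w ] w < n × d w ≡ c
        all-levels c c≤n with m≤n⇒m<n∨m≡n c≤n
        ... | inj₂ ≡.refl = u , u<n , ≤-antisym (d≤n u u<n) n≤du
        ... | inj₁ c<n    = levels (d v) v v<n ≡.refl dv<n c (≤-pred (≤-trans c<n n≤))
        w : (i : Fin (suc n)) → ∃[ w ] w < n × d w ≡ toℕ i
        w i = all-levels (toℕ i) (≤-pred (toℕ<n i))
        f : Fin (suc n) → Fin n
        f i = fromℕ< (proj₁ (proj₂ (w i)))
        clash : ∃[ i ] ∃[ j ] i Fin.< j × f i ≡ f j → ⊥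
        clash (i , j , i<j , e) = <⇒≢ i<j (≡.trans (≡.sym (proj₂ (proj₂ (w i)))) (≡.trans (cong d same) (proj₂ (proj₂ (w j)))))
          where
          same : proj₁ (w i) ≡ proj₁ (w j)
          same = ≡.trans (≡.sym (toℕ-fromℕ< _)) (≡.trans (cong toℕ e) (toℕ-fromℕ< _))

      avoids : Avoids T
      avoids v v<n e = dec-false (d v + 1 ≤? n) (λ le → <-irrefl (d-source v v<n e) (subst (_≤ n) (+-comm (d v) 1) le))

      covers : Covers T
      covers v v<n s = dec-true (d v + 1 ≤? n) (subst (λ z → z + 1 ≤ n) (≡.sym (d-sink v v<n s)) (≤-trans (s≤s z≤n) v<n))

      -- By validity, an arc into T with positive residual capacity would have its head exactly at
      -- level n - 1, which `gap` excludes.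
      closed : ∀ a → a < M → crossing T a ≡ true → r a ≤ʳ 0#
      closed a a<M cr with valid a a<M
      ... | inj₂ r≤0 = r≤0
      ... | inj₁ le  = ⊥-elim (gap (tail a) (head a) (tail<n a<M) (head<n a<M) n≤d (T-true h) (≤-trans n≤d le))
        where
        h = proj₂ (∧-true {not (T (tail a))} cr)
        n≤d = T-false (not-true (proj₁ (∧-true cr)))

      -- Positive excess inside T survives only at sinks, and `A` contains these.
      excess-≤ : ∀ A → Covers A → S n (λ v → ind (T v) (x v)) ≤ʳ S n (λ v → ind (A v) (x v))
      excess-≤ A cov = S-mono n pointwise
        where
        pointwise : ∀ v → v < n → ind (T v) (x v) ≤ʳ ind (A v) (x v)
        pointwise v v<n with T v in eq
        ... | false = ind-nonneg (A v) (x≥0 v v<n)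
        ... | true with descend v v<n (T-true eq)
        ...   | inj₁ s       = subst (λ b → x v ≤ʳ ind b (x v)) (≡.sym (cov v v<n s)) ≤ʳ-refl
        ...   | inj₂ (x≤0 , _) = ≤ʳ-trans x≤0 (ind-nonneg (A v) (x≥0 v v<n))

      value-T : value T ≈ S n (λ v → ind (T v) (x v))
      value-T = ≈-trans (≈-sym (balance T avoids)) (≈-trans (+-congʳ (S-ε M zero-term)) (+ʳ-identityˡ _))
        where
        zero-term : ∀ a → a < M → ind (crossing T a) (r a) ≈ 0#
        zero-term a a<M with crossing T a in eq
        ... | true  = antisym (closed a a<M eq) (r≥0 a a<M)
        ... | false = ≈-refl

      residual : (ℕ → Bool) → Carrier
      residual A = S M (λ a → ind (crossing A a) (r a))

      -- Max-flow min-cut: `balance` splits the capacity entering `A` into residual capacity and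
      -- excess. For T the first part vanishes, and the second is at most that of `A`.
      minimum : ∀ A → Avoids A → Covers A → value T ≤ʳ value A
      minimum A av cov = ≤ʳ-resp (≈-trans (+ʳ-identityˡ _) (≈-sym value-T)) (balance A av)
        (+ʳ-mono-≤ (S-nonneg M (λ a a<M → ind-nonneg (crossing A a) (r≥0 a a<M))) (excess-≤ A cov))

      -- If `A` is no more expensive than T, no residual capacity enters it. A residual arc with its
      -- head in `A` then has its tail there too, so membership travels from a sink back up the
      -- admissible arcs to `v`.
      least : ∀ A → Avoids A → Covers A → value A ≤ʳ value T → ∀ v → v < n → T v ≡ true → A v ≡ true
      least A av cov le v v<n t = go (d v) v v<n ≡.refl (T-true t)
        where
        residual≤0 : residual A ≤ʳ 0#
        residual≤0 = +-cancelʳ-≤ʳ (S n (λ v → ind (A v) (x v))) (≤ʳ-trans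
          (≤ʳ-resp (≈-sym (balance A av)) (≈-trans value-T (≈-sym (+ʳ-identityˡ _))) le)
          (+ʳ-mono-≤ ≤ʳ-refl (excess-≤ A cov)))
        go : ∀ c v → v < n → d v ≡ c → d v < n → A v ≡ true
        go c v v<n e dv<n with descend v v<n dv<n
        ... | inj₁ s = cov v v<n s
        go zero v v<n e dv<n | inj₂ (_ , a , a<M , _ , _ , e′) = contradiction (≡.trans (≡.sym e) e′) λ ()
        go (suc c) v v<n e dv<n | inj₂ (_ , a , a<M , t≡v , r≰0 , e′) with A v in eq
        ... | true  = ≡.refl
        ... | false = contradiction (≤ʳ-trans (subst (λ b → r a ≤ʳ ind b (r a)) (≡.sym cr) ≤ʳ-refl)
                (≤ʳ-trans (term≤S M (λ b b<M → ind-nonneg (crossing A b) (r≥0 b b<M)) a<M) residual≤0)) r≰0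
          where
          below : d (head a) < n
          below = ≤-trans (≤-reflexive (≡.sym e′)) (<⇒≤ dv<n)
          cr : crossing A a ≡ true
          cr = cong₂ (λ b c → not b ∧ c) (≡.trans (cong A t≡v) eq)
            (go c (head a) (head<n a<M) (suc-injective (≡.trans (≡.sym e′) e)) below)

-- Binary expansions

pow2 : ℕ → ℕ
pow2 zero    = 1
pow2 (suc m) = pow2 m + pow2 m

pow2≡2^ : ∀ m → pow2 m ≡ 2 ^ m
pow2≡2^ zero    = ≡.refl
pow2≡2^ (suc m) rewrite pow2≡2^ m = cong (2 ^ m +_) (≡.sym (+-identityʳ (2 ^ m)))

-- Bit t of j, with P = pow2 m and the most significant of the m bits at t = 0;
-- doubling replaces the missing division.

remainder : ℕ → ℕ → ℕ → ℕ
remainder P j zero    = j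
remainder P j (suc t) =
  if does (P ≤? remainder P j t + remainder P j t)
  then remainder P j t + remainder P j t ∸ P else remainder P j t + remainder P j t

bit : ℕ → ℕ → ℕ → Bool
bit P j t = does (P ≤? remainder P j t + remainder P j t)

does-double : ∀ x y → does (x + x ≤? y + y) ≡ does (x ≤? y)
does-double x y with x ≤? y
... | yes x≤y = ≡.trans (dec-true (x + x ≤? y + y) (+-mono-≤ x≤y x≤y)) (≡.sym (dec-true (x ≤? y) x≤y))
... | no x≰y  = ≡.trans (dec-false (x + x ≤? y + y) (<⇒≱ (+-mono-< (≰⇒> x≰y) (≰⇒> x≰y)))) (≡.sym (dec-false (x ≤? y) x≰y))

double-∸ : ∀ x y → (x + x) ∸ (y + y) ≡ (x ∸ y) + (x ∸ y)
double-∸ x y = ≡.trans (cong₂ _∸_ (two x) (two y)) (≡.trans (≡.sym (*-distribˡ-∸ 2 x y)) (≡.sym (two (x ∸ y))))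
  where
  two : ∀ z → z + z ≡ 2 * z
  two z = cong (z +_) (≡.sym (+-identityʳ z))

if-double : ∀ b x y → (if b then x + x else (y + y)) ≡ (if b then x else y) + (if b then x else y)
if-double true  x y = ≡.refl
if-double false x y = ≡.refl

remainder-double : ∀ P j t → remainder (P + P) (j + j) t ≡ remainder P j t + remainder P j t
remainder-double P j zero    = ≡.refl
remainder-double P j (suc t) rewrite remainder-double P j t
  | does-double P (remainder P j t + remainder P j t) | double-∸ (remainder P j t + remainder P j t) P =
  if-double (does (P ≤? remainder P j t + remainder P j t)) _ _

bit-double : ∀ P j t → bit (P + P) (j + j) t ≡ bit P j t
bit-double P j t rewrite remainder-double P j t = does-double P (remainder P j t + remainder P j t)

remainder-suc : ∀ P j t → remainder P j (suc t) ≡ remainder P (remainder P j 1) t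
remainder-suc P j zero    = ≡.refl
remainder-suc P j (suc t) rewrite ≡.sym (remainder-suc P j t) = ≡.refl

bit-suc : ∀ P j t → bit P j (suc t) ≡ bit P (remainder P j 1) t
bit-suc P j t rewrite ≡.sym (remainder-suc P j t) = ≡.refl

-- Once the leading digit is read, the remainder for modulus P + P is j + j, where j encodes the
-- other digits for modulus P; digits do not change when modulus and number are doubled together.
encode : ∀ m (u : ℕ → Bool) → ∃[ j ] j < pow2 m × (∀ t → t < m → bit (pow2 m) j t ≡ u t)
encode zero    u = 0 , s≤s z≤n , λ _ ()
encode (suc m) u with encode m (λ t → u (suc t)) | u 0 in eq
... | j , j< , e | true = P + j , +-monoʳ-< P j< , bits
  where
  P = pow2 m
  le : P + P ≤ (P + j) + (P + j)
  le = +-mono-≤ (m≤m+n P j) (m≤m+n P j)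
  first : bit (P + P) (P + j) 0 ≡ true
  first = dec-true (P + P ≤? (P + j) + (P + j)) le
  rest : remainder (P + P) (P + j) 1 ≡ j + j
  rest rewrite dec-true (P + P ≤? (P + j) + (P + j)) le =
    ≡.trans (double-∸ (P + j) P) (cong (λ z → z + z) (m+n∸m≡n P j))
  bits : ∀ t → t < suc m → bit (P + P) (P + j) t ≡ u t
  bits zero    _         = ≡.trans first (≡.sym eq)
  bits (suc t) (s≤s t<m) = ≡.trans (bit-suc (P + P) (P + j) t)
    (≡.trans (cong (λ z → bit (P + P) z t) rest) (≡.trans (bit-double P j t) (e t t<m)))
... | j , j< , e | false = j , ≤-trans j< (m≤m+n P P) , bits
  where
  P = pow2 m
  nle : ¬ (P + P ≤ j + j)
  nle = <⇒≱ (+-mono-< j< j<)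
  rest : remainder (P + P) j 1 ≡ j + j
  rest rewrite dec-false (P + P ≤? j + j) nle = ≡.refl
  bits : ∀ t → t < suc m → bit (P + P) j t ≡ u t
  bits zero    _         = ≡.trans (dec-false (P + P ≤? j + j) nle) (≡.sym eq)
  bits (suc t) (s≤s t<m) = ≡.trans (bit-suc (P + P) j t)
    (≡.trans (cong (λ z → bit (P + P) z t) rest) (≡.trans (bit-double P j t) (e t t<m)))

-- Horner's scheme with `f 0` as leading digit: a new cut doubles the code and appends a digit,
-- which is what `recordVertex` does.
code : ℕ → (ℕ → Bool) → ℕ
code zero    f = 0
code (suc j) f = if f j then code j f + code j f + 1 else code j f + code j f

code-cong : ∀ j {f g} → (∀ i → i < j → f i ≡ g i) → code j f ≡ code j g
code-cong zero    e = ≡.refl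
code-cong (suc j) e rewrite code-cong j (λ i i<j → e i (m<n⇒m<1+n i<j)) | e j ≤-refl = ≡.refl

-- The parity of the code gives its last digit, halving gives the others.
code-injective : ∀ j {f g} → code j f ≡ code j g → ∀ i → i < j → f i ≡ g i
code-injective (suc j) {f} {g} e i i<sj = split (m<1+n⇒m<n∨m≡n i<sj)
  where
  same-parity : ∀ x y → x + x ≡ y + y → x ≡ y
  same-parity x y e = ≡.trans (n≡⌊n+n/2⌋ x) (≡.trans (cong ⌊_/2⌋ e) (≡.sym (n≡⌊n+n/2⌋ y)))
  odd≢even : ∀ x y → x + x + 1 ≢ y + y
  odd≢even x y e = 1+n≢n (≡.trans (cong suc (n≡⌊n+n/2⌋ x)) (≡.trans (cong ⌈_/2⌉ e′)
    (≡.trans (≡.sym (n≡⌈n+n/2⌉ y)) (≡.trans (n≡⌊n+n/2⌋ y) (≡.trans (cong ⌊_/2⌋ (≡.sym e′)) (≡.sym (n≡⌈n+n/2⌉ x)))))))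
    where
    e′ : suc (x + x) ≡ y + y
    e′ = ≡.trans (+-comm 1 (x + x)) e
  digits : ∀ b c x y → (if b then x + x + 1 else x + x) ≡ (if c then y + y + 1 else y + y) → b ≡ c × x ≡ y
  digits true  true  x y e = ≡.refl , same-parity x y (+-cancelʳ-≡ 1 (x + x) (y + y) e)
  digits true  false x y e = contradiction e (odd≢even x y)
  digits false true  x y e = contradiction (≡.sym e) (odd≢even y x)
  digits false false x y e = ≡.refl , same-parity x y e
  split : i < j ⊎ i ≡ j → f i ≡ g i
  split (inj₁ i<j)    = code-injective j (proj₂ (digits (f j) (g j) (code j f) (code j g) e)) i i<j
  split (inj₂ ≡.refl) = proj₁ (digits (f j) (g j) (code j f) (code j g) e)

-- Undirected cuts, submodularity, least minimum cuts

module Cuts (ℝ : RealNumbers) (n m : ℕ) (src tgt : ℕ → ℕ) (c : ℕ → RealNumbers.Carrier ℝ) where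
  open Reals ℝ

  record Edges : Set where
    field
      src<tgt : ∀ {e} → e < m → src e < tgt e
      tgt<n   : ∀ {e} → e < m → tgt e < n
      c>0     : ∀ {e} → e < m → 0# <ʳ c e

  capacity-of : (ℕ → Bool) → Carrier
  capacity-of A = S m (λ e → ind (A (src e) xor A (tgt e)) (c e))

  -- `sums` ranges over all oriented predicates `w` because it is applied twice: with arcs entering
  -- a set, to identify directed with undirected cuts, and with `separates`, to count each edge once
  -- in the quotient.
  record Doubled (j M : ℕ) (tail head rev : ℕ → ℕ) (cap : ℕ → Carrier) : Set where
    field
      M≡2j  : M ≡ j + j
      arcs  : Flow.Arcs ℝ n M tail head rev cap
      cap>0 : ∀ {a} → a < M → 0# <ʳ cap a
      sums  : ∀ (w : ℕ → ℕ → Bool) → S M (λ a → ind (w (tail a) (head a)) (cap a)) ≈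
              S j (λ e → ind (w (src e) (tgt e)) (c e) +ʳ ind (w (tgt e) (src e)) (c e))

  doubled-0 : ∀ {tail head rev cap} → Doubled 0 0 tail head rev cap
  doubled-0 = record { M≡2j = ≡.refl
    ; arcs = record { tail<n = λ () ; head<n = λ () ; rev<M = λ () ; tail-rev = λ () ; head-rev = λ () ; cap≥0 = λ () }
    ; cap>0 = λ () ; sums = λ w → ≈-refl }

  upd₂ : ∀ {A : Set} → (ℕ → A) → ℕ → A → A → ℕ → A
  upd₂ f M x y = upd (upd f M x) (suc M) y

  upd₂-old : ∀ {A : Set} (f : ℕ → A) {M} x y {a} → a < M → upd₂ f M x y a ≡ f a
  upd₂-old f {M} x y a<M = ≡.trans (upd-other (upd f M x) y (<⇒≢ (m<n⇒m<1+n a<M))) (upd-other f x (<⇒≢ a<M))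

  upd₂-fst : ∀ {A : Set} (f : ℕ → A) M x y → upd₂ f M x y M ≡ x
  upd₂-fst f M x y = ≡.trans (upd-other (upd f M x) y (<⇒≢ (n<1+n M))) (upd-same f M x)

  upd₂-snd : ∀ {A : Set} (f : ℕ → A) M x y → upd₂ f M x y (suc M) ≡ y
  upd₂-snd f M x y = upd-same (upd f M x) (suc M) y

  below₂ : ∀ {M} {P : ℕ → Set} → (∀ a → a < M → P a) → P M → P (suc M) → ∀ {a} → a < suc (suc M) → P a
  below₂ f p q {a} a< = below-suc (below-suc f p) q a a<

  doubled-suc : ∀ {j M tail head rev cap} → Edges → j < m → Doubled j M tail head rev cap →
    Doubled (suc j) (M + 2) (upd (upd tail M (src j)) (M + 1) (tgt j)) (upd (upd head M (tgt j)) (M + 1) (src j))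
                            (upd (upd rev M (M + 1)) (M + 1) M) (upd (upd cap M (c j)) (M + 1) (c j))
  doubled-suc {j} {M} {tail} {head} {rev} {cap} E j<m D rewrite +-comm M 2 | +-comm M 1 = record
    { M≡2j = cong suc (≡.trans (cong suc (D .M≡2j)) (≡.sym (+-suc j j)))
    ; arcs = record
      { tail<n = below₂ (λ a a<M → subst (_< n) (≡.sym (tailo a<M)) (tail<n a<M)) (subst (_< n) (≡.sym tailM) s<n) (subst (_< n) (≡.sym tailM′) t<n)
      ; head<n = below₂ (λ a a<M → subst (_< n) (≡.sym (heado a<M)) (head<n a<M)) (subst (_< n) (≡.sym headM) t<n) (subst (_< n) (≡.sym headM′) s<n)
      ; rev<M  = below₂ (λ a a<M → subst (_< 2 + M) (≡.sym (revo a<M)) (m<n⇒m<1+n (m<n⇒m<1+n (rev<M a<M))))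
                        (subst (_< 2 + M) (≡.sym revM) ≤-refl) (subst (_< 2 + M) (≡.sym revM′) (m<n⇒m<1+n ≤-refl))
      ; tail-rev = below₂ (λ a a<M → ≡.trans (cong tail′ (revo a<M)) (≡.trans (tailo (rev<M a<M)) (≡.trans (tail-rev a<M) (≡.sym (heado a<M)))))
                          (≡.trans (cong tail′ revM) (≡.trans tailM′ (≡.sym headM))) (≡.trans (cong tail′ revM′) (≡.trans tailM (≡.sym headM′)))
      ; head-rev = below₂ (λ a a<M → ≡.trans (cong head′ (revo a<M)) (≡.trans (heado (rev<M a<M)) (≡.trans (head-rev a<M) (≡.sym (tailo a<M)))))
                          (≡.trans (cong head′ revM) (≡.trans headM′ (≡.sym tailM))) (≡.trans (cong head′ revM′) (≡.trans headM (≡.sym tailM′)))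
      ; cap≥0 = λ a<M → proj₁ (positive a<M) }
    ; cap>0 = positive
    ; sums = λ w → ≈-trans (+-cong (+-cong
        (≈-trans (S-cong M (λ a a<M → ≈-reflexive (≡.trans (cong₂ (λ s t → ind (w s t) (cap′ a)) (tailo a<M) (heado a<M)) (cong (ind (w (tail a) (head a))) (upd₂-old cap _ _ a<M))))) (D .sums w))
        (≈-reflexive (≡.trans (cong₂ (λ s t → ind (w s t) (cap′ M)) tailM headM) (cong (ind (w (src j) (tgt j))) (upd₂-fst cap M _ _)))))
        (≈-reflexive (≡.trans (cong₂ (λ s t → ind (w s t) (cap′ (suc M))) tailM′ headM′) (cong (ind (w (tgt j) (src j))) (upd₂-snd cap M _ _)))))
        (+ʳ-assoc _ _ _)
    }
    where
    open Doubled
    open Flow.Arcs (D .arcs)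
    open Edges E
    t<n = tgt<n j<m
    s<n = <-trans (src<tgt j<m) t<n
    tail′ = upd₂ tail M (src j) (tgt j)
    head′ = upd₂ head M (tgt j) (src j)
    cap′  = upd₂ cap M (c j) (c j)
    tailo = λ {a} → upd₂-old tail {M} (src j) (tgt j) {a}
    tailM = upd₂-fst tail M (src j) (tgt j)
    tailM′ = upd₂-snd tail M (src j) (tgt j)
    heado = λ {a} → upd₂-old head {M} (tgt j) (src j) {a}
    headM = upd₂-fst head M (tgt j) (src j)
    headM′ = upd₂-snd head M (tgt j) (src j)
    revo = λ {a} → upd₂-old rev {M} (suc M) M {a}
    revM = upd₂-fst rev M (suc M) M
    revM′ = upd₂-snd rev M (suc M) M
    positive : ∀ {a} → a < 2 + M → 0# <ʳ cap′ a
    positive = below₂ (λ a a<M → subst (0# <ʳ_) (≡.sym (upd₂-old cap _ _ a<M)) (D .cap>0 a<M))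
      (subst (0# <ʳ_) (≡.sym (upd₂-fst cap M _ _)) (c>0 j<m)) (subst (0# <ʳ_) (≡.sym (upd₂-snd cap M _ _)) (c>0 j<m))

  value≈ : ∀ {M tail head rev cap} → Doubled m M tail head rev cap → ∀ A → Flow.value ℝ n M tail head rev cap A ≈ capacity-of A
  value≈ D A = ≈-trans (Doubled.sums D (λ s t → not (A s) ∧ A t)) (S-cong m (λ e _ → either (A (src e)) (A (tgt e)) (c e)))
    where
    either : ∀ p q x → (ind (not p ∧ q) x +ʳ ind (not q ∧ p) x) ≈ ind (p xor q) x
    either true  true  x = +ʳ-identityˡ _
    either true  false x = +ʳ-identityˡ _
    either false true  x = +ʳ-identityʳ _
    either false false x = +ʳ-identityˡ _

  -- The two sides differ only for an edge joining a vertex of A outside B to a vertex of B outside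
  -- A: it counts twice on the right and not at all on the left.
  submodular : Edges → ∀ A B → (capacity-of (λ v → A v ∧ B v) +ʳ capacity-of (λ v → A v ∨ B v)) ≤ʳ (capacity-of A +ʳ capacity-of B)
  submodular E A B = ≤ʳ-resp (S-∙ m _ _) (S-∙ m _ _) (S-mono m (λ e e<m →
    termwise (A (src e)) (B (src e)) (A (tgt e)) (B (tgt e)) (proj₁ (Edges.c>0 E e<m))))
    where
    termwise : ∀ a b a′ b′ {x} → 0# ≤ʳ x →
      (ind ((a ∧ b) xor (a′ ∧ b′)) x +ʳ ind ((a ∨ b) xor (a′ ∨ b′)) x) ≤ʳ (ind (a xor a′) x +ʳ ind (b xor b′) x)
    termwise true  true  true  true  p = ≤ʳ-refl
    termwise true  true  true  false p = ≤ʳ-reflexive (+ʳ-comm _ _)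
    termwise true  true  false true  p = ≤ʳ-refl
    termwise true  true  false false p = ≤ʳ-refl
    termwise true  false true  true  p = ≤ʳ-reflexive (+ʳ-comm _ _)
    termwise true  false true  false p = ≤ʳ-refl
    termwise true  false false true  p = +ʳ-mono-≤ p p
    termwise true  false false false p = ≤ʳ-reflexive (+ʳ-comm _ _)
    termwise false true  true  true  p = ≤ʳ-refl
    termwise false true  true  false p = +ʳ-mono-≤ p p
    termwise false true  false true  p = ≤ʳ-refl
    termwise false true  false false p = ≤ʳ-refl
    termwise false false true  true  p = ≤ʳ-refl
    termwise false false true  false p = ≤ʳ-reflexive (+ʳ-comm _ _)
    termwise false false false true  p = ≤ʳ-refl
    termwise false false false false p = ≤ʳ-refl

  -- Cuts whose trace on the terminals is given by u; terminal 0 stays outside.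

  module Traces (l : ℕ) (term : ℕ → ℕ) where
    Trace : (ℕ → Bool) → (ℕ → Bool) → Set
    Trace u A = A (term 0) ≡ false × (∀ t → t < l → A (term (suc t)) ≡ u t)

    record LeastMinCut (u T : ℕ → Bool) : Set where
      field
        trace   : Trace u T
        minimum : ∀ A → Trace u A → capacity-of T ≤ʳ capacity-of A
        least   : ∀ A → Trace u A → capacity-of A ≤ʳ capacity-of T → ∀ v → v < n → T v ≡ true → A v ≡ true

    -- The intersection has trace `u` and the union trace `u′`. The union costs at least as much as
    -- `T′`, so by submodularity the intersection costs at most as much as `T`; since `T` is least,
    -- it lies inside the intersection.
    leastMinCut-mono : Edges → ∀ {u u′ T T′} → LeastMinCut u T → LeastMinCut u′ T′ →
                       (∀ t → t < l → u t ≡ true → u′ t ≡ true) → ∀ v → v < n → T v ≡ true → T′ v ≡ true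
    leastMinCut-mono E {u} {u′} {T} {T′} L L′ u≤u′ v v<n Tv =
      proj₂ (∧-true {T v} (least L (λ w → T w ∧ T′ w) ∩-trace (+-cancelʳ-≤ʳ (capacity-of T′)
        (≤ʳ-trans (+ʳ-mono-≤ ≤ʳ-refl (minimum L′ (λ w → T w ∨ T′ w) ∪-trace)) (submodular E T T′))) v v<n Tv))
      where
      open LeastMinCut
      ∩-trace : Trace u (λ w → T w ∧ T′ w)
      ∩-trace = cong (_∧ T′ (term 0)) (proj₁ (trace L)) , λ t t<l →
        ≡.trans (cong₂ _∧_ (proj₂ (trace L) t t<l) (proj₂ (trace L′) t t<l)) (absorb (u t) (u≤u′ t t<l))
        where
        absorb : ∀ b {c} → (b ≡ true → c ≡ true) → b ∧ c ≡ b
        absorb true  f = f ≡.refl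
        absorb false f = ≡.refl
      ∪-trace : Trace u′ (λ w → T w ∨ T′ w)
      ∪-trace = cong₂ _∨_ (proj₁ (trace L)) (proj₁ (trace L′)) , λ t t<l →
        ≡.trans (cong₂ _∨_ (proj₂ (trace L) t t<l) (proj₂ (trace L′) t t<l)) (absorb (u t) (u≤u′ t t<l))
        where
        absorb : ∀ b {c} → (b ≡ true → c ≡ true) → b ∨ c ≡ c
        absorb true  f = ≡.sym (f ≡.refl)
        absorb false f = ≡.refl

    -- Two inclusions from monotonicity. This identifies the cut stored at an arbitrary index with
    -- the one at the index that `encode` selects for the same digits.
    leastMinCut-unique : Edges → ∀ {u u′ T T′} → LeastMinCut u T → LeastMinCut u′ T′ →
                         (∀ t → t < l → u t ≡ u′ t) → ∀ v → v < n → T v ≡ T′ v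
    leastMinCut-unique E {T = T} {T′} L L′ e v v<n = iff
      (leastMinCut-mono E L L′ (λ t t<l p → ≡.trans (≡.sym (e t t<l)) p) v v<n)
      (leastMinCut-mono E L′ L (λ t t<l p → ≡.trans (e t t<l) p) v v<n)
      where
      iff : ∀ {b c} → (b ≡ true → c ≡ true) → (c ≡ true → b ≡ true) → b ≡ c
      iff {true}  {c}     f g = ≡.sym (f ≡.refl)
      iff {false} {true}  f g = g ≡.refl
      iff {false} {false} f g = ≡.refl

-- Numbering the classes and merging parallel arcs

record Numbered (j : ℕ) (cls num hcls : ℕ → ℕ) (np : ℕ) : Set where
  field
    np≤j     : np ≤ j
    num<np   : ∀ v → v < j → num v < np
    hcls-num : ∀ v → v < j → hcls (num v) ≡ cls v
    distinct : ∀ {p q} → p < np → q < np → hcls p ≡ hcls q → p ≡ q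
    witness  : ∀ p → p < np → ∃[ v ] v < j × num v ≡ p

numbered-0 : ∀ {cls num hcls} → Numbered 0 cls num hcls 0
numbered-0 = record { np≤j = z≤n ; num<np = λ _ () ; hcls-num = λ _ () ; distinct = λ () ; witness = λ _ () }

numbered-old : ∀ {j cls num hcls np k} → Numbered j cls num hcls np → k < np → hcls k ≡ cls j →
               Numbered (suc j) cls (upd num j k) hcls np
numbered-old {j} {cls} {num} {hcls} {np} {k} N k<np e = record
  { np≤j = m≤n⇒m≤1+n np≤j
  ; num<np = below-suc (λ v v<j → subst (_< np) (≡.sym (old v v<j)) (num<np v v<j)) (subst (_< np) (≡.sym (upd-same num j k)) k<np)
  ; hcls-num = below-suc (λ v v<j → ≡.trans (cong hcls (old v v<j)) (hcls-num v v<j)) (≡.trans (cong hcls (upd-same num j k)) e)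
  ; distinct = distinct
  ; witness = λ p p<np → let v , v<j , e = witness p p<np in v , m<n⇒m<1+n v<j , ≡.trans (old v v<j) e }
  where
  open Numbered N
  old : ∀ v → v < j → upd num j k v ≡ num v
  old v v<j = upd-other num k (<⇒≢ v<j)

numbered-new : ∀ {j cls num hcls np} → Numbered j cls num hcls np → (∀ q → q < np → hcls q ≢ cls j) →
               Numbered (suc j) cls (upd num j np) (upd hcls np (cls j)) (np + 1)
numbered-new {j} {cls} {num} {hcls} {np} N fresh rewrite +-comm np 1 = record
  { np≤j = s≤s np≤j
  ; num<np = below-suc (λ v v<j → subst (_< suc np) (≡.sym (old v v<j)) (m<n⇒m<1+n (num<np v v<j))) (subst (_< suc np) (≡.sym (upd-same num j np)) ≤-refl)
  ; hcls-num = below-suc (λ v v<j → ≡.trans (cong hcls′ (old v v<j)) (≡.trans (hold _ (num<np v v<j)) (hcls-num v v<j)))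
                          (≡.trans (cong hcls′ (upd-same num j np)) hnew)
  ; distinct = dist
  ; witness = below-suc (λ p p<np → let v , v<j , e = witness p p<np in v , m<n⇒m<1+n v<j , ≡.trans (old v v<j) e)
                         (j , ≤-refl , upd-same num j np) }
  where
  open Numbered N
  hcls′ = upd hcls np (cls j)
  old : ∀ v → v < j → upd num j np v ≡ num v
  old v v<j = upd-other num np (<⇒≢ v<j)
  hold : ∀ p → p < np → hcls′ p ≡ hcls p
  hold p p<np = upd-other hcls (cls j) (<⇒≢ p<np)
  hnew : hcls′ np ≡ cls j
  hnew = upd-same hcls np (cls j)
  dist : ∀ {p q} → p < suc np → q < suc np → hcls′ p ≡ hcls′ q → p ≡ q
  dist {p} {q} p< q< e with m<1+n⇒m<n∨m≡n p< | m<1+n⇒m<n∨m≡n q<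
  ... | inj₁ p<np   | inj₁ q<np   = distinct p<np q<np (≡.trans (≡.sym (hold p p<np)) (≡.trans e (hold q q<np)))
  ... | inj₁ p<np   | inj₂ ≡.refl = contradiction (≡.trans (≡.sym (hold p p<np)) (≡.trans e hnew)) (fresh p p<np)
  ... | inj₂ ≡.refl | inj₁ q<np   = contradiction (≡.trans (≡.sym (hold q q<np)) (≡.trans (≡.sym e) hnew)) (fresh q q<np)
  ... | inj₂ ≡.refl | inj₂ ≡.refl = ≡.refl

module Contraction (ℝ : RealNumbers) (M : ℕ) (tail head : ℕ → ℕ) (cap : ℕ → RealNumbers.Carrier ℝ) (num : ℕ → ℕ) (np : ℕ) where
  open Reals ℝ

  -- Every edge is represented by two opposite arcs; between distinct classes
  -- exactly one of them is increasing.

  separates : (ℕ → Bool) → ℕ → ℕ → Bool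
  separates B s t = does (num s + 1 ≤? num t) ∧ (B (num s) xor B (num t))

  record Contracted (j cnt : ℕ) (hs ht : ℕ → ℕ) (hc : ℕ → Carrier) : Set where
    field
      cnt≤j  : cnt ≤ j
      hs<ht  : ∀ i → i < cnt → hs i < ht i
      ht<np  : ∀ i → i < cnt → ht i < np
      hc>0   : ∀ i → i < cnt → 0# <ʳ hc i
      simple : ∀ {i i′} → i < cnt → i′ < cnt → hs i ≡ hs i′ → ht i ≡ ht i′ → i ≡ i′
      sums   : ∀ B → S cnt (λ i → ind (B (hs i) xor B (ht i)) (hc i)) ≈
                     S j (λ a → ind (separates B (tail a) (head a)) (cap a))

  contracted-0 : ∀ {hs ht hc} → Contracted 0 0 hs ht hc
  contracted-0 = record { cnt≤j = z≤n ; hs<ht = λ _ () ; ht<np = λ _ () ; hc>0 = λ _ () ; simple = λ () ; sums = λ _ → ≈-refl }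

  >0-+ : ∀ {x y} → 0# <ʳ x → 0# <ʳ y → 0# <ʳ (x +ʳ y)
  >0-+ {x} {y} (0≤x , 0≉x) (0≤y , _) = 0≤+ 0≤x 0≤y , λ e → 0≉x (antisym 0≤x (≤ʳ-trans (x≤x+y 0≤y) (≤ʳ-reflexive (≈-sym e))))

  module _ {j cnt hs ht hc} (C : Contracted j cnt hs ht hc) where
    open Contracted C

    contracted-skip : ¬ (num (tail j) + 1 ≤ num (head j)) → Contracted (suc j) cnt hs ht hc
    contracted-skip nle = record
      { cnt≤j = m≤n⇒m≤1+n cnt≤j ; hs<ht = hs<ht ; ht<np = ht<np ; hc>0 = hc>0 ; simple = simple
      ; sums = λ B → ≈-trans (sums B) (≈-trans (≈-sym (+ʳ-identityʳ _)) (+-congˡ (≈-reflexive (cong (λ b → ind (b ∧ (B (num (tail j)) xor B (num (head j)))) (cap j)) (≡.sym (dec-false (_ ≤? _) nle)))))) }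

    module _ (le : num (tail j) + 1 ≤ num (head j)) (cap>0 : 0# <ʳ cap j) where
      separated : ∀ B → ind (B (num (tail j)) xor B (num (head j))) (cap j) ≈ ind (separates B (tail j) (head j)) (cap j)
      separated B = ≈-reflexive (cong (λ b → ind (b ∧ (B (num (tail j)) xor B (num (head j)))) (cap j)) (≡.sym (dec-true (_ ≤? _) le)))

      contracted-old : ∀ {k} → k < cnt → hs k ≡ num (tail j) → ht k ≡ num (head j) →
                       Contracted (suc j) cnt hs ht (add hc k (cap j))
      contracted-old {k} k<cnt es et = record
        { cnt≤j = m≤n⇒m≤1+n cnt≤j ; hs<ht = hs<ht ; ht<np = ht<np ; simple = simple
        ; hc>0 = positive
        ; sums = λ B → ≈-trans (S-add cnt (λ i → B (hs i) xor B (ht i)) hc (cap j) k<cnt)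
            (+-cong (sums B) (≈-trans (≈-reflexive (cong₂ (λ s t → ind (B s xor B t) (cap j)) es et)) (separated B))) }
        where
        positive : ∀ i → i < cnt → 0# <ʳ add hc k (cap j) i
        positive i i<cnt with i ≟ k
        ... | yes ≡.refl = subst (0# <ʳ_) (≡.sym (upd-same hc k _)) (>0-+ (hc>0 k i<cnt) cap>0)
        ... | no i≢k     = subst (0# <ʳ_) (≡.sym (upd-other hc _ i≢k)) (hc>0 i i<cnt)

      contracted-new : num (head j) < np → (∀ i → i < cnt → hs i ≡ num (tail j) → ht i ≡ num (head j) → ⊥) →
                       Contracted (suc j) (cnt + 1) (upd hs cnt (num (tail j))) (upd ht cnt (num (head j))) (upd hc cnt (cap j))
      contracted-new t<np fresh rewrite +-comm cnt 1 = record
        { cnt≤j = s≤s cnt≤j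
        ; hs<ht = below-suc (λ i i<cnt → subst₂ _<_ (≡.sym (old hs i i<cnt)) (≡.sym (old ht i i<cnt)) (hs<ht i i<cnt))
                             (subst₂ _<_ (≡.sym (upd-same hs cnt _)) (≡.sym (upd-same ht cnt _)) (subst (_≤ num (head j)) (+-comm _ 1) le))
        ; ht<np = below-suc (λ i i<cnt → subst (_< np) (≡.sym (old ht i i<cnt)) (ht<np i i<cnt)) (subst (_< np) (≡.sym (upd-same ht cnt _)) t<np)
        ; hc>0 = below-suc (λ i i<cnt → subst (0# <ʳ_) (≡.sym (old hc i i<cnt)) (hc>0 i i<cnt)) (subst (0# <ʳ_) (≡.sym (upd-same hc cnt _)) cap>0)
        ; simple = simple′
        ; sums = λ B → +-cong
            (≈-trans (S-cong cnt (λ i i<cnt → ≈-reflexive (≡.trans (cong₂ (λ s t → ind (B s xor B t) _) (old hs i i<cnt) (old ht i i<cnt)) (cong (ind _) (old hc i i<cnt))))) (sums B))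
            (≈-trans (≈-reflexive (≡.trans (cong₂ (λ s t → ind (B s xor B t) _) (upd-same hs cnt _) (upd-same ht cnt _)) (cong (ind (B (num (tail j)) xor B (num (head j)))) (upd-same hc cnt (cap j))))) (separated B)) }
        where
        old : ∀ {A : Set} (f : ℕ → A) {y} i → i < cnt → upd f cnt y i ≡ f i
        old f i i<cnt = upd-other f _ (<⇒≢ i<cnt)
        simple′ : ∀ {i i′} → i < suc cnt → i′ < suc cnt → upd hs cnt (num (tail j)) i ≡ upd hs cnt (num (tail j)) i′ →
                  upd ht cnt (num (head j)) i ≡ upd ht cnt (num (head j)) i′ → i ≡ i′
        simple′ {i} {i′} i< i′< e e′ with m<1+n⇒m<n∨m≡n i< | m<1+n⇒m<n∨m≡n i′<
        ... | inj₁ p      | inj₁ q      = simple p q (≡.trans (≡.sym (old hs i p)) (≡.trans e (old hs i′ q)))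
                                                     (≡.trans (≡.sym (old ht i p)) (≡.trans e′ (old ht i′ q)))
        ... | inj₁ p      | inj₂ ≡.refl = ⊥-elim (fresh i p (≡.trans (≡.sym (old hs i p)) (≡.trans e (upd-same hs cnt _)))
                                                            (≡.trans (≡.sym (old ht i p)) (≡.trans e′ (upd-same ht cnt _))))
        ... | inj₂ ≡.refl | inj₁ q      = ⊥-elim (fresh i′ q (≡.trans (≡.sym (old hs i′ q)) (≡.trans (≡.sym e) (upd-same hs cnt _)))
                                                             (≡.trans (≡.sym (old ht i′ q)) (≡.trans (≡.sym e′) (upd-same ht cnt _))))
        ... | inj₂ ≡.refl | inj₂ ≡.refl = ≡.refl

  -- Pulling a side back along `num` preserves its capacity, so a side of the quotient is never
  -- cheaper than a side of the graph. Edges inside a class vanish on both sides of the equation.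
  contracted-capacity : ∀ {n m src tgt c rev cnt hs ht hc} → Cuts.Doubled ℝ n m src tgt c m M tail head rev cap → Contracted M cnt hs ht hc →
    ∀ B → S cnt (λ i → ind (B (hs i) xor B (ht i)) (hc i)) ≈ Cuts.capacity-of ℝ n m src tgt c (λ v → B (num v))
  contracted-capacity {m = m} {src} {tgt} {c} D C B = ≈-trans (Contracted.sums C B)
    (≈-trans (Cuts.Doubled.sums D (separates B)) (S-cong m (λ e _ → once (src e) (tgt e) (c e))))
    where
    once : ∀ s t x → (ind (separates B s t) x +ʳ ind (separates B t s) x) ≈ ind (B (num s) xor B (num t)) x
    once s t x with <-cmp (num s) (num t)
    ... | tri< lt _ gt = ≈-trans (+-cong (≈-reflexive (cong (λ b → ind (b ∧ (B (num s) xor B (num t))) x) (dec-true (_ ≤? _) (subst (_≤ num t) (+-comm 1 _) lt))))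
                                         (≈-reflexive (cong (λ b → ind (b ∧ (B (num t) xor B (num s))) x) (dec-false (_ ≤? _) (λ le → gt (subst (_≤ num s) (+-comm _ 1) le))))))
                                 (+ʳ-identityʳ _)
    ... | tri> nlt _ gt = ≈-trans (+-cong (≈-reflexive (cong (λ b → ind (b ∧ (B (num s) xor B (num t))) x) (dec-false (_ ≤? _) (λ le → nlt (subst (_≤ num t) (+-comm _ 1) le)))))
                                          (≈-reflexive (cong₂ (λ b b′ → ind (b ∧ b′) x) (dec-true (_ ≤? _) (subst (_≤ num s) (+-comm 1 _) gt)) (xor-comm (B (num t)) (B (num s))))))
                                 (+ʳ-identityˡ _)
    ... | tri≈ _ e _ rewrite e | xor-same (B (num t)) | ∧-zeroʳ (does (num t + 1 ≤? num t)) = +ʳ-identityˡ _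

-- Monotone Boolean functions and antichains

module MonotoneFunctions where
  open import Data.Bool.Base using (Bool; true; false)
  import Data.Bool.Properties as Bool
  open import Data.Fin.Base using (Fin)
  open import Data.Fin.Properties using (all?; any?; injective⇒≤)
  open import Data.Fin.Subset using (Subset; inside; outside; _∈_; _⊆_; ∣_∣; _-_; ⁅_⁆)
  open import Data.Fin.Subset.Properties using (_∈?_; ⊆-antisym; p─q⊆p; x∈p∧x≢y⇒x∈p-y; x∈p⇒∣p-x∣<∣p∣)
  open import Data.List.Base as List using (List; []; _∷_; filter; map)
  open import Data.List.Membership.Propositional using () renaming (_∈_ to _∈ˡ_)
  open import Data.List.Membership.Propositional.Properties using (∈-filter⁺; ∈-filter⁻; ∈-++⁺ˡ; ∈-++⁺ʳ; ∈-map⁺; ∈-map⁻)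
  open import Data.List.Relation.Unary.All as All using (All; []; _∷_)
  open import Data.List.Relation.Unary.All.Properties using (all-filter)
  open import Data.List.Relation.Unary.AllPairs using (AllPairs; []; _∷_; allPairs?)
  open import Data.List.Relation.Unary.Any using (here; index)
  open import Data.List.Relation.Unary.Any.Properties using (lookup-index)
  open import Data.List.Relation.Unary.Unique.Propositional using (Unique)
  import Data.List.Relation.Unary.Unique.Propositional.Properties as Unique
  open import Data.Nat.Base using (ℕ; zero; suc; _≤_; _<_)
  open import Data.Nat.Induction using (<-wellFounded)
  open import Data.Product.Base using (_×_; _,_; ∃-syntax; proj₁; proj₂)
  open import Data.Vec.Base as Vec using ([]; _∷_)
  open import Data.Vec.Properties using (∷-injectiveʳ)
  open import Function.Bundles using (mk⇔)
  open import Induction.WellFounded using (Acc; acc)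
  open import Relation.Binary.Core using (Rel)
  open import Level using (0ℓ)
  open import Relation.Binary.PropositionalEquality using (_≡_; _≢_; refl; sym; trans; cong; subst)
  open import Relation.Nullary.Decidable using (Dec; yes; no; does; _×-dec_; _→-dec_)
  open import Relation.Nullary.Negation using (¬_; contradiction)
  open import Relation.Unary using (Pred)

  ∈-allSubsets : ∀ {n} (U : Subset n) → U ∈ˡ allSubsets n
  ∈-allSubsets []            = here refl
  ∈-allSubsets (outside ∷ U) = ∈-++⁺ˡ (∈-map⁺ (outside ∷_) (∈-allSubsets U))
  ∈-allSubsets (inside ∷ U)  = ∈-++⁺ʳ (map (outside ∷_) (allSubsets _)) (∈-map⁺ (inside ∷_) (∈-allSubsets U))

  allSubsets-unique : ∀ n → Unique (allSubsets n)
  allSubsets-unique zero    = [] ∷ []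
  allSubsets-unique (suc n) = Unique.++⁺
    (Unique.map⁺ ∷-injectiveʳ (allSubsets-unique n)) (Unique.map⁺ ∷-injectiveʳ (allSubsets-unique n))
    λ (o , i) → heads (∈-map⁻ (outside ∷_) o) (∈-map⁻ (inside ∷_) i)
    where
    heads : ∀ {V} → ∃[ U ] U ∈ˡ allSubsets n × V ≡ outside ∷ U → ¬ (∃[ U ] U ∈ˡ allSubsets n × V ≡ inside ∷ U)
    heads (_ , _ , refl) (_ , _ , ())

  -- `dedekind` counts sublists of one fixed enumeration, so an antichain has to be listed in that
  -- order. Filtering the enumeration does so.
  filter-∈-sublists : ∀ {A : Set} {P : Pred A 0ℓ} (P? : ∀ x → Dec (P x)) xs → filter P? xs ∈ˡ sublists xs
  filter-∈-sublists P? []       = here refl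
  filter-∈-sublists P? (x ∷ xs) with does (P? x)
  ... | true  = ∈-++⁺ʳ (sublists xs) (∈-map⁺ (x ∷_) (filter-∈-sublists P? xs))
  ... | false = ∈-++⁺ˡ (filter-∈-sublists P? xs)

  AllPairs-refine : ∀ {A : Set} {P : Pred A 0ℓ} {R R′ : Rel A 0ℓ} → (∀ {x y} → P x → P y → R x y → R′ x y) →
                    ∀ {xs} → All P xs → AllPairs R xs → AllPairs R′ xs
  AllPairs-refine f []         []         = []
  AllPairs-refine f (px ∷ pxs) (rx ∷ rxs) =
    All.zipWith (λ (py , r) → f px py r) (pxs , rx) ∷ AllPairs-refine f pxs rxs

  module _ {m : ℕ} (f : Subset m → Bool) where
    Monotone : Set
    Monotone = ∀ {U V} → U ⊆ V → f U ≡ true → f V ≡ true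

    -- Only the removal of single elements is tested, which a search through `Fin m` decides. For
    -- monotone `f` this is minimality with respect to inclusion.
    Minimal : Pred (Subset m) 0ℓ
    Minimal U = f U ≡ true × (∀ x → x ∈ U → f (U - x) ≡ false)

    minimal? : ∀ U → Dec (Minimal U)
    minimal? U = (f U Bool.≟ true) ×-dec all? (λ x → (x ∈? U) →-dec (f (U - x) Bool.≟ false))

    minimals : List (Subset m)
    minimals = filter minimal? (allSubsets m)

    minimal-below : ∀ U → f U ≡ true → ∃[ V ] V ⊆ U × Minimal V
    minimal-below U = go U (<-wellFounded ∣ U ∣)
      where
      go : ∀ U → Acc _<_ ∣ U ∣ → f U ≡ true → ∃[ V ] V ⊆ U × Minimal V
      go U (acc rs) fU with any? (λ x → (x ∈? U) ×-dec (f (U - x) Bool.≟ true))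
      ... | yes (x , x∈U , e) = let V , V⊆ , min = go (U - x) (rs (x∈p⇒∣p-x∣<∣p∣ x∈U)) e in
                                V , (λ y∈V → p─q⊆p U ⁅ x ⁆ (V⊆ y∈V)) , min
      ... | no none = U , (λ x∈U → x∈U) , fU , λ x x∈U → Bool.¬-not (λ e → none (x , x∈U , e))

    module _ (mono : Monotone) where
      -- An element `x` of V outside U would give `U ⊆ V - x`; monotonicity makes f true at `V - x`,
      -- against the minimality of V.
      minimal-⊆ : ∀ {U V} → Minimal U → Minimal V → U ⊆ V → U ≡ V
      minimal-⊆ {U} {V} (fU , _) (_ , minV) U⊆V = ⊆-antisym U⊆V V⊆U
        where
        V⊆U : V ⊆ U
        V⊆U {x} x∈V with x ∈? U
        ... | yes x∈U = x∈U
        ... | no x∉U  = contradiction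
          (trans (sym (mono (λ {y} y∈U → x∈p∧x≢y⇒x∈p-y (U⊆V y∈U) (λ { refl → x∉U y∈U })) fU)) (minV x x∈V)) λ ()

      minimals-antichain : Antichain minimals
      minimals-antichain = AllPairs-refine
        (λ minU minV U≢V → (λ U⊆V → U≢V (minimal-⊆ minU minV U⊆V)) , (λ V⊆U → U≢V (sym (minimal-⊆ minV minU V⊆U))))
        (all-filter minimal? (allSubsets m)) (Unique.filter⁺ minimal? (allSubsets-unique m))

  minimals-determine : ∀ {m} (f g : Subset m → Bool) → Monotone g → minimals f ≡ minimals g →
                       ∀ U → f U ≡ true → g U ≡ true
  minimals-determine f g mono e U fU =
    let V , V⊆U , min = minimal-below f U fU
        _ , gV , _ = ∈-filter⁻ (minimal? g) {xs = allSubsets _} (subst (V ∈ˡ_) e (∈-filter⁺ (minimal? f) (∈-allSubsets V) min))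
    in mono V⊆U gV

  -- A monotone function is the upward closure of its minimal sets, so the position of this
  -- antichain in the list that `dedekind` counts determines the function.
  monotone-count : ∀ m p (f : Fin p → Subset m → Bool) → (∀ i → Monotone (f i)) →
                   (∀ i j → (∀ U → f i U ≡ f j U) → i ≡ j) → p ≤ dedekind m
  monotone-count m p f mono distinct = injective⇒≤ injective
    where
    antichains = filter (allPairs? incomparable?) (sublists (allSubsets m))
    member : ∀ i → minimals (f i) ∈ˡ antichains
    member i = ∈-filter⁺ (allPairs? incomparable?) (filter-∈-sublists (minimal? (f i)) (allSubsets m))
                 (minimals-antichain (f i) (mono i))
    injective : ∀ {i j} → index (member i) ≡ index (member j) → i ≡ j
    injective {i} {j} e = distinct i j λ U → Bool.⇔→≡
      {z = true} (mk⇔ (minimals-determine (f i) (f j) (mono j) same U)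
                      (minimals-determine (f j) (f i) (mono i) (sym same) U))
      where
      same : minimals (f i) ≡ minimals (f j)
      same = trans (lookup-index (member i)) (trans (cong (List.lookup antichains) e) (sym (lookup-index (member j))))

open MonotoneFunctions using (monotone-count)

-- SIZE, SRC, TGT, TERM and WEIGHT hold the input and, in the end, the output.
-- From WEIGHT on the names are those of arrays of reals, numbered afresh.

pattern SIZE = 0
pattern SRC = 1
pattern TGT = 2
pattern TERM = 3
pattern TAIL = 4
pattern HEAD = 5
pattern REV = 6
pattern ARCS = 7
pattern LABEL = 8
pattern SINK = 9
pattern CHANGED = 10
pattern CUR = 11
pattern ARC = 12
pattern FOUND = 13
pattern CLS = 14
pattern CUT = 15
pattern POW = 16
pattern REM = 17
pattern IDX = 18
pattern VTX = 19
pattern HCLS = 20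
pattern NUM = 21
pattern CLASSES = 22
pattern COUNT = 23
pattern EDGE = 24
pattern WEIGHT = 0
pattern CAP = 1
pattern RESIDUE = 2
pattern EXCESS = 3
pattern AMOUNT = 4

! : ArrayName → NatExp
! a = a [ lit 0 ]

#V #K #E #K∸1 : NatExp
#V   = SIZE [ lit 0 ]
#K   = SIZE [ lit 1 ]
#E   = SIZE [ lit 2 ]
#K∸1 = #K ⊖ lit 1

-- The program

addArc : Program
addArc =
    setNat TAIL (! ARCS) (SRC [ ! EDGE ]) ⨾ setNat HEAD (! ARCS) (TGT [ ! EDGE ])
  ⨾ setNat REV (! ARCS) (! ARCS ⊕ lit 1) ⨾ setReal CAP (! ARCS) (WEIGHT [ ! EDGE ])
  ⨾ setNat TAIL (! ARCS ⊕ lit 1) (TGT [ ! EDGE ]) ⨾ setNat HEAD (! ARCS ⊕ lit 1) (SRC [ ! EDGE ])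
  ⨾ setNat REV (! ARCS ⊕ lit 1) (! ARCS) ⨾ setReal CAP (! ARCS ⊕ lit 1) (WEIGHT [ ! EDGE ])
  ⨾ setNat ARCS (lit 0) (! ARCS ⊕ lit 2)

addArcs : Program
addArcs = for EDGE #E addArc

power : Program
power = setNat POW (lit 0) (lit 1) ⨾ for IDX #K∸1 (setNat POW (lit 0) (! POW ⊕ ! POW))

resetVertex : Program
resetVertex =
    setNat SINK (! VTX) (lit 0) ⨾ setNat LABEL (! VTX) (lit 0) ⨾ setReal EXCESS (! VTX) 0ʳ

reset : Program
reset = for VTX #V resetVertex

-- The index shift passes over terminal 0, which `minCut` makes a source in every cut.
decodeBit : Program
decodeBit =
    setNat REM (lit 0) (! REM ⊕ ! REM)
  ⨾ ifThenElse (natLE (! POW) (! REM))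
      (setNat REM (lit 0) (! REM ⊖ ! POW) ⨾ setNat SINK (TERM [ ! IDX ⊕ lit 1 ]) (lit 1))
      (setNat LABEL (TERM [ ! IDX ⊕ lit 1 ]) #V)

decode : Program
decode = for IDX #K∸1 decodeBit

saturateArc : Program
saturateArc =
    ifThenElse (natLE #V (LABEL [ TAIL [ ! ARC ] ]))
    (setReal RESIDUE (! ARC) 0ʳ ⨾ setReal EXCESS (HEAD [ ! ARC ]) (EXCESS [ HEAD [ ! ARC ] ] ⊕ CAP [ ! ARC ]))
    (setReal RESIDUE (! ARC) (CAP [ ! ARC ]))

saturate : Program
saturate = for ARC (! ARCS) saturateArc

admissible : List Test
admissible = natLE (TAIL [ ! ARC ]) (! CUR) ∷ natLE (! CUR) (TAIL [ ! ARC ]) ∷ neg (realLE (RESIDUE [ ! ARC ]) 0ʳ)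
           ∷ natLE (LABEL [ ! CUR ]) (LABEL [ HEAD [ ! ARC ] ] ⊕ lit 1) ∷ natLE (LABEL [ HEAD [ ! ARC ] ] ⊕ lit 1) (LABEL [ ! CUR ]) ∷ []

push : Program
push = setNat CHANGED (lit 0) (lit 1)
  ⨾ ifThenElse (realLE (EXCESS [ ! CUR ]) (RESIDUE [ ! FOUND ])) (setReal AMOUNT (lit 0) (EXCESS [ ! CUR ])) (setReal AMOUNT (lit 0) (RESIDUE [ ! FOUND ]))
  ⨾ setReal RESIDUE (! FOUND) (RESIDUE [ ! FOUND ] ⊖ AMOUNT [ lit 0 ])
  ⨾ setReal RESIDUE (REV [ ! FOUND ]) (RESIDUE [ REV [ ! FOUND ] ] ⊕ AMOUNT [ lit 0 ])
  ⨾ setReal EXCESS (! CUR) (EXCESS [ ! CUR ] ⊖ AMOUNT [ lit 0 ])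
  ⨾ setReal EXCESS (HEAD [ ! FOUND ]) (EXCESS [ HEAD [ ! FOUND ] ] ⊕ AMOUNT [ lit 0 ])

-- A vertex without excess is relabelled too if no admissible arc leaves it: in
-- the end the vertices labelled below n are those from which a sink can be
-- reached, and no separate graph search is needed.

settle : Program
settle = when (natLE (LABEL [ ! CUR ] ⊕ lit 1) #V ∷ neg (natLE (lit 1) (SINK [ ! CUR ])) ∷ [])
  ( search ARC FOUND (! ARCS) admissible
  ⨾ ifThenElse (natLE (! ARCS) (! FOUND))
      (setNat LABEL (! CUR) (LABEL [ ! CUR ] ⊕ lit 1) ⨾ setNat CHANGED (lit 0) (lit 1))
      (when (neg (realLE (EXCESS [ ! CUR ]) 0ʳ) ∷ []) push))

-- A pass that changes nothing has examined all vertices in one and the same state, so all of them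
-- are settled in it.
settleAll : Program
settleAll = setNat CHANGED (lit 0) (lit 1)
  ⨾ while (natLE (lit 1) (! CHANGED)) (setNat CHANGED (lit 0) (lit 0) ⨾ for CUR #V settle)

-- The sides of all the cuts on which a vertex lies are the binary digits of CLS.

recordVertex : Program
recordVertex =
    ifThenElse (natLE (LABEL [ ! VTX ] ⊕ lit 1) #V)
    (setNat CLS (! VTX) (CLS [ ! VTX ] ⊕ CLS [ ! VTX ] ⊕ lit 1))
    (setNat CLS (! VTX) (CLS [ ! VTX ] ⊕ CLS [ ! VTX ]))

record-side : Program
record-side = for VTX #V recordVertex

minCut : Program
minCut = reset ⨾ setNat LABEL (TERM [ lit 0 ]) #V ⨾ setNat REM (lit 0) (! CUT) ⨾ decode ⨾ saturate ⨾ settleAll ⨾ record-side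

numberVertex : Program
numberVertex =
    search ARC FOUND (! CLASSES) (natLE (HCLS [ ! ARC ]) (CLS [ ! VTX ]) ∷ natLE (CLS [ ! VTX ]) (HCLS [ ! ARC ]) ∷ [])
  ⨾ setNat NUM (! VTX) (! FOUND)
  ⨾ when (natLE (! CLASSES) (! FOUND) ∷ [])
      (setNat HCLS (! CLASSES) (CLS [ ! VTX ]) ⨾ setNat CLASSES (lit 0) (! CLASSES ⊕ lit 1))

number : Program
number = for VTX #V numberVertex

parallel : List Test
parallel = natLE (SRC [ ! EDGE ]) (NUM [ TAIL [ ! ARC ] ]) ∷ natLE (NUM [ TAIL [ ! ARC ] ]) (SRC [ ! EDGE ])
         ∷ natLE (TGT [ ! EDGE ]) (NUM [ HEAD [ ! ARC ] ]) ∷ natLE (NUM [ HEAD [ ! ARC ] ]) (TGT [ ! EDGE ]) ∷ []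

-- Output edges may overwrite the input edges, since endpoints and capacities are now read from
-- `TAIL`, `HEAD` and `CAP`. Old entries from `COUNT` on are cut off by the new edge count.
contractArc : Program
contractArc =
    when (natLE (NUM [ TAIL [ ! ARC ] ] ⊕ lit 1) (NUM [ HEAD [ ! ARC ] ]) ∷ [])
    ( search EDGE FOUND (! COUNT) parallel
    ⨾ ifThenElse (natLE (! COUNT) (! FOUND))
        ( setNat SRC (! COUNT) (NUM [ TAIL [ ! ARC ] ]) ⨾ setNat TGT (! COUNT) (NUM [ HEAD [ ! ARC ] ])
        ⨾ setReal WEIGHT (! COUNT) (CAP [ ! ARC ]) ⨾ setNat COUNT (lit 0) (! COUNT ⊕ lit 1))
        (setReal WEIGHT (! FOUND) (WEIGHT [ ! FOUND ] ⊕ CAP [ ! ARC ])))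

contract : Program
contract = for ARC (! ARCS) contractArc

output : Program
output = for IDX #K (setNat TERM (! IDX) (NUM [ TERM [ ! IDX ] ]))
  ⨾ setNat SIZE (lit 0) (! CLASSES) ⨾ setNat SIZE (lit 2) (! COUNT)

mimic : Program
mimic = addArcs ⨾ power ⨾ for CUT (! POW) minCut ⨾ number ⨾ contract ⨾ output

-- Correctness of the program

module Setup (ℝ : RealNumbers) (B : ℕ) .{{_ : NonZero B}} (σ₀ : Machine.Store ℝ) where
  open Reals ℝ
  open Machine ℝ
  open Logic ℝ B

  n m l : ℕ
  n = nats σ₀ SIZE 0
  m = nats σ₀ SIZE 2
  l = nats σ₀ SIZE 1 ∸ 1

  open Cuts ℝ n m (nats σ₀ SRC) (nats σ₀ TGT) (reals σ₀ WEIGHT)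

  addArcs-spec : Edges → m ≤ B → nats σ₀ ARCS 0 ≡ 0 →
    WP addArcs σ₀ (λ τ → Doubled m (nats τ ARCS 0) (nats τ TAIL) (nats τ HEAD) (nats τ REV) (reals τ CAP))
  addArcs-spec edges m≤B start = for-rule EDGE #E addArc I m m≤B ≡.refl
    (λ τ u → cong-app (nats-≡ u SIZE ≡.refl) 2)
    (subst (λ z → Doubled 0 z (nats σ₀ TAIL) (nats σ₀ HEAD) (nats σ₀ REV) (reals σ₀ CAP)) (≡.sym start) doubled-0)
    (λ τ u j<m D → subst₃ (λ s t c → let j = nats τ EDGE 0 ; M = nats τ ARCS 0 in Doubled (suc j) (M + 2)
        (upd (upd (nats τ TAIL) M (s j)) (M + 1) (t j)) (upd (upd (nats τ HEAD) M (t j)) (M + 1) (s j))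
        (upd (upd (nats τ REV) M (M + 1)) (M + 1) M) (upd (upd (reals τ CAP) M (c j)) (M + 1) (c j)))
      (≡.sym (nats-≡ u SRC ≡.refl)) (≡.sym (nats-≡ u TGT ≡.refl)) (≡.sym (reals-≡ u WEIGHT ≡.refl))
      (doubled-suc edges j<m D))
    (λ τ u D → D)
    where
    I : ℕ → Assertion
    I j τ = Doubled j (nats τ ARCS 0) (nats τ TAIL) (nats τ HEAD) (nats τ REV) (reals τ CAP)
    subst₃ : ∀ {X Y Z : Set} (P : X → Y → Z → Set) {x x′ y y′ z z′} → x ≡ x′ → y ≡ y′ → z ≡ z′ → P x y z → P x′ y′ z′
    subst₃ P ≡.refl ≡.refl ≡.refl p = p

  power-spec : ∀ σ → nats σ SIZE 1 ∸ 1 ≡ l → l ≤ B → WP power σ (λ τ → nats τ POW 0 ≡ pow2 l)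
  power-spec σ e l≤B = for-rule IDX #K∸1 (setNat POW (lit 0) (! POW ⊕ ! POW)) (λ t τ → nats τ POW 0 ≡ pow2 t) l l≤B ≡.refl
    (λ τ u → ≡.trans (cong (_∸ 1) (cong-app (nats-≡ u SIZE ≡.refl) 1)) e)
    ≡.refl
    (λ τ u _ p → cong₂ _+_ p p)
    (λ τ u p → p)

-- `σ₁` is the store once arcs and power of two are ready. The graph is read off it once and for
-- all, so that the theory of flows and cuts speaks of fixed arrays while later stores vary; `Env`
-- records that these still hold the same data.
module Main (ℝ : RealNumbers) (B : ℕ) .{{_ : NonZero B}} (σ₁ : Machine.Store ℝ) where
  open Reals ℝ
  open Machine ℝ
  open Logic ℝ B

  n m l M : ℕ
  n = nats σ₁ SIZE 0
  m = nats σ₁ SIZE 2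
  l = nats σ₁ SIZE 1 ∸ 1
  M = nats σ₁ ARCS 0

  tail head rev term : ℕ → ℕ
  tail = nats σ₁ TAIL
  head = nats σ₁ HEAD
  rev  = nats σ₁ REV
  term = nats σ₁ TERM

  cap : ℕ → Carrier
  cap = reals σ₁ CAP

  open Cuts ℝ n m (nats σ₁ SRC) (nats σ₁ TGT) (reals σ₁ WEIGHT)
  open Traces l term
  open Flow ℝ n M tail head rev cap

  record Env (τ : Store) : Set where
    field
      size≡ : nats τ SIZE ≡ nats σ₁ SIZE
      term≡ : nats τ TERM ≡ term
      tail≡ : nats τ TAIL ≡ tail
      head≡ : nats τ HEAD ≡ head
      rev≡  : nats τ REV ≡ rev
      arcs≡ : nats τ ARCS ≡ nats σ₁ ARCS
      pow≡  : nats τ POW ≡ nats σ₁ POW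
      cap≡  : reals τ CAP ≡ cap

    n≡ : nats τ SIZE 0 ≡ n
    n≡ = cong-app size≡ 0
    l≡ : nats τ SIZE 1 ∸ 1 ≡ l
    l≡ = cong (λ f → f 1 ∸ 1) size≡
    M≡ : nats τ ARCS 0 ≡ M
    M≡ = cong-app arcs≡ 0

  env-self : Env σ₁
  env-self = record { size≡ = ≡.refl ; term≡ = ≡.refl ; tail≡ = ≡.refl ; head≡ = ≡.refl
                    ; rev≡ = ≡.refl ; arcs≡ = ≡.refl ; pow≡ = ≡.refl ; cap≡ = ≡.refl }

  any-false : ∀ (p : ℕ → Bool) xs → any p xs ≡ false → All (λ x → p x ≡ false) xs
  any-false p []       e = []
  any-false p (x ∷ xs) e = proj₁ (∨-false e) ∷ any-false p xs (proj₂ (∨-false {p x} e))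

  constants : List ArrayName
  constants = SIZE ∷ TERM ∷ TAIL ∷ HEAD ∷ REV ∷ ARCS ∷ POW ∷ []

  -- Both hypotheses are syntactic checks that evaluate to `false`, so every use discharges them by
  -- `refl`.
  env-after : ∀ P → any (writesNat P) constants ≡ false → writesReal P CAP ≡ false →
              ∀ {σ τ} → Unchanged P σ τ → Env σ → Env τ
  env-after P e e′ u env with any-false (writesNat P) constants e
  ... | e₁ ∷ e₂ ∷ e₃ ∷ e₄ ∷ e₅ ∷ e₆ ∷ e₇ ∷ [] = record
    { size≡ = ≡.trans (nats-≡ u SIZE e₁) size≡ ; term≡ = ≡.trans (nats-≡ u TERM e₂) term≡
    ; tail≡ = ≡.trans (nats-≡ u TAIL e₃) tail≡ ; head≡ = ≡.trans (nats-≡ u HEAD e₄) head≡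
    ; rev≡ = ≡.trans (nats-≡ u REV e₅) rev≡ ; arcs≡ = ≡.trans (nats-≡ u ARCS e₆) arcs≡
    ; pow≡ = ≡.trans (nats-≡ u POW e₇) pow≡ ; cap≡ = ≡.trans (reals-≡ u CAP e′) cap≡ }
    where open Env env

  record Assumptions : Set where
    field
      edges     : Edges
      doubled   : Doubled m M tail head rev cap
      power≡    : nats σ₁ POW 0 ≡ pow2 l
      term<n    : ∀ {t} → t ≤ l → term t < n
      term-inj  : ∀ {s t} → s ≤ l → t ≤ l → term s ≡ term t → s ≡ t
      n≤B       : n ≤ B
      M≤B       : M ≤ B
      terminals≡ : nats σ₁ SIZE 1 ≡ suc l
      l<B       : l < B
      power≤B   : pow2 l ≤ B
      rounds≤B  : suc (n * n + (suc n * M + (2 + suc n * M) * (n * n))) ≤ B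

  module _ (assumptions : Assumptions) where
    open Assumptions assumptions
    open Doubled doubled using (arcs; cap>0)
    open Arcs arcs

    P : ℕ
    P = pow2 l

    reset-spec : ∀ σ → Env σ → WP reset σ (λ τ → ∀ v → v < n → nats τ SINK v ≡ 0 × nats τ LABEL v ≡ 0 × reals τ EXCESS v ≡ 0#)
    reset-spec σ env = for-rule VTX #V resetVertex
      (λ j τ → ∀ v → v < j → nats τ SINK v ≡ 0 × nats τ LABEL v ≡ 0 × reals τ EXCESS v ≡ 0#) n n≤B ≡.refl
      (λ τ u → Env.n≡ (env-after reset ≡.refl ≡.refl u env))
      (λ _ ())
      (λ τ u _ inv → below-suc
        (λ v v<j → ≡.trans (upd-other (nats τ SINK) 0 (<⇒≢ v<j)) (proj₁ (inv v v<j))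
                 , ≡.trans (upd-other (nats τ LABEL) 0 (<⇒≢ v<j)) (proj₁ (proj₂ (inv v v<j)))
                 , ≡.trans (upd-other (reals τ EXCESS) 0# (<⇒≢ v<j)) (proj₂ (proj₂ (inv v v<j))))
        (upd-same (nats τ SINK) _ 0 , upd-same (nats τ LABEL) _ 0 , upd-same (reals τ EXCESS) _ 0#))
      (λ τ u inv → inv)

    -- `sink-from` and `d-from` say that nothing but the intended terminals is a sink or a source,
    -- so every set with the right trace competes in the flow problem. `sinks` and `sources` say
    -- that all of them are, which gives T its trace.
    record Decoded (j t rem : ℕ) (sink d : ℕ → ℕ) : Set where
      field
        rem≡      : rem ≡ remainder P j t
        sink-from : ∀ v → v < n → 1 ≤ sink v → ∃[ i ] i < t × v ≡ term (suc i) × bit P j i ≡ true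
        d-from    : ∀ v → v < n → d v ≡ 0 ⊎ d v ≡ n × (v ≡ term 0 ⊎ ∃[ i ] i < t × v ≡ term (suc i) × bit P j i ≡ false)
        source₀   : d (term 0) ≡ n
        sinks     : ∀ i → i < t → bit P j i ≡ true → 1 ≤ sink (term (suc i))
        sources   : ∀ i → i < t → bit P j i ≡ false → d (term (suc i)) ≡ n

    upd-either : ∀ (f : ℕ → ℕ) i y (Q : ℕ → Set) v → Q y → Q (f v) → Q (upd f i y v)
    upd-either f i y Q v qy qf with v ≟ i
    ... | yes ≡.refl = subst Q (≡.sym (upd-same f i y)) qy
    ... | no v≢i     = subst Q (≡.sym (upd-other f y v≢i)) qf

    decoded-one : ∀ {j t rem sink d} → Decoded j t rem sink d → P ≤ rem + rem →
                  Decoded j (suc t) (rem + rem ∸ P) (upd sink (term (t + 1)) 1) d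
    decoded-one {j} {t} {rem} {sink} {d} D le rewrite +-comm t 1 = record
      { rem≡ = ≡.trans (cong (λ z → z + z ∸ P) rem≡) (≡.sym (cong (λ b → if b then remainder P j t + remainder P j t ∸ P else remainder P j t + remainder P j t) isOne))
      ; sink-from = from
      ; d-from = λ v v<n → case d-from v v<n of λ
          { (inj₁ e) → inj₁ e ; (inj₂ (e , inj₁ e′)) → inj₂ (e , inj₁ e′)
          ; (inj₂ (e , inj₂ (i , i<t , q))) → inj₂ (e , inj₂ (i , m<n⇒m<1+n i<t , q)) }
      ; source₀ = source₀
      ; sinks = below-suc (λ i i<t e → upd-either sink (term (suc t)) 1 (1 ≤_) _ ≤-refl (sinks i i<t e))
                           (λ _ → subst (1 ≤_) (≡.sym (upd-same sink (term (suc t)) 1)) ≤-refl)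
      ; sources = below-suc sources (λ e → contradiction (≡.trans (≡.sym e) isOne) λ ()) }
      where
      open Decoded D
      isOne : bit P j t ≡ true
      isOne = dec-true (_ ≤? _) (subst (λ z → P ≤ z + z) rem≡ le)
      from : ∀ v → v < n → 1 ≤ upd sink (term (suc t)) 1 v → ∃[ i ] i < suc t × v ≡ term (suc i) × bit P j i ≡ true
      from v v<n s with v ≟ term (suc t)
      ... | yes e = t , ≤-refl , e , isOne
      ... | no v≢ = let i , i<t , q = sink-from v v<n (subst (1 ≤_) (upd-other sink 1 v≢) s) in i , m<n⇒m<1+n i<t , q

    decoded-zero : ∀ {j t rem sink d} → Decoded j t rem sink d → ¬ (P ≤ rem + rem) →
                   Decoded j (suc t) (rem + rem) sink (upd d (term (t + 1)) n)
    decoded-zero {j} {t} {rem} {sink} {d} D nle rewrite +-comm t 1 = record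
      { rem≡ = ≡.trans (cong (λ z → z + z) rem≡) (≡.sym (cong (λ b → if b then remainder P j t + remainder P j t ∸ P else remainder P j t + remainder P j t) isZero))
      ; sink-from = λ v v<n s → let i , i<t , q = sink-from v v<n s in i , m<n⇒m<1+n i<t , q
      ; d-from = from
      ; source₀ = upd-either d (term (suc t)) n (_≡ n) _ ≡.refl source₀
      ; sinks = below-suc sinks (λ e → contradiction (≡.trans (≡.sym isZero) e) λ ())
      ; sources = below-suc (λ i i<t e → upd-either d (term (suc t)) n (_≡ n) _ ≡.refl (sources i i<t e))
                             (λ _ → upd-same d (term (suc t)) n) }
      where
      open Decoded D
      isZero : bit P j t ≡ false
      isZero = dec-false (_ ≤? _) (subst (λ z → ¬ (P ≤ z + z)) rem≡ nle)
      from : ∀ v → v < n → upd d (term (suc t)) n v ≡ 0 ⊎ upd d (term (suc t)) n v ≡ n × (v ≡ term 0 ⊎ ∃[ i ] i < suc t × v ≡ term (suc i) × bit P j i ≡ false)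
      from v v<n with v ≟ term (suc t)
      ... | yes e@≡.refl = inj₂ (upd-same d (term (suc t)) n , inj₂ (t , ≤-refl , e , isZero))
      ... | no v≢ rewrite upd-other d n v≢ = case d-from v v<n of λ
          { (inj₁ e) → inj₁ e ; (inj₂ (e , inj₁ e′)) → inj₂ (e , inj₁ e′)
          ; (inj₂ (e , inj₂ (i , i<t , q))) → inj₂ (e , inj₂ (i , m<n⇒m<1+n i<t , q)) }

    decode-spec : ∀ j σ → Env σ → Decoded j 0 (nats σ REM 0) (nats σ SINK) (nats σ LABEL) →
                  WP decode σ (λ τ → ∃[ rem ] Decoded j l rem (nats τ SINK) (nats τ LABEL))
    decode-spec j σ env start = for-rule IDX #K∸1 decodeBit
      (λ t τ → Decoded j t (nats τ REM 0) (nats τ SINK) (nats τ LABEL)) l (<⇒≤ l<B) ≡.refl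
      (λ τ u → Env.l≡ (env-after decode ≡.refl ≡.refl u env))
      start
      (λ τ u _ inv →
        let env′ = env-after decode ≡.refl ≡.refl u env
            pow = ≡.trans (cong-app (Env.pow≡ env′) 0) power≡
            t = nats τ IDX 0 ; rem = nats τ REM 0 ; sink = nats τ SINK ; d = nats τ LABEL in
        (λ e → subst₂ (λ p w → Decoded j (suc t) (rem + rem ∸ p) (upd sink (w (t + 1)) 1) d) (≡.sym pow) (≡.sym (Env.term≡ env′))
                 (decoded-one inv (subst (_≤ rem + rem) pow (from-does (_ ≤? _) e)))) ,
        (λ e → subst₂ (λ z w → Decoded j (suc t) (rem + rem) sink (upd d (w (t + 1)) z)) (≡.sym (Env.n≡ env′)) (≡.sym (Env.term≡ env′))
                 (decoded-zero inv (λ le → from-does-false (_ ≤? _) e (subst (_≤ rem + rem) (≡.sym pow) le)))))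
      (λ τ u inv → nats τ REM 0 , inv)

    module Cut (d₀ sink : ℕ → ℕ) where
      open Phase arcs d₀ sink

      saturate-spec : ∀ σ → Env σ → nats σ LABEL ≡ d₀ → (∀ v → v < n → d₀ v ≤ n) → (∀ v → v < n → reals σ EXCESS v ≡ 0#) →
                      WP saturate σ (λ τ → Saturated M (reals τ RESIDUE) (reals τ EXCESS))
      saturate-spec σ env d≡ d≤n ex = for-rule ARC (! ARCS) saturateArc
        (λ j τ → Saturated j (reals τ RESIDUE) (reals τ EXCESS)) M M≤B ≡.refl
        (λ τ u → Env.M≡ (env-after saturate ≡.refl ≡.refl u env))
        (saturated-0 ex)
        (λ τ u j<M inv →
          let env′ = env-after saturate ≡.refl ≡.refl u env
              j = nats τ ARC 0 ; r = reals τ RESIDUE ; x = reals τ EXCESS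
              label : nats τ LABEL (nats τ TAIL j) ≡ d₀ (tail j)
              label = cong₂ (λ f g → f (g j)) (≡.trans (nats-≡ u LABEL ≡.refl) d≡) (Env.tail≡ env′)
          in
          (λ e → subst₂ (λ h c → Saturated (suc j) (upd r j 0#) (add x (h j) (c j))) (≡.sym (Env.head≡ env′)) (≡.sym (Env.cap≡ env′))
                   (saturated-closed j<M (subst₂ _≤_ (Env.n≡ env′) label (from-does (_ ≤? _) e)) (d≤n (tail j) (tail<n j<M)) inv)) ,
          (λ e → subst (λ c → Saturated (suc j) (upd r j (c j)) x) (≡.sym (Env.cap≡ env′))
                   (saturated-open j<M (λ le → from-does-false (_ ≤? _) e (subst₂ _≤_ (≡.sym (Env.n≡ env′)) (≡.sym label) le)) inv)))
        (λ τ u inv → inv)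

      State : Set
      State = (ℕ → ℕ) × (ℕ → Carrier) × (ℕ → Carrier)

      state : Store → State
      state τ = nats τ LABEL , reals τ RESIDUE , reals τ EXCESS

      IsPreflow : State → Set
      IsPreflow (d , r , x) = Preflow d r x

      potential : State → ℕ
      potential (d , r , x) = Ψ d r x

      IsSettled : State → ℕ → Set
      IsSettled (d , r , x) = Settled d r x

      state-≡ : ∀ P → any (writesNat P) (LABEL ∷ []) ≡ false → any (writesReal P) (RESIDUE ∷ EXCESS ∷ []) ≡ false →
                ∀ {σ τ} → Unchanged P σ τ → state τ ≡ state σ
      state-≡ P e e′ u with any-false (writesNat P) (LABEL ∷ []) e | any-false (writesReal P) (RESIDUE ∷ EXCESS ∷ []) e′
      ... | e₁ ∷ [] | e₂ ∷ e₃ ∷ [] = cong₂ _,_ (nats-≡ u LABEL e₁) (cong₂ _,_ (reals-≡ u RESIDUE e₂) (reals-≡ u EXCESS e₃))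

      -- Shaped like the value of `all admissible`, down to the final `∧ true`, so that the two
      -- agree definitionally. The arrays are arguments because `admits-cong` has to replace those
      -- of the current store by the fixed ones.
      admits : (t h : ℕ → ℕ) → ℕ → (ℕ → ℕ) → (ℕ → Carrier) → ℕ → Bool
      admits t h u d r a = does (t a ≤? u) ∧ (does (u ≤? t a) ∧ (not (does (r a ≤?ʳ 0#))
                         ∧ (does (d u ≤? d (h a) + 1) ∧ (does (d (h a) + 1 ≤? d u) ∧ true))))

      admits-cong : ∀ {t t′ h h′ u u′ d d′ r r′} a → t ≡ t′ → h ≡ h′ → u ≡ u′ → d ≡ d′ → r ≡ r′ →
                    admits t h u d r a ≡ admits t′ h′ u′ d′ r′ a
      admits-cong a ≡.refl ≡.refl ≡.refl ≡.refl ≡.refl = ≡.refl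

      admits-sound : ∀ {u d r a} → admits tail head u d r a ≡ true → Admissible d r u a
      admits-sound {u} {d} {r} {a} e =
        let e₁ , e = ∧-true {does (tail a ≤? u)} e
            e₂ , e = ∧-true {does (u ≤? tail a)} e
            e₃ , e = ∧-true {not (does (r a ≤?ʳ 0#))} e
            e₄ , e = ∧-true {does (d u ≤? d (head a) + 1)} e
            e₅ , _ = ∧-true {does (d (head a) + 1 ≤? d u)} e
        in ≤-antisym (from-does (tail a ≤? u) e₁) (from-does (u ≤? tail a) e₂)
         , from-does-false (r a ≤?ʳ 0#) (not-true e₃)
         , ≡.trans (≤-antisym (from-does (d u ≤? d (head a) + 1) e₄) (from-does (d (head a) + 1 ≤? d u) e₅)) (+-comm (d (head a)) 1)

      admits-complete : ∀ {u d r a} → Admissible d r u a → admits tail head u d r a ≡ true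
      admits-complete {u} {d} {r} {a} (e , r≰0 , e′) =
        cong₂ _∧_ (dec-true (tail a ≤? u) (≤-reflexive e)) (cong₂ _∧_ (dec-true (u ≤? tail a) (≤-reflexive (≡.sym e)))
        (cong₂ _∧_ (cong not (dec-false (r a ≤?ʳ 0#) r≰0)) (cong₂ _∧_ (dec-true (d u ≤? d (head a) + 1) (≤-reflexive e″))
        (cong (_∧ true) (dec-true (d (head a) + 1 ≤? d u) (≤-reflexive (≡.sym e″)))))))
        where
        e″ : d u ≡ d (head a) + 1
        e″ = ≡.trans e′ (+-comm 1 (d (head a)))

      -- In the first case the state is kept, so what was settled earlier in the pass stays settled;
      -- in the second the change is paid for by potential.
      Outcome : Store → Assertion
      Outcome σ τ = (state τ ≡ state σ × nats τ CHANGED 0 ≡ nats σ CHANGED 0 × IsSettled (state σ) (nats σ CUR 0))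
                  ⊎ (IsPreflow (state τ) × potential (state τ) < potential (state σ) × nats τ CHANGED 0 ≡ 1)

      advance : Program
      advance = ifThenElse (natLE (! ARCS) (! FOUND))
        (setNat LABEL (! CUR) (LABEL [ ! CUR ] ⊕ lit 1) ⨾ setNat CHANGED (lit 0) (lit 1))
        (when (neg (realLE (EXCESS [ ! CUR ]) 0ʳ) ∷ []) push)

      push-spec : ∀ σ → Env σ → IsPreflow (state σ) → let u = nats σ CUR 0 ; a = nats σ FOUND 0 in
                  a < M → Admissible (nats σ LABEL) (reals σ RESIDUE) u a → ¬ (reals σ EXCESS u ≤ʳ 0#) →
                  WP push σ (Outcome σ)
      push-spec σ env p a<M (tail≡u , r≰0 , down) x≰0 =
        (λ e → inj₂ (pushed (x≥0 u u<n) (from-does (x u ≤?ʳ r a) e) ≤ʳ-refl (inj₁ ≡.refl))) ,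
        (λ e → inj₂ (pushed (r≥0 a a<M) ≤ʳ-refl (≰⇒≥ʳ (from-does-false (x u ≤?ʳ r a) e)) (inj₂ ≡.refl)))
        where
        open Preflow p
        u = nats σ CUR 0
        a = nats σ FOUND 0
        d = nats σ LABEL
        r = reals σ RESIDUE
        x = reals σ EXCESS
        u<n : u < n
        u<n = subst (_< n) tail≡u (tail<n a<M)
        Pushed : Carrier → ℕ → (ℕ → ℕ) → (ℕ → ℕ) → Set
        Pushed δ u rv h = let s = d , add (add r a (-ʳ δ)) (rv a) δ , add (add x u (-ʳ δ)) (h a) δ in
          IsPreflow s × potential s < potential (state σ) × 1 ≡ 1
        pushed : ∀ {δ} → 0# ≤ʳ δ → δ ≤ʳ r a → δ ≤ʳ x u → δ ≡ x u ⊎ δ ≡ r a → Pushed δ u (nats σ REV) (nats σ HEAD)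
        pushed {δ} 0≤δ δ≤r δ≤x δ≡ = subst₂ (Pushed δ u) (≡.sym (Env.rev≡ env)) (≡.sym (Env.head≡ env))
          (subst (λ w → Pushed δ w rev head) tail≡u (Step.preflow , Step.decrease (subst (λ w → δ ≡ x w ⊎ δ ≡ r a) (≡.sym tail≡u) δ≡) , ≡.refl))
          where
          module Step = Push p a<M r≰0 (≡.trans (cong d tail≡u) down) (λ le → x≰0 (subst (λ w → x w ≤ʳ 0#) tail≡u le)) 0≤δ δ≤r
                          (subst (λ w → δ ≤ʳ x w) (≡.sym tail≡u) δ≤x)

      advance-spec : ∀ σ → Env σ → IsPreflow (state σ) → let u = nats σ CUR 0 in
                     u < n → nats σ LABEL u < n → ¬ (1 ≤ sink u) →
                     Found (admits tail head u (nats σ LABEL) (reals σ RESIDUE)) M (nats σ FOUND 0) →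
                     WP advance σ (Outcome σ)
      advance-spec σ env p u<n du<n nonsink found =
        (λ e → inj₂ (relabelled (subst (_≤ nats σ FOUND 0) (Env.M≡ env) (from-does (nats σ ARCS 0 ≤? nats σ FOUND 0) e)) found)) ,
        (λ e → pushing (λ le → from-does-false (nats σ ARCS 0 ≤? nats σ FOUND 0) e (subst (_≤ nats σ FOUND 0) (≡.sym (Env.M≡ env)) le)) found)
        where
        u = nats σ CUR 0
        adm = admits tail head u (nats σ LABEL) (reals σ RESIDUE)
        relabelled : M ≤ nats σ FOUND 0 → Found adm M (nats σ FOUND 0) →
                     let s = upd (nats σ LABEL) u (nats σ LABEL u + 1) , reals σ RESIDUE , reals σ EXCESS in
                     IsPreflow s × potential s < potential (state σ) × 1 ≡ 1
        relabelled M≤k (inj₂ (k<M , _))  = contradiction M≤k (<⇒≱ k<M)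
        relabelled M≤k (inj₁ (_ , none)) = Step.preflow , Step.decrease , ≡.refl
          where
          module Step = Relabel p u<n du<n nonsink
            (λ a a<M ad → contradiction (≡.trans (≡.sym (none a a<M)) (admits-complete {u} {nats σ LABEL} {reals σ RESIDUE} ad)) λ ())
        pushing : ¬ (M ≤ nats σ FOUND 0) → Found adm M (nats σ FOUND 0) →
                  WP (when (neg (realLE (EXCESS [ ! CUR ]) 0ʳ) ∷ []) push) σ (Outcome σ)
        pushing M≰k (inj₁ (k≡M , _)) = contradiction (≤-reflexive (≡.sym k≡M)) M≰k
        pushing M≰k (inj₂ (k<M , e)) =
          (λ e′ → push-spec σ env p k<M (admits-sound {u} {nats σ LABEL} {reals σ RESIDUE} e) (from-does-false (reals σ EXCESS u ≤?ʳ 0#) (not-true e′))) ,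
          (λ e′ → inj₁ (≡.refl , ≡.refl , inj₂ (from-does (reals σ EXCESS u ≤?ʳ 0#) (not-false e′) , nats σ FOUND 0 , k<M , admits-sound {u} {nats σ LABEL} {reals σ RESIDUE} e)))

      idle : ∀ a s k → does (a + 1 ≤? k) ∧ (not (does (1 ≤? s)) ∧ true) ≡ false → k ≤ a ⊎ 1 ≤ s
      idle a s k e = go (a + 1 ≤? k) (1 ≤? s) e
        where
        go : (p : Dec (a + 1 ≤ k)) (q : Dec (1 ≤ s)) → does p ∧ (not (does q) ∧ true) ≡ false → k ≤ a ⊎ 1 ≤ s
        go _       (yes s≥1) _ = inj₂ s≥1
        go (no ¬p) (no _)    _ = inj₁ (≮⇒≥ (λ lt → ¬p (subst (_≤ k) (+-comm 1 a) lt)))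

      busy : ∀ a s k → does (a + 1 ≤? k) ∧ (not (does (1 ≤? s)) ∧ true) ≡ true → a < k × ¬ (1 ≤ s)
      busy a s k e =
        let e₁ , e = ∧-true {does (a + 1 ≤? k)} e
            e₂ , _ = ∧-true {not (does (1 ≤? s))} e
        in subst (_≤ k) (+-comm a 1) (from-does (a + 1 ≤? k) e₁) , from-does-false (1 ≤? s) (not-true e₂)

      searchArc : Program
      searchArc = search ARC FOUND (! ARCS) admissible

      searchArc-spec : ∀ σ → Env σ → WP searchArc σ
        (λ τ → Found (admits tail head (nats σ CUR 0) (nats σ LABEL) (reals σ RESIDUE)) M (nats τ FOUND 0))
      searchArc-spec σ env = search-rule ARC FOUND (! ARCS) admissible
        (admits tail head (nats σ CUR 0) (nats σ LABEL) (reals σ RESIDUE)) M M≤B ≡.refl ≡.refl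
        (λ τ w → Env.M≡ (env-after searchArc ≡.refl ≡.refl w env))
        (λ τ w → let env′ = env-after searchArc ≡.refl ≡.refl w env in
          admits-cong (nats τ ARC 0) (Env.tail≡ env′) (Env.head≡ env′) (cong-app (nats-≡ w CUR ≡.refl) 0)
            (nats-≡ w LABEL ≡.refl) (reals-≡ w RESIDUE ≡.refl))
        (λ τ w found → found)

      search-advance-spec : ∀ σ → Env σ → IsPreflow (state σ) → let u = nats σ CUR 0 in
                            u < n → nats σ LABEL u < n → ¬ (1 ≤ sink u) → WP (searchArc ⨾ advance) σ (Outcome σ)
      search-advance-spec σ env p u<n lt nonsink = after searchArc {σ} {λ τ → Found (admits tail head u (nats σ LABEL) (reals σ RESIDUE)) M (nats τ FOUND 0)} {λ τ → WP advance τ (Outcome σ)} (searchArc-spec σ env) continue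
        where
        u = nats σ CUR 0
        transport : ∀ {τ υ} → state τ ≡ state σ → nats τ CUR 0 ≡ u → nats τ CHANGED 0 ≡ nats σ CHANGED 0 → Outcome τ υ → Outcome σ υ
        transport s≡ u≡ c≡ (inj₁ (s≡′ , c≡′ , st)) = inj₁ (≡.trans s≡′ s≡ , ≡.trans c≡′ c≡ , subst₂ IsSettled s≡ u≡ st)
        transport {τ} {υ} s≡ u≡ c≡ (inj₂ (p , lt , c)) = inj₂ (p , subst (λ s → potential (state υ) < potential s) s≡ lt , c)
        continue : ∀ τ → Unchanged searchArc σ τ → Found (admits tail head u (nats σ LABEL) (reals σ RESIDUE)) M (nats τ FOUND 0) →
                   WP advance τ (Outcome σ)
        continue τ w found = WP-mono advance {τ} {Outcome τ} {Outcome σ} (λ υ → transport {τ} {υ} s≡ u≡ (cong-app (nats-≡ w CHANGED ≡.refl) 0))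
          (advance-spec τ (env-after searchArc ≡.refl ≡.refl w env) (subst IsPreflow (≡.sym s≡) p)
            (subst (_< n) (≡.sym u≡) u<n)
            (subst₂ (λ (f : ℕ → ℕ) v → f v < n) (≡.sym (nats-≡ w LABEL ≡.refl)) (≡.sym u≡) lt)
            (subst (λ v → ¬ (1 ≤ sink v)) (≡.sym u≡) nonsink)
            (subst₂ (λ v s → Found (admits tail head v (proj₁ s) (proj₁ (proj₂ s))) M (nats τ FOUND 0)) (≡.sym u≡) (≡.sym s≡) found))
          where
          s≡ : state τ ≡ state σ
          s≡ = state-≡ searchArc ≡.refl ≡.refl w
          u≡ : nats τ CUR 0 ≡ u
          u≡ = cong-app (nats-≡ w CUR ≡.refl) 0

      settle-spec : ∀ σ → Env σ → nats σ SINK ≡ sink → IsPreflow (state σ) → nats σ CUR 0 < n → WP settle σ (Outcome σ)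
      settle-spec σ env sink≡ p u<n = when-rule (natLE (LABEL [ ! CUR ] ⊕ lit 1) #V ∷ neg (natLE (lit 1) (SINK [ ! CUR ])) ∷ [])
        {searchArc ⨾ advance} {σ} {Outcome σ} go stay
        where
        u = nats σ CUR 0
        guard : Bool
        guard = does (nats σ LABEL u + 1 ≤? nats σ SIZE 0) ∧ (not (does (1 ≤? nats σ SINK u)) ∧ true)
        go : guard ≡ true → WP (searchArc ⨾ advance) σ (Outcome σ)
        go e = search-advance-spec σ env p u<n
          (subst (nats σ LABEL u <_) (Env.n≡ env) (proj₁ (busy (nats σ LABEL u) (nats σ SINK u) (nats σ SIZE 0) e)))
          (subst (λ f → ¬ (1 ≤ f u)) sink≡ (proj₂ (busy (nats σ LABEL u) (nats σ SINK u) (nats σ SIZE 0) e)))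
        stay : guard ≡ false → Outcome σ σ
        stay e = inj₁ (≡.refl , ≡.refl , inj₁ (subst₂ (λ k f → k ≤ nats σ LABEL u ⊎ 1 ≤ f u) (Env.n≡ env) sink≡
          (idle (nats σ LABEL u) (nats σ SINK u) (nats σ SIZE 0) e)))

      Done : Assertion
      Done τ = IsPreflow (state τ) × (∀ u → u < n → IsSettled (state τ) u)

      -- While `CHANGED` is 1 the potential stays below the remaining budget, and each pass that
      -- changes something lowers it. Since the potential starts at `bound` or less, `suc bound`
      -- passes suffice, the last quiet one included.
      settleAll-spec : ∀ σ → Env σ → nats σ SINK ≡ sink → IsPreflow (state σ) →
                       WP settleAll σ Done
      settleAll-spec σ env sink≡ p = while-rule {b = natLE (lit 1) (! CHANGED)} {setNat CHANGED (lit 0) (lit 0) ⨾ for CUR #V settle} {setN CHANGED 0 1 σ} {Done} I (suc bound)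
        (λ { s τ (_ , _ , p , inj₁ (_ , all)) stop → p , all
           ; s τ (_ , _ , _ , inj₂ (c , _)) stop → contradiction (≡.trans (≡.sym stop) (dec-true (1 ≤? nats τ CHANGED 0) (≤-reflexive (≡.sym c)))) λ () })
        (λ { τ (_ , _ , _ , inj₁ (c , _)) → dec-false (1 ≤? nats τ CHANGED 0) (λ le → contradiction (subst (1 ≤_) c le) λ ())
           ; τ (_ , _ , _ , inj₂ (_ , ())) })
        (λ { s τ (env , sink≡ , p , inj₁ (c , _)) go → contradiction (subst (1 ≤_) c (from-does (1 ≤? nats τ CHANGED 0) go)) λ ()
           ; s τ (env , sink≡ , p , inj₂ (c , lt)) go → round s τ env sink≡ p lt })
        rounds≤B
        (env-after (setNat CHANGED (lit 0) (lit 1)) ≡.refl ≡.refl (setNat-unchanged CHANGED (lit 0) (lit 1)) env , sink≡ , p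
          , inj₂ (≡.refl , s≤s (Ψ-bound _ _ _ (Preflow.d≤n p))))
        where
        bound = n * n + (suc n * M + (2 + suc n * M) * (n * n))
        I : ℕ → Assertion
        I s τ = Env τ × nats τ SINK ≡ sink × IsPreflow (state τ) ×
          ((nats τ CHANGED 0 ≡ 0 × (∀ u → u < n → IsSettled (state τ) u)) ⊎ (nats τ CHANGED 0 ≡ 1 × potential (state τ) < s))
        Round : Store → ℕ → Assertion
        Round τ j υ = IsPreflow (state υ) ×
          ((nats υ CHANGED 0 ≡ 0 × potential (state υ) ≡ potential (state τ) × (∀ u → u < j → IsSettled (state υ) u))
          ⊎ (nats υ CHANGED 0 ≡ 1 × potential (state υ) < potential (state τ)))
        round : ∀ s τ → Env τ → nats τ SINK ≡ sink → IsPreflow (state τ) → potential (state τ) < suc s →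
                WP (setNat CHANGED (lit 0) (lit 0) ⨾ for CUR #V settle) τ (I s)
        round s τ env sink≡ p lt = for-rule CUR #V settle {setN CHANGED 0 0 τ} {I s} (Round τ) n n≤B ≡.refl
          (λ υ w → Env.n≡ (env-after (for CUR #V settle) ≡.refl ≡.refl w env₀))
          (p , inj₁ (≡.refl , ≡.refl , λ _ ()))
          (λ υ w u<n (p′ , inv) → WP-mono settle {υ} {Outcome υ} {λ χ → Round τ (suc (nats υ CUR 0)) (setN CUR 0 (nats χ CUR 0 + 1) χ)} (λ χ → next υ χ p′ inv)
            (settle-spec υ (env-after (for CUR #V settle) ≡.refl ≡.refl w env₀) (≡.trans (nats-≡ w SINK ≡.refl) sink≡) p′ u<n))
          (λ υ w (p′ , inv) → env-after (for CUR #V settle) ≡.refl ≡.refl w env₀ , ≡.trans (nats-≡ w SINK ≡.refl) sink≡ , p′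
            , (case inv of λ { (inj₁ (c , _ , all)) → inj₁ (c , all) ; (inj₂ (c , lt′)) → inj₂ (c , <-≤-trans lt′ (≤-pred lt)) }))
          where
          env₀ = env-after (setNat CHANGED (lit 0) (lit 0)) ≡.refl ≡.refl (setNat-unchanged CHANGED (lit 0) (lit 0)) env
          next : ∀ υ χ → IsPreflow (state υ) →
                 (nats υ CHANGED 0 ≡ 0 × potential (state υ) ≡ potential (state τ) × (∀ u → u < nats υ CUR 0 → IsSettled (state υ) u))
                 ⊎ (nats υ CHANGED 0 ≡ 1 × potential (state υ) < potential (state τ)) →
                 Outcome υ χ → Round τ (suc (nats υ CUR 0)) χ
          next υ χ p′ (inj₁ (c , e , all)) (inj₁ (s≡ , c≡ , st)) = subst IsPreflow (≡.sym s≡) p′ ,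
            inj₁ (≡.trans c≡ c , ≡.trans (cong potential s≡) e , subst (λ s → ∀ u → u < suc (nats υ CUR 0) → IsSettled s u) (≡.sym s≡) (below-suc all st))
          next υ χ p′ (inj₂ (c , lt)) (inj₁ (s≡ , c≡ , st)) = subst IsPreflow (≡.sym s≡) p′ ,
            inj₂ (≡.trans c≡ c , subst (λ s → potential s < potential (state τ)) (≡.sym s≡) lt)
          next υ χ p′ (inj₁ (c , e , all)) (inj₂ (p″ , lt , c′)) = p″ , inj₂ (c′ , <-≤-trans lt (≤-reflexive e))
          next υ χ p′ (inj₂ (c , lt)) (inj₂ (p″ , lt′ , c′)) = p″ , inj₂ (c′ , <-trans lt′ lt)

    next : ℕ → Bool → ℕ
    next c b = if b then c + c + 1 else c + c

    record-spec : ∀ σ → Env σ → WP record-side σ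
      (λ τ → ∀ v → v < n → nats τ CLS v ≡ next (nats σ CLS v) (does (nats σ LABEL v + 1 ≤? n)))
    record-spec σ env = for-rule VTX #V recordVertex {σ}
      {λ τ → ∀ v → v < n → nats τ CLS v ≡ next (nats σ CLS v) (side v)} I n n≤B ≡.refl
      (λ τ w → Env.n≡ (env-after record-side ≡.refl ≡.refl w env))
      ((λ _ ()) , λ _ _ → ≡.refl)
      (λ τ w _ inv → step τ inv true (test τ w) , step τ inv false (test τ w))
      (λ τ w inv → proj₁ inv)
      where
      side : ℕ → Bool
      side v = does (nats σ LABEL v + 1 ≤? n)
      -- Codes are updated in place from their old values, so the cells from `j` on have to be known
      -- to be untouched.
      I : ℕ → Assertion
      I j τ = (∀ v → v < j → nats τ CLS v ≡ next (nats σ CLS v) (side v)) × (∀ v → j ≤ v → nats τ CLS v ≡ nats σ CLS v)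
      test : ∀ τ → Unchanged record-side σ τ → does (nats τ LABEL (nats τ VTX 0) + 1 ≤? nats τ SIZE 0) ≡ side (nats τ VTX 0)
      test τ w = cong₂ (λ f k → does (f (nats τ VTX 0) + 1 ≤? k)) (nats-≡ w LABEL ≡.refl) (Env.n≡ (env-after record-side ≡.refl ≡.refl w env))
      step : ∀ τ → I (nats τ VTX 0) τ → ∀ b {t} → t ≡ side (nats τ VTX 0) → t ≡ b →
             let j = nats τ VTX 0 ; f = upd (nats τ CLS) j (next (nats τ CLS j) b) in
             (∀ v → v < suc j → f v ≡ next (nats σ CLS v) (side v)) × (∀ v → suc j ≤ v → f v ≡ nats σ CLS v)
      step τ (old , rest) b e₁ e₂ =
        below-suc (λ v v<j → ≡.trans (upd-other (nats τ CLS) _ (<⇒≢ v<j)) (old v v<j))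
          (≡.trans (upd-same (nats τ CLS) j _) (cong₂ next (rest j ≤-refl) (≡.trans (≡.sym e₂) e₁))) ,
        (λ v j<v → ≡.trans (upd-other (nats τ CLS) _ (>⇒≢ j<v)) (rest v (<⇒≤ j<v)))
        where
        j = nats τ VTX 0

    leastMinCut : ∀ {j rem sink d₀ d r x} → Decoded j l rem sink d₀ → (p : Phase.Preflow arcs d₀ sink d r x) →
                  (∀ u → u < n → Phase.Settled arcs d₀ sink d r x u) →
                  LeastMinCut (bit P j) (λ v → does (d v + 1 ≤? n))
    leastMinCut {j} {rem} {sink} {d₀} {d} {r} {x} dec p settled = record
      { trace = avoids (term 0) (term<n z≤n) source₀ , λ t t<l → side t t<l (bit P j t) ≡.refl
      ; minimum = λ A tr → ≤ʳ-resp (value≈ doubled T) (value≈ doubled A) (minimum A (avoiding A tr) (covering A tr))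
      ; least = λ A tr le → least A (avoiding A tr) (covering A tr)
          (≤ʳ-resp (≈-sym (value≈ doubled A)) (≈-sym (value≈ doubled T)) le) }
      where
      open Decoded dec
      open Phase arcs d₀ sink
      open Final p settled
      side : ∀ t → t < l → ∀ b → bit P j t ≡ b → T (term (suc t)) ≡ b
      side t t<l true  e = covers (term (suc t)) (term<n t<l) (sinks t t<l e)
      side t t<l false e = avoids (term (suc t)) (term<n t<l) (sources t t<l e)
      avoiding : ∀ A → Trace (bit P j) A → Avoids A
      avoiding A (t₀ , ts) v v<n e with d-from v v<n
      -- The label would be both 0 and n, but `v < n` excludes n = 0.
      ... | inj₁ e′ = contradiction (≤-trans v<n (≤-reflexive (≡.trans (≡.sym e) e′))) λ ()
      ... | inj₂ (_ , inj₁ ≡.refl) = t₀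
      ... | inj₂ (_ , inj₂ (i , i<l , ≡.refl , e′)) = ≡.trans (ts i i<l) e′
      covering : ∀ A → Trace (bit P j) A → Covers A
      covering A (_ , ts) v v<n s with sink-from v v<n s
      ... | i , i<l , ≡.refl , e = ≡.trans (ts i i<l) e

    IsCut : Store → Assertion
    IsCut σ τ = Σ[ T ∈ (ℕ → Bool) ] LeastMinCut (bit P (nats σ CUT 0)) T × (∀ v → v < n → nats τ CLS v ≡ next (nats σ CLS v) (T v))

    cut-spec : ∀ σ j → Env σ → ∀ {rem} → Decoded j l rem (nats σ SINK) (nats σ LABEL) → (∀ v → v < n → reals σ EXCESS v ≡ 0#) →
               WP (saturate ⨾ settleAll ⨾ record-side) σ
                 (λ τ → Σ[ T ∈ (ℕ → Bool) ] LeastMinCut (bit P j) T × (∀ v → v < n → nats τ CLS v ≡ next (nats σ CLS v) (T v)))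
    cut-spec σ j env {rem} dec ex =
      after saturate {σ} {λ τ → Saturated M (reals τ RESIDUE) (reals τ EXCESS)} {λ τ → WP (settleAll ⨾ record-side) τ Goal}
        (Cut.saturate-spec d₀ sink σ env ≡.refl d₀≤n ex) λ τ w s →
      let env₁ = env-after saturate ≡.refl ≡.refl w env
          d≡ = nats-≡ w LABEL ≡.refl
          p = subst (λ d → Preflow d (reals τ RESIDUE) (reals τ EXCESS)) (≡.sym d≡) (saturated⇒preflow two sink-zero s) in
      after settleAll {τ} {Cut.Done d₀ sink} {λ υ → WP record-side υ Goal} (Cut.settleAll-spec d₀ sink τ env₁ (nats-≡ w SINK ≡.refl) p) λ υ w′ (p′ , st) →
      WP-mono record-side {υ} {λ χ → ∀ v → v < n → nats χ CLS v ≡ next (nats υ CLS v) (does (nats υ LABEL v + 1 ≤? n))} {Goal}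
        (λ χ e → (λ v → does (nats υ LABEL v + 1 ≤? n)) , leastMinCut dec p′ st ,
                 subst (λ f → ∀ v → v < n → nats χ CLS v ≡ next (f v) (does (nats υ LABEL v + 1 ≤? n)))
                   (≡.trans (nats-≡ w′ CLS ≡.refl) (nats-≡ w CLS ≡.refl)) e)
        (record-spec υ (env-after settleAll ≡.refl ≡.refl w′ env₁))
      where
      d₀ = nats σ LABEL
      sink = nats σ SINK
      open Phase arcs d₀ sink
      open Decoded dec
      Goal : Assertion
      Goal τ = Σ[ T ∈ (ℕ → Bool) ] LeastMinCut (bit P j) T × (∀ v → v < n → nats τ CLS v ≡ next (nats σ CLS v) (T v))
      two : ∀ v → v < n → d₀ v ≡ 0 ⊎ d₀ v ≡ n
      two v v<n = case d-from v v<n of λ { (inj₁ e) → inj₁ e ; (inj₂ (e , _)) → inj₂ e }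
      d₀≤n : ∀ v → v < n → d₀ v ≤ n
      d₀≤n v v<n = case two v v<n of λ { (inj₁ e) → subst (_≤ n) (≡.sym e) z≤n ; (inj₂ e) → ≤-reflexive e }
      -- Terminals are distinct vertices with one digit each, and terminal 0 is none of those that
      -- carry a digit; hence no vertex is both sink and source.
      sink-zero : ∀ v → v < n → 1 ≤ sink v → d₀ v ≡ 0
      sink-zero v v<n s with sink-from v v<n s | d-from v v<n
      ... | _ | inj₁ e = e
      ... | i , i<l , e , _ | inj₂ (_ , inj₁ e′) = contradiction (term-inj i<l z≤n (≡.trans (≡.sym e) e′)) λ ()
      ... | i , i<l , e , b | inj₂ (_ , inj₂ (i′ , i′<l , e′ , b′)) = contradiction
              (≡.trans (≡.sym b) (≡.trans (cong (bit P j) (suc-injective (term-inj i<l i′<l (≡.trans (≡.sym e) e′)))) b′)) λ ()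

    minCut-spec : ∀ σ → Env σ → WP minCut σ (IsCut σ)
    minCut-spec σ env =
      after reset {σ} {λ τ → ∀ v → v < n → nats τ SINK v ≡ 0 × nats τ LABEL v ≡ 0 × reals τ EXCESS v ≡ 0#}
        {λ τ → WP (setNat LABEL (TERM [ lit 0 ]) #V ⨾ setNat REM (lit 0) (! CUT) ⨾ decode ⨾ saturate ⨾ settleAll ⨾ record-side) τ (IsCut σ)}
        (reset-spec σ env) λ τ w z →
      let env₁ = env-after reset ≡.refl ≡.refl w env
          τ′ = setN REM 0 (nats τ CUT 0) (setN LABEL (nats τ TERM 0) (nats τ SIZE 0) τ)
          env₂ = env-after (setNat LABEL (TERM [ lit 0 ]) #V ⨾ setNat REM (lit 0) (! CUT)) ≡.refl ≡.refl
                   (proj₁ (WP-frame (setNat LABEL (TERM [ lit 0 ]) #V ⨾ setNat REM (lit 0) (! CUT)) {τ} {λ υ → υ ≡ τ′} ≡.refl)) env₁ in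
      after decode {τ′} {λ υ → ∃[ rem ] Decoded j l rem (nats υ SINK) (nats υ LABEL)} {λ υ → WP (saturate ⨾ settleAll ⨾ record-side) υ (IsCut σ)}
        (decode-spec j τ′ env₂ (start τ z (Env.n≡ env₁) (cong-app (Env.term≡ env₁) 0) (cong-app (nats-≡ w CUT ≡.refl) 0))) λ υ w′ (rem , dec) →
      WP-mono (saturate ⨾ settleAll ⨾ record-side) {υ}
        {λ χ → Σ[ T ∈ (ℕ → Bool) ] LeastMinCut (bit P j) T × (∀ v → v < n → nats χ CLS v ≡ next (nats υ CLS v) (T v))} {IsCut σ}
        (λ χ (T , lmc , e) → T , lmc , subst (λ f → ∀ v → v < n → nats χ CLS v ≡ next (f v) (T v))
           (≡.trans (nats-≡ w′ CLS ≡.refl) (nats-≡ w CLS ≡.refl)) e)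
        (cut-spec υ j (env-after decode ≡.refl ≡.refl w′ env₂) {rem} dec
          (subst (λ x → ∀ v → v < n → x v ≡ 0#) (≡.sym (reals-≡ w′ EXCESS ≡.refl)) (λ v v<n → proj₂ (proj₂ (z v v<n)))))
      where
      j = nats σ CUT 0
      start : ∀ τ → (∀ v → v < n → nats τ SINK v ≡ 0 × nats τ LABEL v ≡ 0 × reals τ EXCESS v ≡ 0#) →
              nats τ SIZE 0 ≡ n → nats τ TERM 0 ≡ term 0 → nats τ CUT 0 ≡ j →
              Decoded j 0 (nats τ CUT 0) (nats τ SINK) (upd (nats τ LABEL) (nats τ TERM 0) (nats τ SIZE 0))
      start τ z n≡ t≡ j≡ rewrite n≡ | t≡ = record
        { rem≡ = j≡
        ; sink-from = λ v v<n s → contradiction (≤-trans s (≤-reflexive (proj₁ (z v v<n)))) λ ()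
        ; d-from = from
        ; source₀ = upd-same (nats τ LABEL) (term 0) n
        ; sinks = λ _ () ; sources = λ _ () }
        where
        from : ∀ v → v < n → upd (nats τ LABEL) (term 0) n v ≡ 0 ⊎
               upd (nats τ LABEL) (term 0) n v ≡ n × (v ≡ term 0 ⊎ ∃[ i ] i < 0 × v ≡ term (suc i) × bit P j i ≡ false)
        from v v<n with v ≟ term 0
        ... | yes e@≡.refl = inj₂ (upd-same (nats τ LABEL) (term 0) n , inj₁ e)
        ... | no v≢ = inj₁ (≡.trans (upd-other (nats τ LABEL) n v≢) (proj₁ (proj₂ (z v v<n))))

    Coded : ℕ → Assertion
    Coded j τ = Σ[ T ∈ (ℕ → ℕ → Bool) ] (∀ i → i < j → LeastMinCut (bit P i) (T i)) × (∀ v → v < n → nats τ CLS v ≡ code j (λ i → T i v))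

    cuts-spec : ∀ σ → Env σ → (∀ v → v < n → nats σ CLS v ≡ 0) → WP (for CUT (! POW) minCut) σ (Coded P)
    cuts-spec σ env zeros = for-rule CUT (! POW) minCut {σ} {Coded P} Coded P power≤B ≡.refl
      (λ τ w → ≡.trans (cong-app (Env.pow≡ (env-after (for CUT (! POW) minCut) ≡.refl ≡.refl w env)) 0) power≡)
      ((λ _ _ → false) , (λ _ ()) , zeros)
      (λ τ w _ (T , lmc , e) → WP-mono minCut {τ} {IsCut τ} {λ υ → Coded (suc (nats τ CUT 0)) υ} (λ υ (T′ , lmc′ , e′) →
          upd T (nats τ CUT 0) T′ ,
          below-suc (λ i i<j → subst (LeastMinCut (bit P i)) (≡.sym (upd-other T T′ (<⇒≢ i<j))) (lmc i i<j))
                     (subst (LeastMinCut (bit P (nats τ CUT 0))) (≡.sym (upd-same T (nats τ CUT 0) T′)) lmc′) ,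
          λ v v<n → ≡.trans (e′ v v<n) (cong₂ next
            (≡.trans (e v v<n) (code-cong (nats τ CUT 0) (λ i i<j → cong-app (≡.sym (upd-other T T′ (<⇒≢ i<j))) v)))
            (cong-app (≡.sym (upd-same T (nats τ CUT 0) T′)) v)))
        (minCut-spec τ (env-after (for CUT (! POW) minCut) ≡.refl ≡.refl w env)))
      (λ τ w inv → inv)

    SameClass : (ℕ → ℕ) → ℕ → ℕ → Bool
    SameClass hcls c q = does (hcls q ≤? c) ∧ (does (c ≤? hcls q) ∧ true)

    searchClass assignClass : Program
    searchClass = search ARC FOUND (! CLASSES) (natLE (HCLS [ ! ARC ]) (CLS [ ! VTX ]) ∷ natLE (CLS [ ! VTX ]) (HCLS [ ! ARC ]) ∷ [])
    assignClass = setNat NUM (! VTX) (! FOUND)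
      ⨾ when (natLE (! CLASSES) (! FOUND) ∷ [])
          (setNat HCLS (! CLASSES) (CLS [ ! VTX ]) ⨾ setNat CLASSES (lit 0) (! CLASSES ⊕ lit 1))

    assignClass-spec : ∀ σ → let j = nats σ VTX 0 ; cls = nats σ CLS in
      Numbered j cls (nats σ NUM) (nats σ HCLS) (nats σ CLASSES 0) →
      Found (SameClass (nats σ HCLS) (cls j)) (nats σ CLASSES 0) (nats σ FOUND 0) →
      WP assignClass σ (λ τ → Numbered (suc j) cls (nats τ NUM) (nats τ HCLS) (nats τ CLASSES 0))
    assignClass-spec σ N found = (λ e → fresh found (from-does (np ≤? k) e)) , (λ e → old found (from-does-false (np ≤? k) e))
      where
      j = nats σ VTX 0
      cls = nats σ CLS
      num = nats σ NUM
      hcls = nats σ HCLS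
      np = nats σ CLASSES 0
      k = nats σ FOUND 0
      fresh : Found (SameClass hcls (cls j)) np k → np ≤ k → Numbered (suc j) cls (upd num j k) (upd hcls np (cls j)) (np + 1)
      fresh (inj₂ (k<np , _)) le = contradiction le (<⇒≱ k<np)
      fresh (inj₁ (e , none)) _ = subst (λ z → Numbered (suc j) cls (upd num j z) (upd hcls np (cls j)) (np + 1)) (≡.sym e)
        (numbered-new N (λ q q<np e′ → contradiction (≡.trans (≡.sym (none q q<np))
          (cong₂ (λ b c → b ∧ (c ∧ true)) (dec-true (hcls q ≤? cls j) (≤-reflexive e′)) (dec-true (cls j ≤? hcls q) (≤-reflexive (≡.sym e′))))) λ ()))
      old : Found (SameClass hcls (cls j)) np k → ¬ (np ≤ k) → Numbered (suc j) cls (upd num j k) hcls np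
      old (inj₁ (e , _)) nle = contradiction (≤-reflexive (≡.sym e)) nle
      old (inj₂ (k<np , e)) _ = numbered-old N k<np (≤-antisym (from-does (hcls k ≤? cls j) (proj₁ (∧-true e)))
          (from-does (cls j ≤? hcls k) (proj₁ (∧-true (proj₂ (∧-true {does (hcls k ≤? cls j)} e))))))

    number-spec : ∀ σ → Env σ → nats σ CLASSES 0 ≡ 0 →
                  WP number σ (λ τ → Numbered n (nats σ CLS) (nats τ NUM) (nats τ HCLS) (nats τ CLASSES 0))
    number-spec σ env zero-classes = for-rule VTX #V numberVertex {σ} {I n} I n n≤B ≡.refl
      (λ τ w → Env.n≡ (env-after number ≡.refl ≡.refl w env))
      (subst (Numbered 0 (nats σ CLS) (nats σ NUM) (nats σ HCLS)) (≡.sym zero-classes) numbered-0)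
      (λ τ w j<n N →
        let j = nats τ VTX 0 ; c = nats σ CLS j ; cls≡ = nats-≡ w CLS ≡.refl
            Fnd = λ (υ : Store) → Found (SameClass (nats τ HCLS) c) (nats τ CLASSES 0) (nats υ FOUND 0)
            Next = λ (υ : Store) → Numbered (suc j) (nats σ CLS) (nats υ NUM) (nats υ HCLS) (nats υ CLASSES 0) in
        after searchClass {τ} {Fnd} {λ υ → WP assignClass υ Next}
          (search-rule ARC FOUND (! CLASSES) (natLE (HCLS [ ! ARC ]) (CLS [ ! VTX ]) ∷ natLE (CLS [ ! VTX ]) (HCLS [ ! ARC ]) ∷ []) {τ} {Fnd}
            (SameClass (nats τ HCLS) c) (nats τ CLASSES 0) (≤-trans (Numbered.np≤j N) (≤-trans (<⇒≤ j<n) n≤B)) ≡.refl ≡.refl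
            (λ υ w′ → cong-app (nats-≡ w′ CLASSES ≡.refl) 0)
            (λ υ w′ → cong₂ (λ h c → SameClass h c (nats υ ARC 0)) (nats-≡ w′ HCLS ≡.refl)
               (cong₂ (λ f i → f i) (≡.trans (nats-≡ w′ CLS ≡.refl) cls≡) (cong-app (nats-≡ w′ VTX ≡.refl) 0)))
            (λ υ w′ found → found))
          (λ υ w′ found →
            let v≡ = cong-app (nats-≡ w′ VTX ≡.refl) 0
                c≡ = ≡.trans (nats-≡ w′ CLS ≡.refl) cls≡ in
            WP-mono assignClass {υ} {λ χ → Numbered (suc (nats υ VTX 0)) (nats υ CLS) (nats χ NUM) (nats χ HCLS) (nats χ CLASSES 0)} {Next}
              (λ χ → subst₂ (λ i f → Numbered (suc i) f (nats χ NUM) (nats χ HCLS) (nats χ CLASSES 0)) v≡ c≡)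
              (assignClass-spec υ
                (subst₂ (λ i f → Numbered i f (nats υ NUM) (nats υ HCLS) (nats υ CLASSES 0)) (≡.sym v≡) (≡.sym c≡)
                  (subst₂ (λ f g → Numbered j (nats σ CLS) f (proj₁ g) (proj₂ g)) (≡.sym (nats-≡ w′ NUM ≡.refl))
                    (≡.sym (cong₂ _,_ (nats-≡ w′ HCLS ≡.refl) (cong-app (nats-≡ w′ CLASSES ≡.refl) 0))) N))
                (subst₂ (λ c g → Found (SameClass (proj₁ g) c) (proj₂ g) (nats υ FOUND 0))
                  (≡.sym (cong₂ (λ f i → f i) c≡ v≡))
                  (≡.sym (cong₂ _,_ (nats-≡ w′ HCLS ≡.refl) (cong-app (nats-≡ w′ CLASSES ≡.refl) 0))) found))))
      (λ τ w N → N)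
      where
      I : ℕ → Assertion
      I j τ = Numbered j (nats σ CLS) (nats τ NUM) (nats τ HCLS) (nats τ CLASSES 0)

    SameEdge : (hs ht : ℕ → ℕ) → ℕ → ℕ → ℕ → Bool
    SameEdge hs ht p q i = does (hs i ≤? p) ∧ (does (p ≤? hs i) ∧ (does (ht i ≤? q) ∧ (does (q ≤? ht i) ∧ true)))

    sameEdge-sound : ∀ {hs ht p q i} → SameEdge hs ht p q i ≡ true → hs i ≡ p × ht i ≡ q
    sameEdge-sound {hs} {ht} {p} {q} {i} e =
      let e₁ , e = ∧-true {does (hs i ≤? p)} e
          e₂ , e = ∧-true {does (p ≤? hs i)} e
          e₃ , e = ∧-true {does (ht i ≤? q)} e
          e₄ , _ = ∧-true {does (q ≤? ht i)} e
      in ≤-antisym (from-does (hs i ≤? p) e₁) (from-does (p ≤? hs i) e₂)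
       , ≤-antisym (from-does (ht i ≤? q) e₃) (from-does (q ≤? ht i) e₄)

    sameEdge-complete : ∀ {hs ht p q i} → hs i ≡ p → ht i ≡ q → SameEdge hs ht p q i ≡ true
    sameEdge-complete {hs} {ht} {p} {q} {i} ≡.refl ≡.refl
      rewrite dec-true (hs i ≤? hs i) ≤-refl | dec-true (ht i ≤? ht i) ≤-refl = ≡.refl

    searchEdge joinEdge : Program
    searchEdge = search EDGE FOUND (! COUNT) parallel
    joinEdge = ifThenElse (natLE (! COUNT) (! FOUND))
        ( setNat SRC (! COUNT) (NUM [ TAIL [ ! ARC ] ]) ⨾ setNat TGT (! COUNT) (NUM [ HEAD [ ! ARC ] ])
        ⨾ setReal WEIGHT (! COUNT) (CAP [ ! ARC ]) ⨾ setNat COUNT (lit 0) (! COUNT ⊕ lit 1))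
        (setReal WEIGHT (! FOUND) (WEIGHT [ ! FOUND ] ⊕ CAP [ ! ARC ]))

    module Contracting (num : ℕ → ℕ) (np : ℕ) (num<np : ∀ v → v < n → num v < np) where
      open Contraction ℝ M tail head cap num np

      I : ℕ → Assertion
      I j τ = Contracted j (nats τ COUNT 0) (nats τ SRC) (nats τ TGT) (reals τ WEIGHT)

      joinEdge-spec : ∀ σ → Env σ → nats σ NUM ≡ num → let j = nats σ ARC 0 in
        j < M → num (tail j) + 1 ≤ num (head j) → I j σ →
        Found (SameEdge (nats σ SRC) (nats σ TGT) (num (tail j)) (num (head j))) (nats σ COUNT 0) (nats σ FOUND 0) →
        WP joinEdge σ (I (suc j))
      joinEdge-spec σ env num≡ j<M le C found =
        (λ e → fresh found (from-does (cnt ≤? k) e)) , (λ e → old found (from-does-false (cnt ≤? k) e))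
        where
        j = nats σ ARC 0
        cnt = nats σ COUNT 0
        k = nats σ FOUND 0
        hs = nats σ SRC
        ht = nats σ TGT
        hc = reals σ WEIGHT
        same = SameEdge hs ht (num (tail j)) (num (head j))
        tail≡ : nats σ NUM (nats σ TAIL j) ≡ num (tail j)
        tail≡ = cong₂ (λ f g → f (g j)) num≡ (Env.tail≡ env)
        head≡ : nats σ NUM (nats σ HEAD j) ≡ num (head j)
        head≡ = cong₂ (λ f g → f (g j)) num≡ (Env.head≡ env)
        cap≡ : reals σ CAP j ≡ cap j
        cap≡ = cong-app (Env.cap≡ env) j
        fresh : Found same cnt k → cnt ≤ k →
                Contracted (suc j) (cnt + 1) (upd hs cnt (nats σ NUM (nats σ TAIL j))) (upd ht cnt (nats σ NUM (nats σ HEAD j))) (upd hc cnt (reals σ CAP j))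
        fresh (inj₂ (k<cnt , _)) le′ = contradiction le′ (<⇒≱ k<cnt)
        fresh (inj₁ (_ , none)) _ = subst (λ c → Contracted (suc j) (cnt + 1) (upd hs cnt (nats σ NUM (nats σ TAIL j))) (upd ht cnt (nats σ NUM (nats σ HEAD j))) (upd hc cnt c)) (≡.sym cap≡)
          (subst₂ (λ p q → Contracted (suc j) (cnt + 1) (upd hs cnt p) (upd ht cnt q) (upd hc cnt (cap j))) (≡.sym tail≡) (≡.sym head≡)
            (contracted-new C le (cap>0 j<M) (num<np (head j) (head<n j<M))
              (λ i i<cnt e e′ → contradiction (≡.trans (≡.sym (none i i<cnt)) (sameEdge-complete {hs} {ht} e e′)) λ ())))
        old : Found same cnt k → ¬ (cnt ≤ k) → Contracted (suc j) cnt hs ht (add hc k (reals σ CAP j))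
        old (inj₁ (e , _)) nle = contradiction (≤-reflexive (≡.sym e)) nle
        old (inj₂ (k<cnt , e)) _ = subst (λ c → Contracted (suc j) cnt hs ht (add hc k c)) (≡.sym cap≡)
          (contracted-old C le (cap>0 j<M) k<cnt (proj₁ (sameEdge-sound {hs} {ht} e)) (proj₂ (sameEdge-sound {hs} {ht} e)))

      contract-spec : ∀ σ → Env σ → nats σ NUM ≡ num → nats σ COUNT 0 ≡ 0 → WP contract σ (I M)
      contract-spec σ env num≡ zero-count = for-rule ARC (! ARCS) contractArc {σ} {I M} I M M≤B ≡.refl
        (λ τ w → Env.M≡ (env-after contract ≡.refl ≡.refl w env))
        (subst (λ z → Contracted 0 z (nats σ SRC) (nats σ TGT) (reals σ WEIGHT)) (≡.sym zero-count) contracted-0)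
        (λ τ w j<M C → step τ (env-after contract ≡.refl ≡.refl w env) (≡.trans (nats-≡ w NUM ≡.refl) num≡) j<M C)
        (λ τ w C → C)
        where
        step : ∀ τ → Env τ → nats τ NUM ≡ num → nats τ ARC 0 < M → I (nats τ ARC 0) τ → WP contractArc τ (I (suc (nats τ ARC 0)))
        step τ env num≡ j<M C =
          (λ e → after searchEdge {τ} {Fnd} {λ υ → WP joinEdge υ (I (suc j))} searching (continue (subst₂ (λ p q → p + 1 ≤ q) tail≡ head≡
                   (from-does (nats τ NUM (nats τ TAIL j) + 1 ≤? nats τ NUM (nats τ HEAD j)) e)))) ,
          (λ e → contracted-skip C (λ le → from-does-false (nats τ NUM (nats τ TAIL j) + 1 ≤? nats τ NUM (nats τ HEAD j)) e
                   (subst₂ (λ p q → p + 1 ≤ q) (≡.sym tail≡) (≡.sym head≡) le)))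
          where
          j = nats τ ARC 0
          tail≡ : nats τ NUM (nats τ TAIL j) ≡ num (tail j)
          tail≡ = cong₂ (λ f g → f (g j)) num≡ (Env.tail≡ env)
          head≡ : nats τ NUM (nats τ HEAD j) ≡ num (head j)
          head≡ = cong₂ (λ f g → f (g j)) num≡ (Env.head≡ env)
          same = SameEdge (nats τ SRC) (nats τ TGT) (num (tail j)) (num (head j))
          Fnd : Assertion
          Fnd υ = Found same (nats τ COUNT 0) (nats υ FOUND 0)
          same-cong : ∀ {hs hs′ ht ht′ p p′ q q′} i → hs ≡ hs′ → ht ≡ ht′ → p ≡ p′ → q ≡ q′ → SameEdge hs ht p q i ≡ SameEdge hs′ ht′ p′ q′ i
          same-cong i ≡.refl ≡.refl ≡.refl ≡.refl = ≡.refl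
          class : ∀ υ a → nats υ NUM ≡ nats τ NUM → nats υ a ≡ nats τ a → nats υ ARC 0 ≡ j → nats υ NUM (nats υ a (nats υ ARC 0)) ≡ nats τ NUM (nats τ a j)
          class υ a e e′ e″ = cong₂ (λ f i → f i) e (cong₂ (λ f i → f i) e′ e″)
          searching : WP searchEdge τ Fnd
          searching = search-rule EDGE FOUND (! COUNT) parallel {τ} {Fnd} same (nats τ COUNT 0)
            (≤-trans (Contracted.cnt≤j C) (≤-trans (<⇒≤ j<M) M≤B)) ≡.refl ≡.refl
            (λ υ w → cong-app (nats-≡ w COUNT ≡.refl) 0)
            (λ υ w → same-cong (nats υ EDGE 0) (nats-≡ w SRC ≡.refl) (nats-≡ w TGT ≡.refl)
              (≡.trans (class υ TAIL (nats-≡ w NUM ≡.refl) (nats-≡ w TAIL ≡.refl) (cong-app (nats-≡ w ARC ≡.refl) 0)) tail≡)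
              (≡.trans (class υ HEAD (nats-≡ w NUM ≡.refl) (nats-≡ w HEAD ≡.refl) (cong-app (nats-≡ w ARC ≡.refl) 0)) head≡))
            (λ υ w found → found)
          continue : num (tail j) + 1 ≤ num (head j) → ∀ υ → Unchanged searchEdge τ υ → Fnd υ → WP joinEdge υ (I (suc j))
          continue le υ w found = WP-mono joinEdge {υ} {I (suc (nats υ ARC 0))} {I (suc j)} (λ χ → subst (λ i → I (suc i) χ) j≡)
            (joinEdge-spec υ (env-after searchEdge ≡.refl ≡.refl w env) (≡.trans (nats-≡ w NUM ≡.refl) num≡)
              (subst (_< M) (≡.sym j≡) j<M) (subst (λ i → num (tail i) + 1 ≤ num (head i)) (≡.sym j≡) le)
              (transported edges≡ C)
              (found′ edges≡ found))
            where
            j≡ : nats υ ARC 0 ≡ j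
            j≡ = cong-app (nats-≡ w ARC ≡.refl) 0
            -- The invariant depends on five parts of the store; bundled, they are replaced by a
            -- single `subst`.
            Snapshot = ℕ × ℕ × (ℕ → ℕ) × (ℕ → ℕ) × (ℕ → Carrier)
            snapshot : Store → Snapshot
            snapshot χ = nats χ ARC 0 , nats χ COUNT 0 , nats χ SRC , nats χ TGT , reals χ WEIGHT
            edges≡ : snapshot τ ≡ snapshot υ
            edges≡ = ≡.sym (cong₂ _,_ j≡ (cong₂ _,_ (cong-app (nats-≡ w COUNT ≡.refl) 0)
              (cong₂ _,_ (nats-≡ w SRC ≡.refl) (cong₂ _,_ (nats-≡ w TGT ≡.refl) (reals-≡ w WEIGHT ≡.refl)))))
            transported : snapshot τ ≡ snapshot υ → I (nats τ ARC 0) τ → I (nats υ ARC 0) υ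
            transported = subst (λ (i , c , s , t , r) → Contracted i c s t r)
            found′ : snapshot τ ≡ snapshot υ → Fnd υ → Found (SameEdge (nats υ SRC) (nats υ TGT) (num (tail (nats υ ARC 0))) (num (head (nats υ ARC 0)))) (nats υ COUNT 0) (nats υ FOUND 0)
            found′ = subst (λ (i , c , s , t , _) → Found (SameEdge s t (num (tail i)) (num (head i))) c (nats υ FOUND 0))

    record Result (τ : Store) : Set where
      field
        T            : ℕ → ℕ → Bool
        cls num hcls : ℕ → ℕ
        cuts         : ∀ i → i < P → LeastMinCut (bit P i) (T i)
        coded        : ∀ v → v < n → cls v ≡ code P (λ i → T i v)
        numbered     : Numbered n cls num hcls (nats τ SIZE 0)
        contracted   : Contraction.Contracted ℝ M tail head cap num (nats τ SIZE 0) M (nats τ SIZE 2) (nats τ SRC) (nats τ TGT) (reals τ WEIGHT)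
        size₁≡       : nats τ SIZE 1 ≡ suc l
        located      : ∀ i → i ≤ l → nats τ TERM i ≡ num (term i)

    output-spec : ∀ σ → Env σ → WP output σ (λ τ → nats τ SIZE 0 ≡ nats σ CLASSES 0 × nats τ SIZE 2 ≡ nats σ COUNT 0 × nats τ SIZE 1 ≡ suc l ×
                    (∀ i → i ≤ l → nats τ TERM i ≡ nats σ NUM (term i)))
    output-spec σ env = for-rule IDX #K step {σ} {Post} I (suc l) l<B ≡.refl
      (λ τ w → k≡ τ w)
      ((λ _ ()) , λ i _ → cong-app (Env.term≡ env) i)
      (λ τ w j<k (old , rest) → let j = nats τ IDX 0 in
        below-suc (λ i i<j → ≡.trans (upd-other (nats τ TERM) _ (<⇒≢ i<j)) (old i i<j))
          (≡.trans (upd-same (nats τ TERM) j _) (cong₂ (λ f i → f i) (nats-≡ w NUM ≡.refl) (rest j ≤-refl))) ,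
        (λ i j<i → ≡.trans (upd-other (nats τ TERM) _ (>⇒≢ j<i)) (rest i (<⇒≤ j<i))))
      (λ τ w (old , _) → cong-app (nats-≡ w CLASSES ≡.refl) 0 , cong-app (nats-≡ w COUNT ≡.refl) 0 , k≡ τ w , λ i i≤l → old i (s≤s i≤l))
      where
      step : Program
      step = setNat TERM (! IDX) (NUM [ TERM [ ! IDX ] ])
      -- Terminals are renamed in place: the cells from `j` on still have to hold vertices of the
      -- original graph.
      I : ℕ → Assertion
      I j τ = (∀ i → i < j → nats τ TERM i ≡ nats σ NUM (term i)) × (∀ i → j ≤ i → nats τ TERM i ≡ term i)
      k≡ : ∀ τ → Unchanged (for IDX #K step) σ τ → nats τ SIZE 1 ≡ suc l
      k≡ τ w = ≡.trans (cong-app (nats-≡ w SIZE ≡.refl) 1) (≡.trans (cong-app (Env.size≡ env) 1) terminals≡)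
      Post : Assertion
      Post τ = WP (setNat SIZE (lit 0) (! CLASSES) ⨾ setNat SIZE (lit 2) (! COUNT)) τ (λ υ →
        nats υ SIZE 0 ≡ nats σ CLASSES 0 × nats υ SIZE 2 ≡ nats σ COUNT 0 × nats υ SIZE 1 ≡ suc l × (∀ i → i ≤ l → nats υ TERM i ≡ nats σ NUM (term i)))

    main-spec : (∀ v → v < n → nats σ₁ CLS v ≡ 0) → nats σ₁ CLASSES 0 ≡ 0 → nats σ₁ COUNT 0 ≡ 0 →
                WP (for CUT (! POW) minCut ⨾ number ⨾ contract ⨾ output) σ₁ Result
    main-spec zero-code zero-classes zero-count =
      after cutting {σ₁} {Coded P} {λ τ → WP (number ⨾ contract ⨾ output) τ Result} (cuts-spec σ₁ env-self zero-code) λ τ w (T , lmc , coded) →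
      let env₁ = env-after cutting ≡.refl ≡.refl w env-self
          Numb = λ (υ : Store) → Numbered n (nats τ CLS) (nats υ NUM) (nats υ HCLS) (nats υ CLASSES 0) in
      after number {τ} {Numb} {λ υ → WP (contract ⨾ output) υ Result}
        (number-spec τ env₁ (≡.trans (cong-app (nats-≡ w CLASSES ≡.refl) 0) zero-classes)) λ υ w′ N →
      let env₂ = env-after number ≡.refl ≡.refl w′ env₁
          module Contr = Contracting (nats υ NUM) (nats υ CLASSES 0) (Numbered.num<np N) in
      after contract {υ} {Contr.I M} {λ χ → WP output χ Result}
        (Contr.contract-spec υ env₂ ≡.refl (≡.trans (cong-app (nats-≡ w′ COUNT ≡.refl) 0) (≡.trans (cong-app (nats-≡ w COUNT ≡.refl) 0) zero-count))) λ χ w″ C →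
      after output {χ} {λ ψ → nats ψ SIZE 0 ≡ nats χ CLASSES 0 × nats ψ SIZE 2 ≡ nats χ COUNT 0 × nats ψ SIZE 1 ≡ suc l ×
                    (∀ i → i ≤ l → nats ψ TERM i ≡ nats χ NUM (term i))} {Result}
        (output-spec χ (env-after contract ≡.refl ≡.refl w″ env₂)) λ ψ w‴ (size₀ , size₂ , size₁ , located) →
      let np≡ = ≡.trans size₀ (cong-app (nats-≡ w″ CLASSES ≡.refl) 0) in
      record
        { T = T ; cls = nats τ CLS ; num = nats υ NUM ; hcls = nats υ HCLS ; cuts = lmc ; coded = coded
        ; numbered = subst (Numbered n (nats τ CLS) (nats υ NUM) (nats υ HCLS)) (≡.sym np≡) N
        ; contracted = subst₂ (λ p (c , s , t , r) → Contraction.Contracted ℝ M tail head cap (nats υ NUM) p M c s t r) (≡.sym np≡)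
            (≡.sym (cong₂ _,_ size₂ (cong₂ _,_ (nats-≡ w‴ SRC ≡.refl) (cong₂ _,_ (nats-≡ w‴ TGT ≡.refl) (reals-≡ w‴ WEIGHT ≡.refl))))) C
        ; size₁≡ = size₁
        ; located = λ i i≤l → ≡.trans (located i i≤l) (cong-app (nats-≡ w″ NUM ≡.refl) (term i)) }
      where
      cutting : Program
      cutting = for CUT (! POW) minCut

-- The network read off the final store

module Extraction (ℝ : RealNumbers) (B : ℕ) .{{_ : NonZero B}} where
  open Reals ℝ
  open Machine ℝ
  open Networks ℝ
  open Logic ℝ B

  padded-< : ∀ {X : Set} z {k} (f : Fin k → X) i → padded z f (toℕ i) ≡ f i
  padded-< z {k} f i with toℕ i <? k
  ... | yes p = cong f (toℕ-injective (toℕ-fromℕ< p))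
  ... | no ¬p = contradiction (toℕ<n i) ¬p

  fin : ∀ {i k} → i < k → Σ[ j ∈ Fin k ] toℕ j ≡ i
  fin p = fromℕ< p , toℕ-fromℕ< p

  ext : ∀ {k} → Subset k → ℕ → Bool
  ext A = padded false (lookup A)

  ext-lookup : ∀ {k} (A : Subset k) i → ext A (toℕ i) ≡ lookup A i
  ext-lookup A = padded-< false (lookup A)

  input-holds : ∀ {k n} (G : Graph n) (K : Terminals k n) → input G K Holds G , K
  input-holds G K = record
    { vertexCount = ≡.refl ; terminalCount = ≡.refl ; edgeCount = ≡.refl
    ; sources = padded-< 0 (λ e → toℕ (source G e)) ; targets = padded-< 0 (λ e → toℕ (target G e))
    ; terminals = padded-< 0 (λ i → toℕ (Injection.to K i))
    ; capacities = λ e → ≈-reflexive (padded-< 0# (capacity G) e) }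

  cut≈ : ∀ {k} (G : Graph k) {s t : ℕ → ℕ} {c : ℕ → Carrier} → (∀ e → s (toℕ e) ≡ toℕ (source G e)) → (∀ e → t (toℕ e) ≡ toℕ (target G e)) →
         (∀ e → c (toℕ e) ≈ capacity G e) → ∀ A → cut G A ≈ S (edges G) (λ e → ind (ext A (s e) xor ext A (t e)) (c e))
  cut≈ G {s} {t} {c} es et ec A = sum≈S (edges G) (λ e → if lookup (δ G A) e then capacity G e else 0#) {λ e → ind (ext A (s e) xor ext A (t e)) (c e)} λ e → ≈-trans
    (≈-reflexive (cong (λ b → if b then capacity G e else 0#) (≡.trans (lookup∘tabulate (λ e → lookup A (source G e) xor lookup A (target G e)) e)
      (cong₂ _xor_ (side (source G e) (es e)) (side (target G e) (et e))))))
    (ind-cong (ext A (s (toℕ e)) xor ext A (t (toℕ e))) (≈-sym (ec e)))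
    where
    side : ∀ {v} i → v ≡ toℕ i → lookup A i ≡ ext A v
    side i ≡.refl = ≡.sym (ext-lookup A i)

  -- The types of `G` and `K` mention cells of the store, so that their sizes are definitionally the
  -- `n` and `suc l` of `Main`.
  module Instance (σ : Store) (G : Graph (nats σ SIZE 0)) (K : Terminals (suc (nats σ SIZE 1 ∸ 1)) (nats σ SIZE 0)) (holds : σ Holds G , K) where
    open Main ℝ B σ
    open _Holds_,_ holds
    open Cuts ℝ n m (nats σ SRC) (nats σ TGT) (reals σ WEIGHT)
    open Traces l term

    edge : ∀ {e} → e < m → Σ[ e′ ∈ Fin (edges G) ] toℕ e′ ≡ e
    edge e<m = fin (subst (_ <_) edgeCount e<m)

    is-edges : Edges
    is-edges = record
      { src<tgt = λ e<m → case edge e<m of λ { (e , ≡.refl) → subst₂ _<_ (≡.sym (sources e)) (≡.sym (targets e)) (ordered G e) }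
      ; tgt<n = λ e<m → case edge e<m of λ { (e , ≡.refl) → subst (_< n) (≡.sym (targets e)) (toℕ<n (target G e)) }
      ; c>0 = λ e<m → case edge e<m of λ { (e , ≡.refl) →
          ≤ʳ-resp ≈-refl (≈-sym (capacities e)) (proj₁ (positive G e)) ,
          λ 0≈ → proj₂ (positive G e) (≈-trans 0≈ (capacities e)) } }

    -- Edges of a simple graph inject into pairs of vertices. This makes bounds in terms of the
    -- number of arcs polynomial in n.
    m≤n*n : m ≤ n * n
    m≤n*n = subst (_≤ n * n) (≡.sym edgeCount) (injective⇒≤ {f = λ e → combine (source G e) (target G e)}
      (λ {e} {e′} eq → let es , et = combine-injective (source G e) (target G e) (source G e′) (target G e′) eq in simple G (cong₂ _,_ es et)))

    terminal<n : ∀ {t} → t ≤ l → term t < n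
    terminal<n t≤l with fin (s≤s t≤l)
    ... | i , ≡.refl = subst (_< n) (≡.sym (terminals i)) (toℕ<n _)

    terminal-injective : ∀ {s t} → s ≤ l → t ≤ l → term s ≡ term t → s ≡ t
    terminal-injective s≤l t≤l e with fin (s≤s s≤l) | fin (s≤s t≤l)
    ... | i , ≡.refl | j , ≡.refl = cong toℕ (Injection.injective K
      (toℕ-injective (≡.trans (≡.sym (terminals i)) (≡.trans e (terminals j)))))

    cut-G : ∀ A → cut G A ≈ capacity-of (ext A)
    cut-G A = ≈-trans (cut≈ G {nats σ SRC} {nats σ TGT} {reals σ WEIGHT} sources targets capacities A) (≈-reflexive (cong (λ z → S z (λ e → ind (ext A (nats σ SRC e) xor ext A (nats σ TGT e)) (reals σ WEIGHT e))) (≡.sym edgeCount)))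

    Outputs : Assertion
    Outputs τ = ∃[ n′ ] Σ[ H ∈ Graph n′ ] Σ[ K′ ∈ Terminals (suc l) n′ ]
      MimickingNetwork G K H K′ × n′ ≤ dedekind l × (τ Holds H , K′)

    module Extract (assumptions : Assumptions) (τ : Store) (result : Result assumptions τ) where
      open Result result
      open Numbered numbered
      open Contraction ℝ M tail head cap num (nats τ SIZE 0)
      open Contracted contracted using (hs<ht; ht<np; hc>0) renaming (simple to distinct-ends)
      open Assumptions assumptions using (doubled)

      np cnt P′ : ℕ
      np  = nats τ SIZE 0
      cnt = nats τ SIZE 2
      P′  = pow2 l

      hs ht : ℕ → ℕ
      hs = nats τ SRC
      ht = nats τ TGT

      index : (ℕ → Bool) → ℕ
      index u = proj₁ (encode l u)

      index<P : ∀ u → index u < P′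
      index<P u = proj₁ (proj₂ (encode l u))

      bits : ∀ u t → t < l → bit P′ (index u) t ≡ u t
      bits u = proj₂ (proj₂ (encode l u))

      minCutFor : ∀ u → LeastMinCut (bit P′ (index u)) (T (index u))
      minCutFor u = cuts (index u) (index<P u)

      -- Equal numbers mean equal codes and hence equal digits: every `T j` is a union of classes.
      same-class : ∀ {v w} → v < n → w < n → num v ≡ num w → ∀ j → j < P′ → T j v ≡ T j w
      same-class {v} {w} v<n w<n e = code-injective P′ (≡.trans (≡.sym (coded v v<n)) (≡.trans (≡.sym (hcls-num v v<n))
        (≡.trans (cong hcls e) (≡.trans (hcls-num w w<n) (coded w w<n)))))

      class-complete : ∀ {v w} → v < n → w < n → (∀ j → j < P′ → T j v ≡ T j w) → num v ≡ num w
      class-complete {v} {w} v<n w<n e = distinct (num<np v v<n) (num<np w w<n) (≡.trans (hcls-num v v<n) (≡.trans (coded v v<n)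
        (≡.trans (code-cong P′ e) (≡.sym (≡.trans (hcls-num w w<n) (coded w w<n))))))

      H : Graph np
      H = record
        { edges = cnt
        ; source = λ e → fromℕ< (hs<np e)
        ; target = λ e → fromℕ< (ht<np (toℕ e) (toℕ<n e))
        ; ordered = λ e → subst₂ _<_ (≡.sym (toℕ-fromℕ< _)) (≡.sym (toℕ-fromℕ< _)) (hs<ht (toℕ e) (toℕ<n e))
        ; simple = λ {e} {e′} eq → toℕ-injective (distinct-ends (toℕ<n e) (toℕ<n e′)
            (unfin {p = hs<np e} {hs<np e′} (cong proj₁ eq)) (unfin {p = ht<np (toℕ e) (toℕ<n e)} {ht<np (toℕ e′) (toℕ<n e′)} (cong proj₂ eq)))
        ; capacity = λ e → reals τ WEIGHT (toℕ e)
        ; positive = λ e → hc>0 (toℕ e) (toℕ<n e) }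
        where
        hs<np : ∀ (e : Fin cnt) → hs (toℕ e) < np
        hs<np e = <-trans (hs<ht (toℕ e) (toℕ<n e)) (ht<np (toℕ e) (toℕ<n e))
        unfin : ∀ {i j} {p : i < np} {q : j < np} → fromℕ< p ≡ fromℕ< q → i ≡ j
        unfin {p = p} {q} e = ≡.trans (≡.sym (toℕ-fromℕ< p)) (≡.trans (cong toℕ e) (toℕ-fromℕ< q))

      -- The cut for the trace consisting of `t` alone contains `term (suc t)` and no other
      -- terminal, and the cut for the full trace leaves out just terminal 0. Hence no two terminals
      -- are identified.
      term-separated : ∀ s t → s ≤ l → t ≤ l → (∀ j → j < P′ → T j (term s) ≡ T j (term t)) → s ≡ t
      term-separated zero    zero    _   _   e = ≡.refl
      term-separated zero    (suc t) _   t<l e = contradiction (≡.trans (≡.sym (proj₁ (LeastMinCut.trace (minCutFor (λ _ → true)))))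
        (≡.trans (e _ (index<P (λ _ → true))) (≡.trans (proj₂ (LeastMinCut.trace (minCutFor (λ _ → true))) t t<l) (bits (λ _ → true) t t<l)))) λ ()
      term-separated (suc s) zero    s<l _   e = ≡.sym (term-separated zero (suc s) z≤n s<l (λ j j<P → ≡.sym (e j j<P)))
      term-separated (suc s) (suc t) s<l t<l e = cong suc (from-does (s ≟ t)
        (≡.trans (≡.sym (value s s<l)) (≡.trans (e _ (index<P u)) (≡.trans (value t t<l) (dec-true (t ≟ t) ≡.refl)))))
        where
        u : ℕ → Bool
        u i = does (i ≟ t)
        value : ∀ i → i < l → T (index u) (term (suc i)) ≡ does (i ≟ t)
        value i i<l = ≡.trans (proj₂ (LeastMinCut.trace (minCutFor u)) i i<l) (bits u i i<l)

      place : (i : Fin (suc l)) → num (term (toℕ i)) < np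
      place i = num<np _ (terminal<n (≤-pred (toℕ<n i)))

      K′ : Terminals (suc l) np
      K′ = record { to = λ i → fromℕ< (place i) ; cong = λ { ≡.refl → ≡.refl } ; injective = λ {i} {j} e → toℕ-injective
        (term-separated (toℕ i) (toℕ j) (≤-pred (toℕ<n i)) (≤-pred (toℕ<n j))
          (same-class (terminal<n (≤-pred (toℕ<n i))) (terminal<n (≤-pred (toℕ<n j)))
            (≡.trans (≡.sym (toℕ-fromℕ< (place i))) (≡.trans (cong toℕ e) (toℕ-fromℕ< (place j)))))) }

      output-holds : τ Holds H , K′
      output-holds = record
        { vertexCount = ≡.refl ; terminalCount = size₁≡ ; edgeCount = ≡.refl
        ; sources = λ e → ≡.sym (toℕ-fromℕ< _) ; targets = λ e → ≡.sym (toℕ-fromℕ< _)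
        ; terminals = λ i → ≡.trans (located (toℕ i) (≤-pred (toℕ<n i))) (≡.sym (toℕ-fromℕ< (place i)))
        ; capacities = λ e → ≈-refl }

      cut-H : ∀ A → cut H A ≈ capacity-of (λ v → ext A (num v))
      cut-H A = ≈-trans (cut≈ H {hs} {ht} {reals τ WEIGHT} (λ e → ≡.sym (toℕ-fromℕ< _)) (λ e → ≡.sym (toℕ-fromℕ< _)) (λ _ → ≈-refl) A)
        (contracted-capacity doubled contracted (ext A))

      rep : (p : Fin np) → ∃[ v ] v < n × num v ≡ toℕ p
      rep p = witness (toℕ p) (toℕ<n p)

      capacity-cong : ∀ {f g : ℕ → Bool} → (∀ v → v < n → f v ≡ g v) → capacity-of f ≈ capacity-of g
      capacity-cong e = S-cong m (λ i i<m → ≈-reflexive (cong₂ (λ b c → ind (b xor c) (reals σ WEIGHT i))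
        (e _ (<-trans (Edges.src<tgt is-edges i<m) (Edges.tgt<n is-edges i<m))) (e _ (Edges.tgt<n is-edges i<m))))

      -- According to `b`, the xor complements the side or keeps it, and an undirected cut has the
      -- same capacity from either side.
      capacity-flip : ∀ b f → capacity-of (λ v → b xor f v) ≈ capacity-of f
      capacity-flip b f = S-cong m (λ i _ → ≈-reflexive (cong (λ z → ind z (reals σ WEIGHT i)) (flip b (f (nats σ SRC i)) (f (nats σ TGT i)))))
        where
        flip : ∀ b x y → (b xor x) xor (b xor y) ≡ x xor y
        flip false x     y = ≡.refl
        flip true  true  y = ≡.refl
        flip true  false y = not-involutive y

      xor-cancel : ∀ b x → b xor (b xor x) ≡ x
      xor-cancel false x = ≡.refl
      xor-cancel true  x = not-involutive x

      -- Terminal cuts whose side U contains terminal 0 are read off the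
      -- complementary side.

      module For (U : Subset (suc l)) where
        b : Bool
        b = lookup U Fin.zero

        u : ℕ → Bool
        u t = b xor ext U (suc t)

        j : ℕ
        j = index u

        open LeastMinCut (minCutFor u)

        T-term : ∀ i → b xor T j (term (toℕ i)) ≡ lookup U i
        T-term Fin.zero    = ≡.trans (cong (b xor_) (proj₁ trace)) (lemma b)
          where
          lemma : ∀ x → x xor false ≡ x
          lemma true  = ≡.refl
          lemma false = ≡.refl
        T-term (Fin.suc i) = ≡.trans (cong (b xor_) (≡.trans (proj₂ trace (toℕ i) (toℕ<n i)) (bits u (toℕ i) (toℕ<n i))))
          (≡.trans (xor-cancel b _) (ext-lookup U (Fin.suc i)))

        traced : ∀ (f : ℕ → Bool) → (∀ i → f (term (toℕ i)) ≡ lookup U i) → Trace (bit P′ j) (λ v → b xor f v)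
        traced f e = ≡.trans (cong (b xor_) (e Fin.zero)) (lemma b) , λ t t<l → on (fin t<l)
          where
          lemma : ∀ x → x xor x ≡ false
          lemma true  = ≡.refl
          lemma false = ≡.refl
          on : ∀ {t} → Σ[ i ∈ Fin l ] toℕ i ≡ t → b xor f (term (suc t)) ≡ bit P′ j t
          on (i , ≡.refl) = ≡.trans (cong (b xor_) (≡.trans (e (Fin.suc i)) (≡.sym (ext-lookup U (Fin.suc i))))) (≡.sym (bits u (toℕ i) (toℕ<n i)))

        lower : ∀ (f : ℕ → Bool) → (∀ i → f (term (toℕ i)) ≡ lookup U i) → capacity-of (T j) ≤ʳ capacity-of f
        lower f e = ≤ʳ-resp ≈-refl (capacity-flip b f) (minimum (λ v → b xor f v) (traced f e))

        attains : ∀ {f : ℕ → Bool} → (∀ v → v < n → f v ≡ b xor T j v) → capacity-of f ≈ capacity-of (T j)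
        attains {f} e = ≈-trans (capacity-cong {f} {λ v → b xor T j v} e) (capacity-flip b (T j))

        trace-at : ∀ {k} (A : Subset k) (L : Terminals (suc l) k) → A ∩ L ≡ U → ∀ i → ext A (toℕ (Injection.to L i)) ≡ lookup U i
        trace-at A L e i = ≡.trans (ext-lookup A (Injection.to L i)) (≡.trans (≡.sym (lookup∘tabulate (λ i → lookup A (Injection.to L i)) i)) (cong (λ z → lookup z i) e))

        side : ∀ {k} → (Fin k → ℕ) → Subset k
        side f = tabulate (λ i → b xor T j (f i))

        side-trace : ∀ {k} (f : Fin k → ℕ) (L : Terminals (suc l) k) →
                     (∀ i → T j (f (Injection.to L i)) ≡ T j (term (toℕ i))) → side f ∩ L ≡ U
        side-trace f L e = ≡.trans (tabulate-cong (λ i → ≡.trans (lookup∘tabulate (λ i → b xor T j (f i)) (Injection.to L i))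
          (≡.trans (cong (b xor_) (e i)) (T-term i)))) (tabulate∘lookup U)

        in-G : IsTerminalCut G K U (capacity-of (T j))
        in-G = record
          { attained = side toℕ , side-trace toℕ K (λ i → cong (T j) (≡.sym (terminals i))) ,
              ≈-trans (cut-G (side toℕ)) (attains {ext {n} (side toℕ)} (λ v v<n → on (fin v<n)))
          ; minimal = λ A e → ≤ʳ-resp ≈-refl (≈-sym (cut-G A))
              (lower (ext A) (λ i → ≡.trans (cong (ext A) (terminals i)) (trace-at A K e i))) }
          where
          on : ∀ {v} → Σ[ i ∈ Fin n ] toℕ i ≡ v → ext {n} (side toℕ) v ≡ b xor T j v
          on (i , ≡.refl) = ≡.trans (ext-lookup (side toℕ) i) (lookup∘tabulate (λ i → b xor T j (toℕ i)) i)

        -- No side of H is too cheap, because it pulls back along `num` to a side of G with trace U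
        -- and equal capacity. The value is attained because `T j` is constant on classes: the side
        -- chosen at representatives pulls back to `T j` or to its complement.
        in-H : IsTerminalCut H K′ U (capacity-of (T j))
        in-H = record
          { attained = side vertex , side-trace vertex K′ (λ i →
                same-class (vertex<n _) (terminal<n (≤-pred (toℕ<n i))) (≡.trans (vertex-num _) (toℕ-fromℕ< (place i))) j (index<P u)) ,
              ≈-trans (cut-H (side vertex)) (attains {λ v → ext (side vertex) (num v)} (λ v v<n → on v v<n (fin (num<np v v<n))))
          ; minimal = λ A e → ≤ʳ-resp ≈-refl (≈-sym (cut-H A))
              (lower (λ v → ext A (num v)) (λ i → ≡.trans (cong (ext A) (≡.sym (toℕ-fromℕ< (place i)))) (trace-at A K′ e i))) }
          where
          vertex : Fin np → ℕ
          vertex p = proj₁ (rep p)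
          vertex<n : ∀ p → vertex p < n
          vertex<n p = proj₁ (proj₂ (rep p))
          vertex-num : ∀ p → num (vertex p) ≡ toℕ p
          vertex-num p = proj₂ (proj₂ (rep p))
          on : ∀ v → v < n → Σ[ p ∈ Fin np ] toℕ p ≡ num v → ext (side vertex) (num v) ≡ b xor T j v
          on v v<n (p , e) = ≡.trans (cong (ext (side vertex)) (≡.sym e)) (≡.trans (ext-lookup (side vertex) p)
            (≡.trans (lookup∘tabulate (λ p → b xor T j (vertex p)) p) (cong (b xor_) (same-class (vertex<n p) v<n (≡.trans (vertex-num p) e) j (index<P u)))))

      mimicking : MimickingNetwork G K H K′
      mimicking U = capacity-of (T (For.j U)) , For.in-H U , For.in-G U

      -- A class becomes a Boolean function of traces: whether its representative lies in the least
      -- cut for U.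
      few : np ≤ dedekind l
      few = monotone-count l np side mono distinct-sides
        where
        side : Fin np → Subset l → Bool
        side p U = T (index (ext U)) (proj₁ (rep p))
        mono : ∀ p {U V} → U ⊆ V → side p U ≡ true → side p V ≡ true
        mono p {U} {V} U⊆V = leastMinCut-mono is-edges (minCutFor (ext U)) (minCutFor (ext V))
          (λ t t<l e → ≡.trans (bits (ext V) t t<l) (on (fin t<l) (≡.trans (≡.sym (bits (ext U) t t<l)) e)))
          (proj₁ (rep p)) (proj₁ (proj₂ (rep p)))
          where
          on : ∀ {t} → Σ[ i ∈ Fin l ] toℕ i ≡ t → ext U t ≡ true → ext V t ≡ true
          on (i , ≡.refl) e = ≡.trans (ext-lookup V i) ([]=⇒lookup (U⊆V (lookup⇒[]= i U (≡.trans (≡.sym (ext-lookup U i)) e))))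
        distinct-sides : ∀ p q → (∀ U → side p U ≡ side q U) → p ≡ q
        distinct-sides p q e = toℕ-injective (≡.trans (≡.sym (proj₂ (proj₂ (rep p)))) (≡.trans
          (class-complete (proj₁ (proj₂ (rep p))) (proj₁ (proj₂ (rep q))) same) (proj₂ (proj₂ (rep q)))))
          where
          same : ∀ j → j < P′ → T j (proj₁ (rep p)) ≡ T j (proj₁ (rep q))
          same j j<P = ≡.trans (agree (proj₁ (rep p)) (proj₁ (proj₂ (rep p)))) (≡.trans (e U) (≡.sym (agree (proj₁ (rep q)) (proj₁ (proj₂ (rep q))))))
            where
            U : Subset l
            -- The digits of `j` itself as a trace. The index that `encode` finds for it may be
            -- written differently, but uniqueness of least cuts makes the two cuts agree, so
            -- functions equal on all traces belong to equal classes.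
            U = tabulate (λ i → bit P′ j (toℕ i))
            on : ∀ {t} → Σ[ i ∈ Fin l ] toℕ i ≡ t → bit P′ j t ≡ ext U t
            on (i , ≡.refl) = ≡.sym (≡.trans (ext-lookup U i) (lookup∘tabulate (λ i → bit P′ j (toℕ i)) i))
            agree : ∀ v → v < n → T j v ≡ T (index (ext U)) v
            agree = leastMinCut-unique is-edges (cuts j j<P) (minCutFor (ext U))
              (λ t t<l → ≡.trans (on (fin t<l)) (≡.sym (bits (ext U) t t<l)))

      outputs : Outputs τ
      outputs = np , H , K′ , mimicking , few , output-holds

-- Loop bounds and assembly

n<pow2 : ∀ l → l < pow2 l
n<pow2 zero    = s≤s z≤n
n<pow2 (suc l) = +-mono-≤ (≤-trans (s≤s z≤n) (n<pow2 l)) (n<pow2 l)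

afterSetup : Program
afterSetup = for CUT (! POW) minCut ⨾ number ⨾ contract ⨾ output

module Assembly (ℝ : RealNumbers) {n l : ℕ} (G : Networks.Graph ℝ n) (K : Networks.Terminals ℝ (suc l) n) where
  open Reals ℝ
  open Networks ℝ
  open Machine ℝ

  size : ℕ
  size = n + 2 ^ suc l

  -- The number of rounds of push-relabel decides the exponent. With at most 2n² arcs, M ≤ size^3,
  -- so (n + 1)M ≤ size^4, the weight of Λ is at most size^5, and with n² its term is at most
  -- size^7. Four summands of this order fit below size^9, since 2 ≤ size.
  B : ℕ
  B = size ^ 9

  pow2<size : pow2 (suc l) ≤ size
  pow2<size = subst (_≤ size) (≡.sym (pow2≡2^ (suc l))) (m≤n+m (2 ^ suc l) n)

  2+n≤size : 2 + n ≤ size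
  2+n≤size = subst (_≤ size) (+-comm n 2) (+-monoʳ-≤ n (*-monoʳ-≤ 2 (m^n>0 2 l)))

  instance
    size-nonZero : NonZero size
    size-nonZero = >-nonZero (≤-trans (s≤s z≤n) 2+n≤size)
    B-nonZero : NonZero B
    B-nonZero = m^n≢0 size 9

  2≤size : 2 ≤ size
  2≤size = ≤-trans (m≤m+n 2 n) 2+n≤size

  n≤size : n ≤ size
  n≤size = m≤m+n n (2 ^ suc l)

  power≤ : ∀ {x} i j → x ≤ size ^ i → i ≤ j → x ≤ size ^ j
  power≤ i j x≤ i≤j = ≤-trans x≤ (^-monoʳ-≤ size i≤j)

  times : ∀ {x y} i j → x ≤ size ^ i → y ≤ size ^ j → x * y ≤ size ^ (i + j)
  times i j x≤ y≤ = ≤-trans (*-mono-≤ x≤ y≤) (≤-reflexive (≡.sym (^-distribˡ-+-* size i j)))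

  ≤size⇒≤B : ∀ {x} → x ≤ size → x ≤ B
  ≤size⇒≤B x≤ = power≤ 1 9 (≤-trans x≤ (≤-reflexive (≡.sym (^-identityʳ size)))) (s≤s z≤n)

  n¹ : n ≤ size ^ 1
  n¹ = subst (n ≤_) (≡.sym (^-identityʳ size)) n≤size

  double≤ : ∀ {x} i → x ≤ size ^ i → x + x ≤ size ^ suc i
  double≤ {x} i x≤ = ≤-trans (≤-reflexive (cong (x +_) (≡.sym (+-identityʳ x)))) (*-mono-≤ 2≤size x≤)

  rounds≤ : ∀ M → M ≤ size ^ 3 → suc (n * n + (suc n * M + (2 + suc n * M) * (n * n))) ≤ B
  rounds≤ M M≤ = ≤-trans
    (+-mono-≤ {1} {size ^ 7} (m^n>0 size 7) (+-mono-≤ (power≤ 2 7 (times 1 1 n¹ n¹) (m≤m+n 2 5))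
      (+-mono-≤ (power≤ 4 7 nM (m≤m+n 4 3)) (times 5 2 2+nM (times 1 1 n¹ n¹)))))
    (≤-trans (≤-reflexive (≡.sym (+-assoc (size ^ 7) (size ^ 7) (size ^ 7 + size ^ 7)))) (double≤ 8 (double≤ 7 ≤-refl)))
    where
    nM : suc n * M ≤ size ^ 4
    nM = times 1 3 (subst (suc n ≤_) (≡.sym (^-identityʳ size)) (≤-trans (n≤1+n (suc n)) 2+n≤size)) M≤
    2+nM : 2 + suc n * M ≤ size ^ 5
    2+nM = ≤-trans (+-mono-≤ (power≤ 1 4 (subst (2 ≤_) (≡.sym (^-identityʳ size)) 2≤size) (s≤s z≤n)) nM) (double≤ 4 ≤-refl)

  open Logic ℝ B
  open Extraction ℝ B

  σ₀ : Store
  σ₀ = input G K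

  module Start = Instance σ₀ G K (input-holds G K)

  Original Arrows : Set
  Original = ℕ × ℕ × (ℕ → ℕ) × (ℕ → ℕ) × (ℕ → Carrier)
  Arrows   = ℕ × (ℕ → ℕ) × (ℕ → ℕ) × (ℕ → ℕ) × (ℕ → Carrier)

  original : Store → Original
  original σ = nats σ SIZE 0 , nats σ SIZE 2 , nats σ SRC , nats σ TGT , reals σ WEIGHT

  arrows : Store → Arrows
  arrows σ = nats σ ARCS 0 , nats σ TAIL , nats σ HEAD , nats σ REV , reals σ CAP

  IsDoubled : Original → Arrows → Set
  IsDoubled (n , m , s , t , c) (M , tail , head , rev , cap) = Cuts.Doubled ℝ n m s t c m M tail head rev cap

  -- Abstracted over `n` and `l` while `B` stays fixed, so that `afterSetup-spec` can match the
  -- equations between these numbers and the store by `refl`.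
  record Bounds (n l : ℕ) : Set where
    field
      n≤B      : n ≤ B
      l<B      : l < B
      power≤B  : pow2 l ≤ B
      arcs≤B   : ∀ {M} → M ≤ n * n + n * n → M ≤ B
      rounds≤B : ∀ {M} → M ≤ n * n + n * n → suc (n * n + (suc n * M + (2 + suc n * M) * (n * n))) ≤ B

  bounds : Bounds n l
  bounds = record
    { n≤B = ≤size⇒≤B n≤size
    ; l<B = ≤size⇒≤B (≤-trans (n<pow2 l) pow≤)
    ; power≤B = ≤size⇒≤B pow≤
    ; arcs≤B = λ M≤ → power≤ 3 9 (arcs≤ M≤) (m≤m+n 3 6)
    ; rounds≤B = λ M≤ → rounds≤ _ (arcs≤ M≤) }
    where
    pow≤ : pow2 l ≤ size
    pow≤ = ≤-trans (m≤m+n (pow2 l) (pow2 l)) pow2<size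
    arcs≤ : ∀ {M} → M ≤ n * n + n * n → M ≤ size ^ 3
    arcs≤ M≤ = ≤-trans M≤ (double≤ 2 (times 1 1 n¹ n¹))

  Goal : ∀ {n l} → Graph n → Terminals (suc l) n → Assertion
  Goal {n} {l} G K τ = ∃[ n′ ] Σ[ H ∈ Graph n′ ] Σ[ K′ ∈ Terminals (suc l) n′ ]
    MimickingNetwork G K H K′ × n′ ≤ dedekind l × (τ Holds H , K′)

  afterSetup-spec : ∀ σ {n l} → nats σ SIZE 0 ≡ n → nats σ SIZE 1 ∸ 1 ≡ l → (G : Graph n) (K : Terminals (suc l) n) → σ Holds G , K →
              IsDoubled (original σ) (arrows σ) → nats σ POW 0 ≡ pow2 l → Bounds n l →
              (∀ v → nats σ CLS v ≡ 0) → nats σ CLASSES 0 ≡ 0 → nats σ COUNT 0 ≡ 0 → WP afterSetup σ (Goal G K)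
  afterSetup-spec σ ≡.refl ≡.refl G K holds doubled power≡ bounds zero-code zero-classes zero-count =
    WP-mono afterSetup {σ} {Main.Result ℝ B σ assumptions} {Goal G K} (λ τ → Extract.outputs assumptions τ)
      (Main.main-spec ℝ B σ assumptions (λ v _ → zero-code v) zero-classes zero-count)
    where
    open Instance σ G K holds
    open Bounds bounds
    M≤ : nats σ ARCS 0 ≤ nats σ SIZE 0 * nats σ SIZE 0 + nats σ SIZE 0 * nats σ SIZE 0
    M≤ = ≤-trans (≤-reflexive (Cuts.Doubled.M≡2j doubled)) (+-mono-≤ m≤n*n m≤n*n)
    assumptions : Main.Assumptions ℝ B σ
    assumptions = record
      { edges = is-edges ; doubled = doubled ; power≡ = power≡ ; term<n = terminal<n ; term-inj = terminal-injective
      ; n≤B = n≤B ; M≤B = arcs≤B M≤ ; terminals≡ = _Holds_,_.terminalCount holds ; l<B = l<B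
      ; power≤B = power≤B ; rounds≤B = rounds≤B M≤ }

  holds-after : ∀ {σ τ} → nats τ SIZE ≡ nats σ SIZE → nats τ SRC ≡ nats σ SRC → nats τ TGT ≡ nats σ TGT →
                nats τ TERM ≡ nats σ TERM → reals τ WEIGHT ≡ reals σ WEIGHT → σ Holds G , K → τ Holds G , K
  holds-after e e₁ e₂ e₃ e₄ h = record
    { vertexCount = ≡.trans (cong-app e 0) vertexCount ; terminalCount = ≡.trans (cong-app e 1) terminalCount
    ; edgeCount = ≡.trans (cong-app e 2) edgeCount
    ; sources = λ i → ≡.trans (cong-app e₁ _) (sources i) ; targets = λ i → ≡.trans (cong-app e₂ _) (targets i)
    ; terminals = λ i → ≡.trans (cong-app e₃ _) (terminals i)
    ; capacities = λ i → ≈-trans (≈-reflexive (cong-app e₄ _)) (capacities i) }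
    where open _Holds_,_ h

  original-≡ : ∀ {σ τ} → nats τ SIZE ≡ nats σ SIZE → nats τ SRC ≡ nats σ SRC → nats τ TGT ≡ nats σ TGT →
               reals τ WEIGHT ≡ reals σ WEIGHT → original σ ≡ original τ
  original-≡ e e₁ e₂ e₃ = ≡.sym (cong₂ _,_ (cong-app e 0) (cong₂ _,_ (cong-app e 2) (cong₂ _,_ e₁ (cong₂ _,_ e₂ e₃))))

  mimic-spec : WP mimic σ₀ (Goal G K)
  mimic-spec =
    after addArcs {σ₀} {λ τ → IsDoubled (original σ₀) (arrows τ)} {λ τ → WP (power ⨾ afterSetup) τ (Goal G K)}
      (Setup.addArcs-spec ℝ B σ₀ Start.is-edges (≤-trans Start.m≤n*n (Bounds.arcs≤B bounds (m≤m+n (n * n) (n * n)))) ≡.refl) λ τ w D →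
    after power {τ} {λ υ → nats υ POW 0 ≡ pow2 l} {λ υ → WP afterSetup υ (Goal G K)}
      (Setup.power-spec ℝ B σ₀ τ (cong (λ f → f 1 ∸ 1) (nats-≡ w SIZE ≡.refl)) (<⇒≤ (Bounds.l<B bounds))) λ υ w′ pow →
    let e : ∀ a → writesNat (addArcs ⨾ power) a ≡ false → nats υ a ≡ nats σ₀ a
        e a f = ≡.trans (nats-≡ w′ a (proj₂ (∨-false {writesNat addArcs a} f))) (nats-≡ w a (proj₁ (∨-false {writesNat addArcs a} f)))
        c≡ = ≡.trans (reals-≡ w′ WEIGHT ≡.refl) (reals-≡ w WEIGHT ≡.refl)
    in afterSetup-spec υ (cong-app (e SIZE ≡.refl) 0) (cong (λ f → f 1 ∸ 1) (e SIZE ≡.refl)) G K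
      (holds-after {σ₀} {υ} (e SIZE ≡.refl) (e SRC ≡.refl) (e TGT ≡.refl) (e TERM ≡.refl) c≡ (input-holds G K))
      (subst₂ IsDoubled (original-≡ {σ₀} {υ} (e SIZE ≡.refl) (e SRC ≡.refl) (e TGT ≡.refl) c≡)
        (≡.sym (cong₂ _,_ (cong-app (nats-≡ w′ ARCS ≡.refl) 0) (cong₂ _,_ (nats-≡ w′ TAIL ≡.refl) (cong₂ _,_ (nats-≡ w′ HEAD ≡.refl)
          (cong₂ _,_ (nats-≡ w′ REV ≡.refl) (reals-≡ w′ CAP ≡.refl)))))) D)
      pow bounds (λ v → cong-app (e CLS ≡.refl) v) (cong-app (e CLASSES ≡.refl) 0) (cong-app (e COUNT ≡.refl) 0)

theorem1p1 : (ℝ : RealNumbers) →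
    let open Networks ℝ
        open Machine ℝ
    in Σ[ P ∈ Program ] ∃[ c ] ∃[ d ]
       (∀ k-1 n → let k = suc k-1 in
        (G : Graph n) (K : Terminals k n) →
        ∃[ n′ ] Σ[ H ∈ Graph n′ ] Σ[ K′ ∈ Terminals k n′ ]
          MimickingNetwork G K H K′
          × n′ ≤ dedekind k-1
          × (P On G , K Outputs H , K′ Within (c * (n + 2 ^ k) ^ d)))
-- The cost is `coefficient mimic` times `B ^ degree mimic`; since `B` is size^9, the exponents
-- multiply to `9 * degree mimic`.
theorem1p1 ℝ = mimic , coefficient mimic , 9 * degree mimic , λ l n G K →
  let open Assembly ℝ G K
      s , τ , run , s≤ , n′ , H , K′ , mimicking , few , holds = Logic.WP-sound ℝ B {{B-nonZero}} mimic {σ₀} {Goal G K} mimic-spec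
  in n′ , H , K′ , mimicking , few , s , τ , run ,
     ≤-trans s≤ (≤-reflexive (cong (coefficient mimic *_) (^-*-assoc size 9 (degree mimic)))) , holds
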